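{- Let $q$ be a prime power and let $L$ be a line of $\mathrm{PG}(5,q)$ in the $K$-orbit $o_{14,1}$. Then the hyperplane-orbit distribution $OD_4(L)$ is $\left[4,\,\frac{q^2-1}{2}+2q-1,\,\frac{q^2-1}{2}+q-1,\,q^3-2q\right]$ if $q$ is odd, and $\left[1,\,\frac{q^2}{2}+2q,\,\frac{q^2}{2}+q,\,q^3-2q\right]$ if $q$ is even.
   Context: A point $(y_0,\dots,y_5)$ of $\mathrm{PG}(5,q)$ is identified with the nonzero symmetric matrix $\begin{bmatrix} y_0&y_1&y_2\\ y_1&y_3&y_4\\ y_2&y_4&y_5\end{bmatrix}$ up to scalar. $K\cong\mathrm{PGL}(3,q)$ acts by $M\mapsto AMA^T$, $A\in\mathrm{GL}(3,q)$. The orbit $o_{14,1}$ is the $K$-orbit of the line $\left\{\begin{bmatrix}x&0&0\\0&-(x+y)&0\\0&0&y\end{bmatrix}:(x,y)\in\mathrm{PG}(1,q)\right\}$. Hyperplanes correspond to conics of $\mathrm{PG}(2,q)$ (nonzero quadratic forms up to scalar): $\sum_{0\le i\le j\le2}a_{ij}X_iX_j$ corresponds to $a_{00}Y_0+a_{01}Y_1+a_{02}Y_2+a_{11}Y_3+a_{12}Y_4+a_{22}Y_5=0$. $\mathcal H_1,\mathcal H_{2,r},\mathcal H_{2,i},\mathcal H_3$ are the sets of hyperplanes corresponding respectively to double lines (scalar multiples of squares of linear forms), pairs of distinct real lines (products of two non-proportional linear forms over $\mathbb F_q$), pairs of conjugate imaginary lines (scalar multiples of products of two non-proportional linear forms conjugate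 over $\mathbb F_{q^2}$), and non-singular conics (those with $4a_{00}a_{11}a_{22}+a_{01}a_{02}a_{12}-a_{00}a_{12}^2-a_{11}a_{02}^2-a_{22}a_{01}^2\ne0$). $OD_4(L)=[h_1,h_{2,r},h_{2,i},h_3]$ lists the numbers of hyperplanes in $\mathcal H_1,\mathcal H_{2,r},\mathcal H_{2,i},\mathcal H_3$ containing $L$. -}

module Defs where

open import Algebra.Bundles using (CommutativeRing)
open import Algebra.Morphism.Structures using (IsRingHomomorphism)
import Algebra.Properties.Semiring.Exp as Exp
import Algebra.Properties.Semiring.Mult as Mult
import Algebra.Properties.Semiring.Sum as Sum
open import Data.Fin.Base using (Fin)
open import Data.Fin.Patterns using (0F; 1F; 2F; 3F; 4F; 5F)
open import Data.Nat.Base as ℕ using (ℕ; suc)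
open import Data.Nat.Primality using (Prime)
open import Data.Product.Base using (∃; ∃₂; _×_; _,_; proj₁)
open import Data.Vec.Base as Vec using (Vec)
open import Data.Vec.Functional using (Vector; []; _∷_)
import Data.Vec.Functional.Relation.Binary.Equality.Setoid as VecEq
open import Function.Base using (_∘_)
open import Function.Bundles using (Inverse; _⇔_)
open import Level using (Level; _⊔_)
open import Relation.Binary.Bundles using (Setoid)
import Relation.Binary.Construct.On as On
import Relation.Binary.PropositionalEquality.Core as ≡
import Relation.Binary.PropositionalEquality.Properties as ≡
import Relation.Binary.Reasoning.Setoid as ≈-Reasoning
open import Relation.Nullary.Negation.Core using (¬_)
open import Relation.Unary using (Pred; _∩_)

IsPrimePower : ℕ → Set
IsPrimePower q = ∃₂ λ p k → Prime p × q ≡.≡ p ℕ.^ suc k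

-- Elements are counted up to the equality of the setoid.
HasCardinality : ∀ {a ℓ} → Setoid a ℓ → ℕ → Set (a ⊔ ℓ)
HasCardinality S n = Inverse S (≡.setoid (Fin n))

record FiniteField c ℓ (q : ℕ) : Set (Level.suc (c ⊔ ℓ)) where
  field
    commutativeRing : CommutativeRing c ℓ
  open CommutativeRing commutativeRing public
  field
    1≉0         : 1# ≉ 0#
    inverse     : ∀ x → x ≉ 0# → ∃ λ y → x * y ≈ 1#
    cardinality : HasCardinality setoid q

-- The field 𝔽_{q²} together with an inclusion of 𝔽_q.
record QuadraticExtension {c ℓ q} (F : FiniteField c ℓ q) c′ ℓ′
       : Set (c ⊔ ℓ ⊔ Level.suc (c′ ⊔ ℓ′)) where
  private module F = FiniteField F
  field
    field₂ : FiniteField c′ ℓ′ (q ℕ.^ 2)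
  open FiniteField field₂ public
  field
    ι                  : F.Carrier → Carrier
    isRingHomomorphism : IsRingHomomorphism F.rawRing rawRing ι
  open Exp semiring using (_^_)

  conj : Carrier → Carrier
  conj x = x ^ q

module Forms {c ℓ} (R : CommutativeRing c ℓ) where
  open CommutativeRing R
  open Sum semiring using (sum)
  open Mult semiring using () renaming (_×_ to _×′_)
  open VecEq setoid public using (_≋_)

  infixl 7 _·_ _⊡_ _⊗_
  infix  8 _ᵀ
  infix  4 _∝_

  _·_ : ∀ {n} → Carrier → Vector Carrier n → Vector Carrier n
  (k · v) i = k * v i

  _∝_ : ∀ {n} → Vector Carrier n → Vector Carrier n → Set (c ⊔ ℓ)
  u ∝ v = ∃ λ k → k ≉ 0# × u ≋ k · v

  ⟨_,_⟩ : ∀ {n} → Vector Carrier n → Vector Carrier n → Carrier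
  ⟨ u , v ⟩ = sum (λ i → u i * v i)

  Matrix : Set c
  Matrix = Fin 3 → Fin 3 → Carrier

  _⊗_ : Matrix → Matrix → Matrix
  (A ⊗ B) i j = sum (λ k → A i k * B k j)

  _ᵀ : Matrix → Matrix
  (A ᵀ) i j = A j i

  I₃ : Matrix
  I₃ = (1# ∷ 0# ∷ 0# ∷ [])
     ∷ (0# ∷ 1# ∷ 0# ∷ [])
     ∷ (0# ∷ 0# ∷ 1# ∷ [])
     ∷ []

  GL₃ : Pred Matrix (c ⊔ ℓ)
  GL₃ A = ∃ λ B → (∀ i j → (A ⊗ B) i j ≈ I₃ i j) × (∀ i j → (B ⊗ A) i j ≈ I₃ i j)

  symMatrix : Vector Carrier 6 → Matrix
  symMatrix y = (y 0F ∷ y 1F ∷ y 2F ∷ [])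
              ∷ (y 1F ∷ y 3F ∷ y 4F ∷ [])
              ∷ (y 2F ∷ y 4F ∷ y 5F ∷ [])
              ∷ []

  -- A linear form is the vector of its coefficients at X₀, X₁, X₂; a quadratic
  -- form is the vector of its coefficients (a₀₀, a₀₁, a₀₂, a₁₁, a₁₂, a₂₂) at
  -- the monomials XᵢXⱼ, i ≤ j.
  LinearForm QuadraticForm : Set c
  LinearForm    = Vector Carrier 3
  QuadraticForm = Vector Carrier 6

  -- Product of two linear forms, as polynomials.
  _⊡_ : LinearForm → LinearForm → QuadraticForm
  l ⊡ m = l 0F * m 0F
        ∷ l 0F * m 1F + l 1F * m 0F
        ∷ l 0F * m 2F + l 2F * m 0F
        ∷ l 1F * m 1F
        ∷ l 1F * m 2F + l 2F * m 1F
        ∷ l 2F * m 2F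
        ∷ []

  discriminant : QuadraticForm → Carrier
  discriminant a =
    4 ×′ (a₀₀ * a₁₁ * a₂₂) + a₀₁ * a₀₂ * a₁₂
      - a₀₀ * (a₁₂ * a₁₂) - a₁₁ * (a₀₂ * a₀₂) - a₂₂ * (a₀₁ * a₀₁)
    where
    a₀₀ a₀₁ a₀₂ a₁₁ a₁₂ a₂₂ : Carrier
    a₀₀ = a 0F
    a₀₁ = a 1F
    a₀₂ = a 2F
    a₁₁ = a 3F
    a₁₂ = a 4F
    a₂₂ = a 5F

module Projective {c ℓ q} (F : FiniteField c ℓ q) where
  open FiniteField F
  open Forms commutativeRing

  infix 4 _on_ _↦[_]_

  record Point (n : ℕ) : Set (c ⊔ ℓ) where
    constructor point
    field
      coords  : Vector Carrier (suc n)
      nonzero : ¬ (∀ i → coords i ≈ 0#)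
  open Point public

  private
    ∝-refl : ∀ {n} {u : Vector Carrier n} → u ∝ u
    ∝-refl = 1# , 1≉0 , λ i → sym (*-identityˡ _)

    module _ where
      open ≈-Reasoning setoid

      ∝-sym : ∀ {n} {u v : Vector Carrier n} → u ∝ v → v ∝ u
      ∝-sym {u = u} {v} (k , k≉0 , u≈kv) with inverse k k≉0
      ... | k⁻¹ , kk⁻¹≈1 = k⁻¹ , k⁻¹≉0 , λ i → begin
          v i              ≈⟨ *-identityˡ _ ⟨
          1# * v i         ≈⟨ *-congʳ (trans (*-comm k⁻¹ k) kk⁻¹≈1) ⟨
          k⁻¹ * k * v i    ≈⟨ *-assoc _ _ _ ⟩
          k⁻¹ * (k * v i)  ≈⟨ *-congˡ (u≈kv i) ⟨
          k⁻¹ * u i        ∎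
        where
        k⁻¹≉0 : k⁻¹ ≉ 0#
        k⁻¹≉0 k⁻¹≈0 = 1≉0 (trans (sym kk⁻¹≈1) (trans (*-congˡ k⁻¹≈0) (zeroʳ k)))

      *-≉0 : ∀ {x y} → x ≉ 0# → y ≉ 0# → x * y ≉ 0#
      *-≉0 {x} {y} x≉0 y≉0 xy≈0 with inverse x x≉0
      ... | x⁻¹ , xx⁻¹≈1 = y≉0 (begin
          y              ≈⟨ *-identityˡ y ⟨
          1# * y         ≈⟨ *-congʳ (trans (*-comm x⁻¹ x) xx⁻¹≈1) ⟨
          x⁻¹ * x * y    ≈⟨ *-assoc _ _ _ ⟩
          x⁻¹ * (x * y)  ≈⟨ *-congˡ xy≈0 ⟩
          x⁻¹ * 0#       ≈⟨ zeroʳ x⁻¹ ⟩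
          0#             ∎)

    ∝-trans : ∀ {n} {u v w : Vector Carrier n} → u ∝ v → v ∝ w → u ∝ w
    ∝-trans (k , k≉0 , u≈kv) (m , m≉0 , v≈mw) =
      k * m , *-≉0 k≉0 m≉0 ,
      λ i → trans (u≈kv i) (trans (*-congˡ (v≈mw i)) (sym (*-assoc _ _ _)))

  PG : ℕ → Setoid (c ⊔ ℓ) (c ⊔ ℓ)
  PG n = record
    { Carrier       = Point n
    ; _≈_           = λ P Q → coords P ∝ coords Q
    ; isEquivalence = record { refl = ∝-refl ; sym = ∝-sym ; trans = ∝-trans }
    }

  -- A line, given by two distinct points on it.
  record Line (n : ℕ) : Set (c ⊔ ℓ) where
    field
      P₁ P₂    : Point n
      distinct : ¬ (coords P₁ ∝ coords P₂)

  _on_ : ∀ {n} → Point n → Line n → Set (c ⊔ ℓ)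
  P on L = ∃₂ λ x y → ∀ i → coords P i ≈ x * coords P₁ i + y * coords P₂ i
    where open Line L

  _↦[_]_ : Point 5 → Matrix → Point 5 → Set (c ⊔ ℓ)
  Q ↦[ A ] P = ∃ λ k → k ≉ 0# ×
    (∀ i j → symMatrix (coords P) i j ≈ k * (A ⊗ symMatrix (coords Q) ⊗ A ᵀ) i j)

  L₁₄,₁ : Pred (Point 5) (c ⊔ ℓ)
  L₁₄,₁ P = ∃ λ (s : Point 1) → let x = coords s 0F ; y = coords s 1F in
    coords P ∝ (x ∷ 0# ∷ 0# ∷ - (x + y) ∷ 0# ∷ y ∷ [])

  o₁₄,₁ : Pred (Line 5) (c ⊔ ℓ)
  o₁₄,₁ L = ∃ λ A → GL₃ A ×
    (∀ P → P on L ⇔ (∃ λ Q → L₁₄,₁ Q × Q ↦[ A ] P))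

  -- The hyperplane a₀₀Y₀ + a₀₁Y₁ + a₀₂Y₂ + a₁₁Y₃ + a₁₂Y₄ + a₂₂Y₅ = 0 is given
  -- by its coefficient vector up to scalars, that is, by the corresponding conic.
  Hyperplane : Set (c ⊔ ℓ)
  Hyperplane = Point 5

  form : Hyperplane → QuadraticForm
  form = coords

  Contains : Line 5 → Pred Hyperplane (c ⊔ ℓ)
  Contains L H = ∀ P → P on L → ⟨ form H , coords P ⟩ ≈ 0#

  Count : ∀ {p} → Pred Hyperplane p → ℕ → Set (c ⊔ ℓ ⊔ p)
  Count 𝒫 n = HasCardinality (On.setoid (PG 5) (proj₁ {B = 𝒫})) n

  𝓗₁ : Pred Hyperplane (c ⊔ ℓ)
  𝓗₁ H = ∃₂ λ k (l : LinearForm) → form H ≋ k · (l ⊡ l)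

  -- Neither factor can vanish, since a hyperplane has a nonzero form.
  𝓗₂,ᵣ : Pred Hyperplane (c ⊔ ℓ)
  𝓗₂,ᵣ H = ∃₂ λ (l m : LinearForm) → ¬ (l ∝ m) × form H ≋ l ⊡ m

  𝓗₂,ᵢ : ∀ {c′ ℓ′} → QuadraticExtension F c′ ℓ′ → Pred Hyperplane (c ⊔ c′ ⊔ ℓ′)
  𝓗₂,ᵢ E H = ∃₂ λ k (l : E.LinearForm) →
    ¬ (l E.∝ (conj ∘ l)) × (ι ∘ form H) E.≋ ι k E.· (l E.⊡ (conj ∘ l))
    where
    open QuadraticExtension E using (ι; conj)
    module E = Forms (QuadraticExtension.commutativeRing E)

  𝓗₃ : Pred Hyperplane ℓ
  𝓗₃ H = discriminant (form H) ≉ 0#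

  -- OD₄ E L [h₁, h₂ᵣ, h₂ᵢ, h₃] says that OD₄(L) = [h₁, h₂ᵣ, h₂ᵢ, h₃].
  OD₄ : ∀ {c′ ℓ′} → QuadraticExtension F c′ ℓ′ → Line 5 → Vec ℕ 4 → Set (c ⊔ ℓ ⊔ c′ ⊔ ℓ′)
  OD₄ E L (h₁ Vec.∷ h₂ᵣ Vec.∷ h₂ᵢ Vec.∷ h₃ Vec.∷ Vec.[]) =
      Count (𝓗₁     ∩ Contains L) h₁
    × Count (𝓗₂,ᵣ   ∩ Contains L) h₂ᵣ
    × Count (𝓗₂,ᵢ E ∩ Contains L) h₂ᵢ
    × Count (𝓗₃     ∩ Contains L) h₃

{-# OPTIONS --safe #-}

-- Pulling forms back along the matrix that carries the standard line to L turns
-- the hyperplanes on L into the forms with a₀₀ = a₁₁ = a₂₂.  If this common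
-- value is 0, the form is bX₀X₁ + cX₀X₂ + dX₁X₂, of discriminant bcd: there are
-- 3q pairs of real lines and (q - 1)² non-singular conics.  Otherwise it can be
-- scaled to 1, and a factorisation then has the shape
--   (X₀ + uX₁ + vX₂)(X₀ + u⁻¹X₁ + v⁻¹X₂),
-- with u, v in the multiplicative group of F for real lines, and in the group of
-- the q + 1 elements of norm one of E for conjugate lines.  The pair (u , v) is
-- unique up to simultaneous inversion, whose fixed points u² = v² = 1 give the
-- double lines; hence, with f = #{u : u² = 1}, there are f² double lines,
-- ((q - 1)² - f²)/2 real pairs and ((q + 1)² - f²)/2 imaginary ones.  The
-- scaled singular forms are the points of 4 + bcd = b² + c² + d².  For fixed b
-- this conic contains (c , d) = (2 , b), and projecting from there shows that
-- the surface has q² + 1 points; the rest of F³ is non-singular.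

module Submission where

open import Algebra.Bundles using (CommutativeMonoid; CommutativeRing; RawRing)
open import Algebra.Morphism.Structures using (IsRingHomomorphism)
import Algebra.Properties.CommutativeMonoid.Sum as MonoidSum
open import Algebra.Properties.CommutativeSemigroup using (interchange)
import Algebra.Properties.CommutativeSemiring.Binomial as Binomial
import Algebra.Properties.CommutativeSemiring.Exp as Exp
import Algebra.Properties.Monoid.Mult as MonoidMult
import Algebra.Properties.Ring as RingProperties
import Algebra.Properties.Semiring.Mult as Mult
import Algebra.Properties.Semiring.Sum as Sum
import Algebra.Solver.Ring
open import Algebra.Solver.Ring.AlmostCommutativeRing using (_-Raw-AlmostCommutative⟶_; fromCommutativeRing)
open import Data.Fin.Base as Fin using (Fin; zero; suc; toℕ; fromℕ; inject₁; inject≤)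
open import Data.Fin.Patterns using (0F; 1F; 2F; 3F; 4F; 5F)
open import Data.Fin.Permutation using (↔⇒≡)
import Data.Fin.Properties as Fin
open import Data.Maybe.Base using (Maybe; just; nothing)
open import Data.Nat.Base as ℕ using (ℕ; zero; suc; s≤s; z≤n)
open import Data.Nat.Combinatorics using (_C_; nCn≡1; nC1≡n; k>n⇒nCk≡0; nCk+nC[k+1]≡[n+1]C[k+1])
open import Data.Nat.Divisibility using (_∣_; divides; ∣⇒≤; m∣m*n; ∣m+n∣m⇒∣n)
open import Data.Nat.DivMod using (m*n/n≡m)
open import Data.Nat.Primality using (Prime; euclidsLemma)
import Data.Nat.Properties as ℕ
open import Data.Nat.Tactic.RingSolver using (solve-∀)
open import Data.Product.Base using (∃; ∃₂; _×_; _,_; proj₁; proj₂)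
open import Data.Product.Function.NonDependent.Setoid using (_×-inverse_)
open import Data.Product.Relation.Binary.Pointwise.NonDependent using (×-setoid) renaming (Pointwise-≡↔≡ to ×-Pointwise-≡↔≡)
open import Data.Sum.Base as ⊎ using (_⊎_; inj₁; inj₂; [_,_]′)
open import Data.Sum.Function.Setoid using (_⊎-inverse_)
open import Data.Sum.Relation.Binary.Pointwise using (⊎-setoid; inj₁; inj₂) renaming (Pointwise-≡↔≡ to ⊎-Pointwise-≡↔≡)
open import Data.Vec.Base as Vec using (Vec)
open import Data.Vec.Functional as Vector using (Vector)
open import Function.Base using (_∘_; id)
open import Function.Bundles using (Inverse; Equivalence)
import Function.Construct.Composition as Composition
import Function.Construct.Identity as Identity
import Function.Construct.Symmetry as Symmetry
open import Level as Level using (Level; _⊔_; Lift; lift)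
open import Relation.Binary.Bundles using (Setoid)
import Relation.Binary.Construct.On as On
open import Relation.Binary.Definitions using (tri<; tri≈; tri>; Decidable)
open import Relation.Binary.PropositionalEquality as ≡ using (_≡_)
import Relation.Binary.Reasoning.Setoid as ≈-Reasoning
open import Relation.Nullary using (¬_; Dec; yes; no; contradiction; ¬?; _×-dec_; decidable-stable)
open import Relation.Nullary.Decidable as Dec using ()
open import Relation.Unary using (Pred; ∁; _∩_)
open import Defs

-- The non-singular class is not obtained by subtracting the other three, since that would require
-- every singular form to split over `E`; the surface of singular forms is counted by itself. The
-- results fit together: f² + ((q - 1)² - f²)/2 + ((q + 1)² - f²)/2 = q² + 1, and q³ - (q² + 1) + (q
-- - 1)² = q³ - 2q. The condition on the diagonal comes from pairing a form with diag(x, -(x + y),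
-- y), which gives x(a₀₀ - a₁₁) + y(a₂₂ - a₁₁). As expressions in q and f the counts do not depend
-- on the characteristic; f is 1 if 1 + 1 = 0 and 2 otherwise, and free involutions (x + 1 on the
-- field, -x on its units) tie this alternative to the parity of q. `E` is only known as a field of
-- q² elements receiving `F`, with conjugation defined as a power map. That conjugation is additive,
-- that its fixed field is exactly `F`, and that q + 1 elements have norm one must therefore be
-- derived by counting and from the Frobenius map.

private variable
  α β ℓ ℓ₁ ℓ₂ π ρ : Level
  m n q : ℕ
  S : Setoid α ℓ
  T : Setoid β ℓ₂

-- A commutative ring solver with integer coefficients

-- An integer coefficient is a difference of naturals, one of which is zero:
-- the solver compares normal forms definitionally, so they must be canonical.
reduce : ℕ × ℕ → ℕ × ℕ
reduce (a , b) = a ℕ.∸ b , b ℕ.∸ a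

reduce-cross : ∀ a b → (a ℕ.∸ b) ℕ.+ b ≡.≡ a ℕ.+ (b ℕ.∸ a)
reduce-cross ℕ.zero    ℕ.zero    = ≡.refl
reduce-cross ℕ.zero    (ℕ.suc _) = ≡.refl
reduce-cross (ℕ.suc _) ℕ.zero    = ≡.refl
reduce-cross (ℕ.suc a) (ℕ.suc b) = ≡.trans (ℕ.+-suc (a ℕ.∸ b) b) (≡.cong ℕ.suc (reduce-cross a b))

Difference : RawRing Level.zero Level.zero
Difference = record
  { Carrier = ℕ × ℕ
  ; _≈_     = λ (a , b) (c , d) → a ℕ.+ d ≡.≡ c ℕ.+ b
  ; _+_     = λ (a , b) (c , d) → reduce (a ℕ.+ c , b ℕ.+ d)
  ; _*_     = λ (a , b) (c , d) → reduce (a ℕ.* c ℕ.+ b ℕ.* d , a ℕ.* d ℕ.+ b ℕ.* c)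
  ; -_      = λ (a , b) → b , a
  ; 0#      = 0 , 0
  ; 1#      = 1 , 0
  }

module IntegerSolver {c ℓ} (R : CommutativeRing c ℓ) where
  open CommutativeRing R
  open Mult semiring using (×-homo-+; ×1-homo-*; ×-congˡ) renaming (_×_ to _×′_)
  open RingProperties ring using (-‿distribˡ-*; -‿distribʳ-*; -‿involutive; -0#≈0#; -‿+-comm)
  open ≈-Reasoning setoid
  private
    +-swap = interchange +-commutativeSemigroup

    ⟦_⟧ : ℕ × ℕ → Carrier
    ⟦ a , b ⟧ = a ×′ 1# - b ×′ 1#

    -- Agrees with ⟦_⟧, but makes the constants 0 and 1 of the solver denote 0# and 1#.
    value : ℕ × ℕ → Carrier
    value (0 , 0) = 0#
    value (1 , 0) = 1#
    value p       = ⟦ p ⟧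

    value≈ : ∀ p → value p ≈ ⟦ p ⟧
    value≈ (0 , 0)               = sym (-‿inverseʳ 0#)
    value≈ (1 , 0)               = sym (trans (+-cong (+-identityʳ 1#) -0#≈0#) (+-identityʳ 1#))
    value≈ (ℕ.suc (ℕ.suc _) , 0) = refl
    value≈ (0 , ℕ.suc _)         = refl
    value≈ (1 , ℕ.suc _)         = refl
    value≈ (ℕ.suc (ℕ.suc _) , ℕ.suc _) = refl

    difference-* : ∀ x y z w → (x * z + y * w) - (x * w + y * z) ≈ (x - y) * (z - w)
    difference-* x y z w = sym (begin
      (x - y) * (z - w)                                   ≈⟨ distribʳ _ _ _ ⟩
      x * (z - w) + - y * (z - w)                         ≈⟨ +-cong (distribˡ _ _ _) (distribˡ _ _ _) ⟩
      (x * z + x * - w) + (- y * z + - y * - w)           ≈⟨ +-cong (+-congˡ (sym (-‿distribʳ-* x w))) (trans (+-comm _ _) (+-cong (trans (sym (-‿distribˡ-* y _)) (trans (-‿cong (sym (-‿distribʳ-* y w))) (-‿involutive _))) (sym (-‿distribˡ-* y z)))) ⟩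
      (x * z - x * w) + (y * w - y * z)                   ≈⟨ +-swap _ _ _ _ ⟩
      (x * z + y * w) + (- (x * w) - y * z)               ≈⟨ +-congˡ (-‿+-comm _ _) ⟩
      (x * z + y * w) - (x * w + y * z)                   ∎)

    ×1-homo : ∀ a b c d → (a ℕ.* b ℕ.+ c ℕ.* d) ×′ 1# ≈ (a ×′ 1#) * (b ×′ 1#) + (c ×′ 1#) * (d ×′ 1#)
    ×1-homo a b c d = trans (×-homo-+ 1# (a ℕ.* b) (c ℕ.* d)) (+-cong (×1-homo-* a b) (×1-homo-* c d))

    cross : ∀ {a b c d} → a ℕ.+ d ≡.≡ c ℕ.+ b → ⟦ a , b ⟧ ≈ ⟦ c , d ⟧
    cross {a} {b} {c} {d} a+d≡c+b = begin
      a ×′ 1# - b ×′ 1#                                    ≈⟨ +-identityʳ _ ⟨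
      (a ×′ 1# - b ×′ 1#) + 0#                             ≈⟨ +-congˡ (-‿inverseʳ (d ×′ 1#)) ⟨
      (a ×′ 1# - b ×′ 1#) + (d ×′ 1# - d ×′ 1#)            ≈⟨ +-swap _ _ _ _ ⟩
      (a ×′ 1# + d ×′ 1#) + (- (b ×′ 1#) - d ×′ 1#)        ≈⟨ +-congʳ (×-homo-+ 1# a d) ⟨
      (a ℕ.+ d) ×′ 1# + (- (b ×′ 1#) - d ×′ 1#)            ≈⟨ +-cong (×-congˡ a+d≡c+b) (+-comm _ _) ⟩
      (c ℕ.+ b) ×′ 1# + (- (d ×′ 1#) - b ×′ 1#)            ≈⟨ +-congʳ (×-homo-+ 1# c b) ⟩
      (c ×′ 1# + b ×′ 1#) + (- (d ×′ 1#) - b ×′ 1#)        ≈⟨ +-swap _ _ _ _ ⟩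
      (c ×′ 1# - d ×′ 1#) + (b ×′ 1# - b ×′ 1#)            ≈⟨ +-congˡ (-‿inverseʳ (b ×′ 1#)) ⟩
      (c ×′ 1# - d ×′ 1#) + 0#                             ≈⟨ +-identityʳ _ ⟩
      c ×′ 1# - d ×′ 1#                                    ∎
    reduce-sound : ∀ p → ⟦ reduce p ⟧ ≈ ⟦ p ⟧
    reduce-sound (a , b) = cross {a ℕ.∸ b} {b ℕ.∸ a} {a} {b} (reduce-cross a b)

    morphism : Difference -Raw-AlmostCommutative⟶ fromCommutativeRing R
    morphism = record
      { ⟦_⟧    = value
      ; +-homo = λ m@(a , b) n@(c , d) → let m+n = (a ℕ.+ c , b ℕ.+ d) in begin
          value (reduce m+n)                                ≈⟨ value≈ (reduce m+n) ⟩
          ⟦ reduce m+n ⟧                                    ≈⟨ reduce-sound m+n ⟩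
          (a ℕ.+ c) ×′ 1# - (b ℕ.+ d) ×′ 1#                 ≈⟨ +-cong (×-homo-+ 1# a c) (-‿cong (×-homo-+ 1# b d)) ⟩
          (a ×′ 1# + c ×′ 1#) - (b ×′ 1# + d ×′ 1#)         ≈⟨ +-congˡ (-‿+-comm _ _) ⟨
          (a ×′ 1# + c ×′ 1#) + (- (b ×′ 1#) - d ×′ 1#)     ≈⟨ +-swap _ _ _ _ ⟩
          ⟦ m ⟧ + ⟦ n ⟧                                     ≈⟨ +-cong (value≈ m) (value≈ n) ⟨
          value m + value n                                 ∎
      ; *-homo = λ m@(a , b) n@(c , d) → let m*n = (a ℕ.* c ℕ.+ b ℕ.* d , a ℕ.* d ℕ.+ b ℕ.* c) in begin
          value (reduce m*n)  ≈⟨ value≈ (reduce m*n) ⟩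
          ⟦ reduce m*n ⟧      ≈⟨ reduce-sound m*n ⟩
          ⟦ m*n ⟧             ≈⟨ +-cong (×1-homo a c b d) (-‿cong (×1-homo a d b c)) ⟩
          _                   ≈⟨ difference-* _ _ _ _ ⟩
          ⟦ m ⟧ * ⟦ n ⟧       ≈⟨ *-cong (value≈ m) (value≈ n) ⟨
          value m * value n   ∎
      ; -‿homo = λ m@(a , b) → begin
          value (b , a)                    ≈⟨ value≈ (b , a) ⟩
          b ×′ 1# - a ×′ 1#                ≈⟨ +-comm _ _ ⟩
          - (a ×′ 1#) + b ×′ 1#            ≈⟨ +-congˡ (-‿involutive _) ⟨
          - (a ×′ 1#) - (- (b ×′ 1#))      ≈⟨ -‿+-comm _ _ ⟩
          - ⟦ m ⟧                          ≈⟨ -‿cong (value≈ m) ⟨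
          - value m                        ∎
      ; 0-homo = refl
      ; 1-homo = refl
      }

    -- A sound semi-decision is all that the solver asks for: equal integers denote equal elements,
    -- while `nothing` does not claim inequality, as distinct integers may coincide in positive
    -- characteristic.
    _coeff≟_ : ∀ m n → Maybe (value m ≈ value n)
    m@(a , b) coeff≟ n@(c , d) with a ℕ.+ d ℕ.≟ c ℕ.+ b
    ... | yes eq = just (trans (value≈ m) (trans (cross {a} {b} {c} {d} eq) (sym (value≈ n))))
    ... | no  _  = nothing

  open Algebra.Solver.Ring Difference (fromCommutativeRing R) morphism _coeff≟_ public
    using (Polynomial; solve; con; _:+_; _:*_; _:-_; :-_; _:=_; _:×_)

  :0 :1 : ∀ {n} → Polynomial n
  :0 = con (0 , 0)
  :1 = con (1 , 0)

-- Counting finite setoids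

Subsetoid : (S : Setoid α ℓ) → Pred (Setoid.Carrier S) π → Setoid _ _
Subsetoid S P = On.setoid S (proj₁ {B = P})

card-unique : HasCardinality S m → HasCardinality S n → m ≡ n
card-unique S≅m S≅n = ↔⇒≡ (Composition.inverse (Symmetry.inverse S≅m) S≅n)

card-≟ : HasCardinality S n → Decidable (Setoid._≈_ S)
card-≟ {S = S} S≅n x y = Dec.map′
  (λ eq → S.trans (S.sym (strictlyInverseʳ x)) (S.trans (from-cong eq) (strictlyInverseʳ y)))
  to-cong (to x Fin.≟ to y)
  where
  module S = Setoid S
  open Inverse S≅n

module _ {S : Setoid α ℓ} {T : Setoid β ℓ₂} where
  private
    module S = Setoid S
    module T = Setoid T

  -- A bijection given as a relation: choices made in its definition need not
  -- respect the equality of S.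
  card-correspondence : HasCardinality S n →
    (R : S.Carrier → T.Carrier → Set ρ) →
    (∀ s → ∃ (R s)) → (∀ t → ∃ λ s → R s t) →
    (∀ {s s′ t t′} → R s t → R s′ t′ → s S.≈ s′ → t T.≈ t′) →
    (∀ {s s′ t t′} → R s t → R s′ t′ → t T.≈ t′ → s S.≈ s′) →
    HasCardinality T n
  card-correspondence S≅n R total surjective functional injective = record
    { to        = λ t → to (proj₁ (surjective t))
    ; from      = λ i → proj₁ (total (from i))
    ; to-cong   = λ {t} {t′} t≈t′ → to-cong (injective (proj₂ (surjective t)) (proj₂ (surjective t′)) t≈t′)
    ; from-cong = λ { {i} ≡.refl → T.refl }
    ; inverse   =
        (λ {i} {t} t≈ → inverseˡ (injective (proj₂ (surjective t)) (proj₂ (total (from i))) t≈)) ,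
        (λ {t} {i} i≡ → functional (proj₂ (total (from i))) (proj₂ (surjective t)) (inverseʳ i≡))
    }
    where open Inverse S≅n

card-⊎ : HasCardinality S m → HasCardinality T n → HasCardinality (⊎-setoid S T) (m ℕ.+ n)
card-⊎ S≅m T≅n = Composition.inverse (S≅m ⊎-inverse T≅n)
  (Composition.inverse (⊎-Pointwise-≡↔≡ _ _) (Symmetry.inverse Fin.+↔⊎))

card-× : HasCardinality S m → HasCardinality T n → HasCardinality (×-setoid S T) (m ℕ.* n)
card-× S≅m T≅n = Composition.inverse (S≅m ×-inverse T≅n)
  (Composition.inverse ×-Pointwise-≡↔≡ (Symmetry.inverse Fin.*↔×))

private
  Fin-subset : {P : Pred (Fin n) π} → (∀ i → Dec (P i)) →
               ∃ (HasCardinality (Subsetoid (≡.setoid (Fin n)) P))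
  Fin-subset {n = zero} P? = 0 , record
    { to = λ () ; from = λ () ; to-cong = λ { {()} } ; from-cong = λ { {()} }
    ; inverse = (λ { {()} }) , (λ { {()} }) }
  Fin-subset {n = suc n} {P = P} P? with P? zero | Fin-subset (P? ∘ suc)
  ... | no ¬P0 | m , S≅m = m , card-correspondence S≅m
    (λ s t → proj₁ t ≡ suc (proj₁ s))
    (λ (i , Pi) → (suc i , Pi) , ≡.refl)
    (λ { (zero , P0) → contradiction P0 ¬P0 ; (suc i , Pi) → (i , Pi) , ≡.refl })
    (λ { ≡.refl ≡.refl ≡.refl → ≡.refl })
    (λ { ≡.refl ≡.refl ≡.refl → ≡.refl })
  ... | yes P0 | m , S≅m = suc m , card-correspondence
    (card-⊎ (Identity.inverse (≡.setoid (Fin 1))) S≅m)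
    (λ { (inj₁ _) t → proj₁ t ≡ zero ; (inj₂ s) t → proj₁ t ≡ suc (proj₁ s) })
    (λ { (inj₁ _) → (zero , P0) , ≡.refl ; (inj₂ (i , Pi)) → (suc i , Pi) , ≡.refl })
    (λ { (zero , _) → inj₁ zero , ≡.refl ; (suc i , Pi) → inj₂ (i , Pi) , ≡.refl })
    (λ { {inj₁ _} ≡.refl ≡.refl (inj₁ _) → ≡.refl
       ; {inj₂ _} ≡.refl ≡.refl (inj₂ ≡.refl) → ≡.refl })
    (λ { {inj₁ zero} {inj₁ zero} _ _ _ → inj₁ ≡.refl
       ; {inj₁ _} {inj₂ _} ≡.refl ≡.refl ()
       ; {inj₂ _} {inj₁ _} ≡.refl ≡.refl ()
       ; {inj₂ _} {inj₂ _} ≡.refl ≡.refl ≡.refl → inj₂ ≡.refl })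

module _ {S : Setoid α ℓ} (S≅n : HasCardinality S n) where
  open Setoid S
  open Inverse S≅n

  module _ {P : Pred Carrier π} (P? : ∀ x → Dec (P x)) (P-resp : ∀ {x y} → x ≈ y → P x → P y) where

    card-subset : ∃ (HasCardinality (Subsetoid S P))
    card-subset with Fin-subset (P? ∘ from)
    ... | m , Q≅m = m , card-correspondence Q≅m
      (λ s t → proj₁ t ≈ from (proj₁ s))
      (λ (i , Pi) → (from i , Pi) , refl)
      (λ (x , Px) → (to x , P-resp (sym (strictlyInverseʳ x)) Px) , sym (strictlyInverseʳ x))
      (λ { t≈ t′≈ ≡.refl → trans t≈ (sym t′≈) })
      (λ {s} {s′} t≈ t′≈ t≈t′ → ≡.trans (≡.sym (inverseˡ t≈)) (≡.trans (to-cong t≈t′) (inverseˡ t′≈)))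

    card-partition : ∀ {k} → HasCardinality (Subsetoid S P) m → HasCardinality (Subsetoid S (∁ P)) k →
                     m ℕ.+ k ≡ n
    card-partition P≅m ∁P≅k = card-unique {S = S}
      (card-correspondence (card-⊎ P≅m ∁P≅k)
        (λ { (inj₁ s) t → proj₁ s ≈ t ; (inj₂ s) t → proj₁ s ≈ t })
        (λ { (inj₁ s) → _ , refl ; (inj₂ s) → _ , refl })
        (λ x → split x (P? x))
        (λ { {inj₁ _} s≈t s≈t′ (inj₁ s≈s′) → trans (sym s≈t) (trans s≈s′ s≈t′)
           ; {inj₂ _} s≈t s≈t′ (inj₂ s≈s′) → trans (sym s≈t) (trans s≈s′ s≈t′) })
        (λ { {inj₁ _} {inj₁ _} s≈t s≈t′ t≈t′ → inj₁ (trans s≈t (trans t≈t′ (sym s≈t′)))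
           ; {inj₂ _} {inj₂ _} s≈t s≈t′ t≈t′ → inj₂ (trans s≈t (trans t≈t′ (sym s≈t′)))
           ; {inj₁ (_ , Px)} {inj₂ (_ , ¬Py)} s≈t s≈t′ t≈t′ → contradiction (P-resp (trans s≈t (trans t≈t′ (sym s≈t′))) Px) ¬Py
           ; {inj₂ (_ , ¬Px)} {inj₁ (_ , Py)} s≈t s≈t′ t≈t′ → contradiction (P-resp (sym (trans s≈t (trans t≈t′ (sym s≈t′)))) Py) ¬Px }))
      S≅n
      where
      split : ∀ x → Dec (P x) → _
      split x (yes Px) = inj₁ (x , Px) , refl
      split x (no ¬Px) = inj₂ (x , ¬Px) , refl

  module _ {P : Pred Carrier π} (P? : ∀ x → Dec (P x)) (P-resp : ∀ {x y} → x ≈ y → P x → P y) where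

    card-complement : HasCardinality (Subsetoid S P) m →
                      ∃ λ k → m ℕ.+ k ≡ n × HasCardinality (Subsetoid S (∁ P)) k
    card-complement P≅m =
      let k , ∁P≅k = card-subset (λ x → ¬? (P? x)) (λ x≈y ¬Px Py → ¬Px (P-resp (sym x≈y) Py))
      in k , card-partition P? P-resp P≅m ∁P≅k , ∁P≅k

module Involution (S : Setoid α ℓ) (σ : Setoid.Carrier S → Setoid.Carrier S)
  (σ-congruent : ∀ x y → Setoid._≈_ S x y → Setoid._≈_ S (σ x) (σ y)) (σσ : ∀ x → Setoid._≈_ S (σ (σ x)) x) where
  open Setoid S
  private
    σ-cong : ∀ {x y} → x ≈ y → σ x ≈ σ y
    σ-cong = σ-congruent _ _

  Orbits : Setoid α ℓ
  Orbits = record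
    { Carrier       = Carrier
    ; _≈_           = λ x y → x ≈ y ⊎ x ≈ σ y
    ; isEquivalence = record
      { refl  = inj₁ refl
      ; sym   = λ { (inj₁ x≈y) → inj₁ (sym x≈y)
                  ; (inj₂ x≈σy) → inj₂ (sym (trans (σ-cong x≈σy) (σσ _))) }
      ; trans = λ { (inj₁ x≈y) (inj₁ y≈z) → inj₁ (trans x≈y y≈z)
                  ; (inj₁ x≈y) (inj₂ y≈σz) → inj₂ (trans x≈y y≈σz)
                  ; (inj₂ x≈σy) (inj₁ y≈z) → inj₂ (trans x≈σy (σ-cong y≈z))
                  ; (inj₂ x≈σy) (inj₂ y≈σz) → inj₁ (trans x≈σy (trans (σ-cong y≈σz) (σσ _))) }
      }
    }

  -- The enumeration by `Fin n` orders S, and each orbit is represented by its member of smaller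
  -- index. As σ has no fixed point, it exchanges these representatives with the remaining elements,
  -- so both halves have the same size.
  card-orbits : HasCardinality S n → (∀ x → x ≉ σ x) →
                ∃ λ m → m ℕ.+ m ≡ n × HasCardinality Orbits m
  card-orbits S≅n σ-free =
    half , card-partition S≅n <? <-resp <≅m (card-correspondence <≅m
          (λ s t → σ (proj₁ s) ≈ proj₁ t)
          (λ (x , x<σx) → (σ x , λ σx<σσx → Fin.<-asym x<σx (≡.subst (to (σ x) Fin.<_) (to-cong (σσ x)) σx<σσx)) , refl)
          (λ (x , x≮σx) → (σ x , flip x x≮σx) , σσ x)
          (λ σs≈t σs′≈t′ s≈s′ → trans (sym σs≈t) (trans (σ-cong s≈s′) σs′≈t′))
          (λ σs≈t σs′≈t′ t≈t′ → trans (sym (σσ _)) (trans (σ-cong (trans σs≈t (trans t≈t′ (sym σs′≈t′)))) (σσ _)))) ,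
    card-correspondence {T = Orbits} <≅m
      (λ s t → Setoid._≈_ Orbits (proj₁ s) t)
      (λ s → proj₁ s , inj₁ refl)
      (λ x → choose x (<? x))
      (λ s~t s′~t′ s≈s′ → Orb.trans (Orb.sym s~t) (Orb.trans (inj₁ s≈s′) s′~t′))
      (λ {s} {s′} s~t s′~t′ t~t′ → separate s s′ (Orb.trans s~t (Orb.trans t~t′ (Orb.sym s′~t′))))
    where
    open Inverse S≅n
    module Orb = Setoid Orbits

    _<σ : Pred Carrier _
    x <σ = to x Fin.< to (σ x)

    <? : ∀ x → Dec (x <σ)
    <? x = to x Fin.<? to (σ x)

    <-resp : ∀ {x y} → x ≈ y → x <σ → y <σ
    <-resp x≈y = ≡.subst₂ Fin._<_ (to-cong x≈y) (to-cong (σ-cong x≈y))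

    half = proj₁ (card-subset S≅n <? <-resp)
    <≅m = proj₂ (card-subset S≅n <? <-resp)

    flip : ∀ x → ¬ x <σ → σ x <σ
    flip x x≮σx with Fin.<-cmp (to x) (to (σ x))
    ... | tri< x<σx _ _ = contradiction x<σx x≮σx
    ... | tri≈ _ x≡σx _ = contradiction (trans (sym (strictlyInverseʳ x)) (trans (from-cong x≡σx) (strictlyInverseʳ (σ x)))) (σ-free x)
    ... | tri> _ _ σx<x = ≡.subst (to (σ x) Fin.<_) (≡.sym (to-cong (σσ x))) σx<x

    choose : ∀ x → Dec (x <σ) → ∃ λ (s : ∃ _<σ) → Setoid._≈_ Orbits (proj₁ s) x
    choose x (yes x<σx) = (x , x<σx) , inj₁ refl
    choose x (no  x≮σx) = (σ x , flip x x≮σx) , inj₂ refl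

    separate : (s s′ : ∃ _<σ) → Setoid._≈_ Orbits (proj₁ s) (proj₁ s′) → proj₁ s ≈ proj₁ s′
    separate _ _ (inj₁ s≈s′) = s≈s′
    separate (x , x<σx) (y , y<σy) (inj₂ x≈σy) = contradiction x<σx
      (λ x<σx → Fin.<-asym y<σy (≡.subst₂ Fin._<_ (to-cong x≈σy) (to-cong (trans (σ-cong x≈σy) (σσ y))) x<σx))

-- Pigeonhole: a missed `t`, put in front of the image of `f`, would give an injection of `suc n`
-- indices into `n`.
card-injective⇒surjective : HasCardinality S n → HasCardinality T n →
  (f : Setoid.Carrier S → Setoid.Carrier T) → (∀ {x y} → Setoid._≈_ T (f x) (f y) → Setoid._≈_ S x y) →
  ∀ t → ∃ λ s → Setoid._≈_ T (f s) t
card-injective⇒surjective {S = S} {n = n} {T = T} S≅n T≅n f f-injective t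
  with Fin.any? (λ i → card-≟ {S = T} T≅n (f (Inverse.from S≅n i)) t)
... | yes (i , fi≈t) = Inverse.from S≅n i , fi≈t
... | no ¬hit = contradiction (Fin.injective⇒≤ {f = index} index-injective) ℕ.1+n≰n
  where
  module S≅ = Inverse S≅n
  module T≅ = Inverse T≅n
  module T = Setoid T

  to-injective : ∀ {x y} → T≅.to x ≡ T≅.to y → x T.≈ y
  to-injective eq = T.trans (T.sym (T≅.strictlyInverseʳ _)) (T.trans (T≅.from-cong eq) (T≅.strictlyInverseʳ _))

  index : Fin (suc n) → Fin n
  index zero    = T≅.to t
  index (suc i) = T≅.to (f (S≅.from i))

  index-injective : ∀ {i j} → index i ≡ index j → i ≡ j
  index-injective {zero}  {zero}  eq = ≡.refl
  index-injective {zero}  {suc j} eq = contradiction (j , T.sym (to-injective eq)) ¬hit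
  index-injective {suc i} {zero}  eq = contradiction (i , to-injective eq) ¬hit
  index-injective {suc i} {suc j} eq = ≡.cong suc (≡.trans (≡.sym (S≅.strictlyInverseˡ i))
    (≡.trans (S≅.to-cong (f-injective (to-injective eq))) (S≅.strictlyInverseˡ j)))

-- Finite search makes the witness constructive; it later supplies an element moved by `conj`.
card-¬∀⇒∃¬ : HasCardinality S n → {P : Pred (Setoid.Carrier S) π} →
  (∀ x → Dec (P x)) → (∀ {x y} → Setoid._≈_ S x y → P x → P y) → ¬ (∀ x → P x) → ∃ λ x → ¬ P x
card-¬∀⇒∃¬ {n = n} S≅n {P} P? P-resp ¬P =
  let i , ¬Pi = Fin.¬∀⟶∃¬ n (P ∘ from) (P? ∘ from) (λ Pi → ¬P (λ x → P-resp (strictlyInverseʳ x) (Pi (to x))))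
  in from i , ¬Pi
  where open Inverse S≅n

-- Finite fields

-- Free of division, so that Euclid's lemma applies to the product on the left. The induction
-- applies Pascal's rule at both levels.
absorption : ∀ n k → suc k ℕ.* (suc n C suc k) ≡ suc n ℕ.* (n C k)
absorption zero    zero    = ≡.refl
absorption zero    (suc k) rewrite k>n⇒nCk≡0 {1} {2 ℕ.+ k} (s≤s (s≤s z≤n)) | k>n⇒nCk≡0 {0} {suc k} (s≤s z≤n) = ℕ.*-zeroʳ k
absorption (suc n) zero    = ≡.trans (ℕ.*-identityˡ _) (≡.trans (nC1≡n (2 ℕ.+ n)) (≡.sym (ℕ.*-identityʳ _)))
absorption (suc n) (suc k) = begin
  (2 ℕ.+ k) ℕ.* ((2 ℕ.+ n) C (2 ℕ.+ k))              ≡⟨ ≡.cong ((2 ℕ.+ k) ℕ.*_) (nCk+nC[k+1]≡[n+1]C[k+1] (suc n) (suc k)) ⟨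
  (2 ℕ.+ k) ℕ.* (x ℕ.+ y)                        ≡⟨ regroup k x y ⟩
  suc k ℕ.* x ℕ.+ (2 ℕ.+ k) ℕ.* y ℕ.+ x          ≡⟨ ≡.cong₂ (λ v w → v ℕ.+ w ℕ.+ x) (absorption n k) (absorption n (suc k)) ⟩
  suc n ℕ.* (n C k) ℕ.+ suc n ℕ.* (n C suc k) ℕ.+ x ≡⟨ ≡.cong (ℕ._+ x) (ℕ.*-distribˡ-+ (suc n) (n C k) (n C suc k)) ⟨
  suc n ℕ.* ((n C k) ℕ.+ (n C suc k)) ℕ.+ x          ≡⟨ ≡.cong (λ v → suc n ℕ.* v ℕ.+ x) (nCk+nC[k+1]≡[n+1]C[k+1] n k) ⟩
  suc n ℕ.* x ℕ.+ x                              ≡⟨ ℕ.+-comm (suc n ℕ.* x) x ⟩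
  (2 ℕ.+ n) ℕ.* x                                ∎
  where
  open ≡.≡-Reasoning
  x = suc n C suc k
  y = suc n C (2 ℕ.+ k)
  regroup : ∀ k x y → (2 ℕ.+ k) ℕ.* (x ℕ.+ y) ≡ suc k ℕ.* x ℕ.+ (2 ℕ.+ k) ℕ.* y ℕ.+ x
  regroup = solve-∀

-- By `absorption` p divides `suc k` times the binomial coefficient, and `suc k` is positive and too
-- small to be a multiple of p.
prime∣binomial : ∀ {p} → Prime p → ∀ k → suc k ℕ.< p → p ∣ p C suc k
prime∣binomial {suc n} p-prime k k<p
  with euclidsLemma (suc k) (suc n C suc k) p-prime (≡.subst (suc n ∣_) (≡.sym (absorption n k)) (m∣m*n (n C k)))
... | inj₁ p∣k = contradiction (∣⇒≤ p∣k) (ℕ.<⇒≱ k<p)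
... | inj₂ p∣C = p∣C

module _ {c ℓ} (M : CommutativeMonoid c ℓ) where
  open CommutativeMonoid M
  open MonoidSum M using (sum; sum-permute; sum-cong-≋; sum-replicate; ∑-distrib-+)
  open MonoidMult monoid using () renaming (_×_ to _×′_)
  open ≈-Reasoning setoid

  -- Reindexing the total by π leaves it unchanged, yet contributes one `g` per element. Over the
  -- units this yields Fermat's theorem, over the additive group the vanishing of q × 1.
  sum-translate : {S : Setoid α ℓ₁} (S≅n : HasCardinality S n) (π : Inverse S S)
    (f : Setoid.Carrier S → Carrier) (f-cong : ∀ {x y} → Setoid._≈_ S x y → f x ≈ f y) →
    ∀ g → (∀ x → f (Inverse.to π x) ≈ g ∙ f x) →
    sum (f ∘ Inverse.from S≅n) ≈ (n ×′ g) ∙ sum (f ∘ Inverse.from S≅n)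
  sum-translate {n = n} S≅n π f f-cong g f-π = begin
    sum (f ∘ from)                          ≈⟨ sum-permute (f ∘ from) (Composition.inverse (Symmetry.inverse S≅n) (Composition.inverse π S≅n)) ⟩
    sum (λ i → f (from (to (Inverse.to π (from i))))) ≈⟨ sum-cong-≋ (λ i → trans (f-cong (strictlyInverseʳ _)) (f-π (from i))) ⟩
    sum (λ i → g ∙ f (from i))              ≈⟨ ∑-distrib-+ (λ _ → g) (f ∘ from) ⟩
    sum {n} (λ _ → g) ∙ sum (f ∘ from)      ≈⟨ ∙-congʳ (sum-replicate n) ⟩
    (n ×′ g) ∙ sum (f ∘ from)               ∎
    where open Inverse S≅n

module CommutativeRingLemmas {c ℓ} (R : CommutativeRing c ℓ) where
  open CommutativeRing R hiding (zero)
  open IntegerSolver R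
  open ≈-Reasoning setoid

  x-y≈0⇒x≈y : ∀ {x y} → x - y ≈ 0# → x ≈ y
  x-y≈0⇒x≈y {x} {y} x-y≈0 = begin
    x            ≈⟨ solve 2 (λ x y → x := (x :- y) :+ y) refl x y ⟩
    (x - y) + y  ≈⟨ +-congʳ x-y≈0 ⟩
    0# + y       ≈⟨ +-identityˡ y ⟩
    y            ∎

  x≈y⇒x-y≈0 : ∀ {x y} → x ≈ y → x - y ≈ 0#
  x≈y⇒x-y≈0 x≈y = trans (+-congʳ x≈y) (-‿inverseʳ _)

  module _ where
    open Binomial commutativeSemiring using (theorem; binomialTerm)
    open Exp commutativeSemiring using (_^_; ^-assocʳ; ^-congˡ; ^-congʳ)
    open Mult semiring using (×-assocˡ; ×-assoc-*; ×-congʳ; ×-congˡ) renaming (_×_ to _×′_)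
    open Sum semiring using (sum; sum-cong-≋; sum-init-last; sum-replicate-zero)

    ×-∣-0 : ∀ {m n} → m ×′ 1# ≈ 0# → m ∣ n → ∀ x → n ×′ x ≈ 0#
    ×-∣-0 {m} m1≈0 (divides k ≡.refl) x = begin
      (k ℕ.* m) ×′ x                ≈⟨ ×-congʳ (k ℕ.* m) (*-identityˡ x) ⟨
      (k ℕ.* m) ×′ (1# * x)         ≈⟨ ×-assoc-* (k ℕ.* m) 1# x ⟨
      (k ℕ.* m) ×′ 1# * x           ≈⟨ *-congʳ (×-assocˡ 1# k m) ⟨
      k ×′ (m ×′ 1#) * x            ≈⟨ *-congʳ (×-congʳ k m1≈0) ⟩
      k ×′ 0# * x                   ≈⟨ *-congʳ (×-0 k) ⟩
      0# * x                        ≈⟨ zeroˡ x ⟩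
      0#                            ∎
      where
      ×-0 : ∀ k → k ×′ 0# ≈ 0#
      ×-0 zero    = refl
      ×-0 (suc k) = trans (+-identityˡ _) (×-0 k)

    -- In the binomial expansion all terms but the two outer ones carry a coefficient divisible by
    -- p. The term of index 0 is `y ^ p`, the last one `x ^ p`.
    frobenius-+ : ∀ {p} → Prime p → p ×′ 1# ≈ 0# → ∀ x y → (x + y) ^ p ≈ x ^ p + y ^ p
    frobenius-+ {suc n} p-prime p≈0 x y = begin
      (x + y) ^ p                                       ≈⟨ theorem p x y ⟩
      term zero + sum (term ∘ suc)                      ≈⟨ +-congˡ (sum-init-last (term ∘ suc)) ⟩
      term zero + (sum {n} (λ i → term (suc (inject₁ i))) + term (fromℕ p))
                                                        ≈⟨ +-cong first (+-cong (trans (sum-cong-≋ middle) (sum-replicate-zero n)) last) ⟩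
      y ^ p + (0# + x ^ p)                              ≈⟨ solve 2 (λ x y → y :+ (:0 :+ x) := x :+ y) refl (x ^ p) (y ^ p) ⟩
      x ^ p + y ^ p                                     ∎
      where
      p = suc n
      term = binomialTerm x y p

      first : term zero ≈ y ^ p
      first = trans (+-identityʳ _) (*-identityˡ _)

      last : term (fromℕ p) ≈ x ^ p
      last = top (toℕ (fromℕ p)) (Fin.toℕ-fromℕ p)
        where
        -- `toℕ (fromℕ p)` does not reduce to `p`; with a variable `j` in its place the equation can
        -- be matched.
        top : ∀ j → j ≡ p → (p C j) ×′ (x ^ j * y ^ (p ℕ.∸ j)) ≈ x ^ p
        top _ ≡.refl = trans (×-congˡ (nCn≡1 p)) (trans (+-identityʳ _)
          (trans (*-congˡ (^-congʳ y (ℕ.n∸n≡0 p))) (*-identityʳ _)))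

      middle : ∀ i → term (suc (inject₁ i)) ≈ 0#
      middle i = ×-∣-0 p≈0 (prime∣binomial p-prime (toℕ (inject₁ i)) (s≤s (ℕ.≤-trans (ℕ.≤-reflexive (≡.cong suc (Fin.toℕ-inject₁ i))) (Fin.toℕ<n i)))) _

    frobenius^-+ : ∀ {p} → Prime p → p ×′ 1# ≈ 0# → ∀ k x y → (x + y) ^ (p ℕ.^ k) ≈ x ^ (p ℕ.^ k) + y ^ (p ℕ.^ k)
    frobenius^-+         p-prime p≈0 zero    x y = solve 2 (λ x y → (x :+ y) :* :1 := x :* :1 :+ y :* :1) refl x y
    frobenius^-+ {p} p-prime p≈0 (suc k) x y = begin
      (x + y) ^ (p ℕ.* p ℕ.^ k)                  ≈⟨ ^-assocʳ (x + y) p (p ℕ.^ k) ⟨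
      ((x + y) ^ p) ^ (p ℕ.^ k)                  ≈⟨ ^-congˡ (p ℕ.^ k) (frobenius-+ p-prime p≈0 x y) ⟩
      (x ^ p + y ^ p) ^ (p ℕ.^ k)                ≈⟨ frobenius^-+ p-prime p≈0 k (x ^ p) (y ^ p) ⟩
      (x ^ p) ^ (p ℕ.^ k) + (y ^ p) ^ (p ℕ.^ k)  ≈⟨ +-cong (^-assocʳ x p (p ℕ.^ k)) (^-assocʳ y p (p ℕ.^ k)) ⟩
      x ^ (p ℕ.* p ℕ.^ k) + y ^ (p ℕ.* p ℕ.^ k)  ∎

module FieldLemmas {c ℓ} (K : FiniteField c ℓ q) where
  open FiniteField K hiding (zero)
  open IntegerSolver commutativeRing
  open CommutativeRingLemmas commutativeRing public
  open Exp commutativeSemiring using (_^_)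
  open Mult semiring using (×1-homo-*) renaming (_×_ to _×′_)
  open ≈-Reasoning setoid
  open RingProperties ring using (-‿involutive; -0#≈0#)

  infix 4 _≟_
  _≟_ : ∀ x y → Dec (x ≈ y)
  _≟_ = card-≟ {S = setoid} cardinality

  x*y≈0⇒x≈0∨y≈0 : ∀ {x y} → x * y ≈ 0# → x ≈ 0# ⊎ y ≈ 0#
  x*y≈0⇒x≈0∨y≈0 {x} {y} xy≈0 with x ≟ 0#
  ... | yes x≈0 = inj₁ x≈0
  ... | no  x≉0 with inverse x x≉0
  ...   | x⁻¹ , xx⁻¹≈1 = inj₂ (begin
    y              ≈⟨ *-identityˡ y ⟨
    1# * y         ≈⟨ *-congʳ xx⁻¹≈1 ⟨
    x * x⁻¹ * y    ≈⟨ solve 3 (λ x z y → x :* z :* y := z :* (x :* y)) refl x x⁻¹ y ⟩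
    x⁻¹ * (x * y)  ≈⟨ *-congˡ xy≈0 ⟩
    x⁻¹ * 0#       ≈⟨ zeroʳ x⁻¹ ⟩
    0#             ∎)

  *-≉0 : ∀ {x y} → x ≉ 0# → y ≉ 0# → x * y ≉ 0#
  *-≉0 x≉0 y≉0 xy≈0 with x*y≈0⇒x≈0∨y≈0 xy≈0
  ... | inj₁ x≈0 = x≉0 x≈0
  ... | inj₂ y≈0 = y≉0 y≈0

  x*y≉0⇒x≉0 : ∀ {x y} → x * y ≉ 0# → x ≉ 0#
  x*y≉0⇒x≉0 xy≉0 x≈0 = xy≉0 (trans (*-congʳ x≈0) (zeroˡ _))

  x*y≈1⇒x≉0 : ∀ {x y} → x * y ≈ 1# → x ≉ 0#
  x*y≈1⇒x≉0 xy≈1 = x*y≉0⇒x≉0 (λ xy≈0 → 1≉0 (trans (sym xy≈1) xy≈0))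

  *-cancelˡ-≉0 : ∀ {k x y} → k ≉ 0# → k * x ≈ k * y → x ≈ y
  *-cancelˡ-≉0 {k} {x} {y} k≉0 kx≈ky
    with x*y≈0⇒x≈0∨y≈0 (trans (solve 3 (λ k x y → k :* (x :- y) := k :* x :- k :* y) refl k x y) (x≈y⇒x-y≈0 kx≈ky))
  ... | inj₁ k≈0   = contradiction k≈0 k≉0
  ... | inj₂ x-y≈0 = x-y≈0⇒x≈y x-y≈0

  inverse-unique : ∀ {x y z} → x * y ≈ 1# → x * z ≈ 1# → y ≈ z
  inverse-unique xy≈1 xz≈1 = *-cancelˡ-≉0 (x*y≈1⇒x≉0 xy≈1) (trans xy≈1 (sym xz≈1))

  card-singleton : ∀ z → HasCardinality (Subsetoid setoid (_≈ z)) 1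
  card-singleton z = card-correspondence (Identity.inverse (≡.setoid (Fin 1)))
    (λ _ t → proj₁ t ≈ z)
    (λ _ → (z , refl) , refl)
    (λ t → zero , proj₂ t)
    (λ t≈z t′≈z _ → trans t≈z (sym t′≈z))
    (λ { {zero} {zero} _ _ _ → ≡.refl })

  Nonzero : Setoid _ _
  Nonzero = Subsetoid setoid (_≉ 0#)

  card-nonzero : ∃ λ m → suc m ≡ q × HasCardinality Nonzero m
  card-nonzero = card-complement {S = setoid} cardinality (_≟ 0#) (λ x≈y x≈0 → trans (sym x≈y) x≈0) (card-singleton 0#)

  -- Multiplication by a nonzero x permutes the m = q - 1 units, so their product P satisfies P =
  -- x^m P, and P can be cancelled.
  fermat : ∀ x → x ^ q ≈ x
  fermat x with x ≟ 0# | card-nonzero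
  ... | yes x≈0 | _ , ≡.refl , _ = trans (*-congʳ x≈0) (trans (zeroˡ _) (sym x≈0))
  ... | no  x≉0 | m , ≡.refl , N≅m = begin
    x * x ^ m ≈⟨ *-congˡ x^m≈1 ⟩
    x * 1#    ≈⟨ *-identityʳ x ⟩
    x         ∎
    where
    open MonoidSum *-commutativeMonoid using () renaming (sum to product)
    y = proj₁ (inverse x x≉0)
    xy≈1 = proj₂ (inverse x x≉0)

    shift : Inverse Nonzero Nonzero
    shift = record
      { to        = λ (z , z≉0) → x * z , *-≉0 x≉0 z≉0
      ; from      = λ (z , z≉0) → y * z , *-≉0 (x*y≈1⇒x≉0 (trans (*-comm y x) xy≈1)) z≉0
      ; to-cong   = *-congˡ
      ; from-cong = *-congˡ
      ; inverse   = (λ {s} {t} t≈ → trans (*-congˡ t≈) (cancel (proj₁ s)))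
                  , (λ {s} {t} t≈ → trans (*-congˡ t≈) (trans (solve 3 (λ x y z → y :* (x :* z) := x :* (y :* z)) refl x y (proj₁ s)) (cancel (proj₁ s))))
      }
      where
      cancel : ∀ z → x * (y * z) ≈ z
      cancel z = trans (sym (*-assoc x y z)) (trans (*-congʳ xy≈1) (*-identityˡ z))

    product≉0 : ∀ {n} (f : Fin n → Setoid.Carrier Nonzero) → product (proj₁ ∘ f) ≉ 0#
    product≉0 {zero}  f = 1≉0
    product≉0 {suc n} f = *-≉0 (proj₂ (f zero)) (product≉0 (f ∘ suc))

    x^m≈1 : x ^ m ≈ 1#
    x^m≈1 = *-cancelˡ-≉0 (product≉0 (Inverse.from N≅m)) (trans (*-comm _ _) (trans
      (sym (sum-translate *-commutativeMonoid N≅m shift proj₁ (λ eq → eq) x (λ _ → refl)))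
      (sym (*-identityʳ _))))

  -- The additive twin of `fermat`: the translation x ↦ 1 + x shows that the sum of all elements
  -- equals itself plus q × 1.
  q×1≈0 : q ×′ 1# ≈ 0#
  q×1≈0 = trans (solve 2 (λ x y → x := (x :+ y) :- y) refl _ _) (x≈y⇒x-y≈0 (sym
    (sum-translate +-commutativeMonoid cardinality shift (λ x → x) (λ eq → eq) 1# (λ _ → refl))))
    where
    shift : Inverse setoid setoid
    shift = record
      { to        = 1# +_
      ; from      = λ x → x - 1#
      ; to-cong   = +-congˡ
      ; from-cong = +-congʳ
      ; inverse   = (λ {x} y≈ → trans (+-congˡ y≈) (solve 1 (λ x → :1 :+ (x :- :1) := x) refl x))
                  , (λ {x} y≈ → trans (+-congʳ y≈) (solve 1 (λ x → (:1 :+ x) :- :1 := x) refl x))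
      }

  -- The image of p^k in the field is the k-th power of the image of p, and there are no zero
  -- divisors. The exponent is arbitrary so that both q and q² are covered.
  p×1≈0 : ∀ {p} k → q ≡ p ℕ.^ k → p ×′ 1# ≈ 0#
  p×1≈0 {p} k ≡.refl = descend k q×1≈0
    where
    descend : ∀ k → (p ℕ.^ k) ×′ 1# ≈ 0# → p ×′ 1# ≈ 0#
    descend zero    1≈0 = contradiction (trans (sym (+-identityʳ 1#)) 1≈0) 1≉0
    descend (suc k) p^k≈0 with x*y≈0⇒x≈0∨y≈0 (trans (sym (×1-homo-* p (p ℕ.^ k))) p^k≈0)
    ... | inj₁ p≈0   = p≈0
    ... | inj₂ p^k≈0 = descend k p^k≈0

  -- Here x ↦ x + 1 is an involution of the field, and 1 ≉ 0 makes it free.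
  1+1≈0⇒even : 1# + 1# ≈ 0# → ∃ λ r → r ℕ.+ r ≡ q
  1+1≈0⇒even 2≈0 =
    let r , r+r≡q , _ = Involution.card-orbits setoid (_+ 1#) (λ _ _ → +-congʳ)
                          (λ x → trans (+-assoc x 1# 1#) (trans (+-congˡ 2≈0) (+-identityʳ x)))
                          cardinality
                          (λ x x≈x+1 → 1≉0 (trans (solve 2 (λ x y → y := (x :+ y) :- x) refl x 1#) (x≈y⇒x-y≈0 (sym x≈x+1))))
    in r , r+r≡q

  -- Negation is a free involution of the units, so q - 1 is even.
  1+1≉0⇒odd : 1# + 1# ≉ 0# → ∃ λ r → suc (r ℕ.+ r) ≡ q
  1+1≉0⇒odd 2≉0 with card-nonzero
  ... | m , ≡.refl , N≅m =
    let r , r+r≡m , _ = Involution.card-orbits Nonzero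
                          (λ (x , x≉0) → - x , λ -x≈0 → x≉0 (trans (sym (-‿involutive x)) (trans (-‿cong -x≈0) -0#≈0#)))
                          (λ _ _ → -‿cong) (λ (x , _) → -‿involutive x) N≅m
                          (λ (x , x≉0) x≈-x → *-≉0 2≉0 x≉0 (trans (solve 1 (λ x → (:1 :+ :1) :* x := x :- (:- x)) refl x) (x≈y⇒x-y≈0 x≈-x)))
    in r , ≡.cong suc r+r≡m

  -- The monic polynomial of degree n with the given lower coefficients.
  evaluate : Vec Carrier n → Carrier → Carrier
  evaluate Vec.[]       x = 1#
  evaluate (c Vec.∷ cs) x = c + x * evaluate cs x

  evaluate-cong : ∀ (cs : Vec Carrier n) {x y} → x ≈ y → evaluate cs x ≈ evaluate cs y
  evaluate-cong Vec.[]       x≈y = refl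
  evaluate-cong (c Vec.∷ cs) x≈y = +-congˡ (*-cong x≈y (evaluate-cong cs x≈y))

  private
    -- Synthetic division by x - a: the values of the Horner tails at `a` are the coefficients of
    -- the quotient. The implicit leading 1 keeps the quotient monic, of degree one less.
    quotient : Vec Carrier (suc n) → Carrier → Vec Carrier n
    quotient (_ Vec.∷ Vec.[])           a = Vec.[]
    quotient (_ Vec.∷ cs@(_ Vec.∷ _))   a = evaluate cs a Vec.∷ quotient cs a

    quotient-correct : ∀ (cs : Vec Carrier (suc n)) a x →
      evaluate cs x - evaluate cs a ≈ (x - a) * evaluate (quotient cs a) x
    quotient-correct (c Vec.∷ Vec.[]) a x =
      solve 3 (λ c a x → (c :+ x :* :1) :- (c :+ a :* :1) := (x :- a) :* :1) refl c a x
    quotient-correct (c Vec.∷ cs@(_ Vec.∷ _)) a x = begin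
      (c + x * h x) - (c + a * h a)          ≈⟨ solve 5 (λ c a x hx ha → (c :+ x :* hx) :- (c :+ a :* ha) := (x :- a) :* ha :+ x :* (hx :- ha)) refl c a x (h x) (h a) ⟩
      (x - a) * h a + x * (h x - h a)        ≈⟨ +-congˡ (*-congˡ (quotient-correct cs a x)) ⟩
      (x - a) * h a + x * ((x - a) * k)      ≈⟨ solve 4 (λ a x ha k → (x :- a) :* ha :+ x :* ((x :- a) :* k) := (x :- a) :* (ha :+ x :* k)) refl a x (h a) k ⟩
      (x - a) * (h a + x * k)                ∎
      where
      h = evaluate cs
      k = evaluate (quotient cs a) x

  -- Dividing by x - r₀ lowers the degree and keeps the other roots, since distinctness makes the
  -- factor x - r₀ nonzero at each of them. In degree 0 the polynomial is the constant 1.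
  monic-roots : ∀ (cs : Vec Carrier n) (r : Fin (suc n) → Carrier) →
    (∀ {i j} → r i ≈ r j → i ≡ j) → ¬ (∀ i → evaluate cs (r i) ≈ 0#)
  monic-roots {zero}  Vec.[]  r r-injective root = 1≉0 (root zero)
  monic-roots {suc n} cs  r r-injective root =
    monic-roots (quotient cs (r zero)) (r ∘ suc) (Fin.suc-injective ∘ r-injective) root′
    where
    root′ : ∀ i → evaluate (quotient cs (r zero)) (r (suc i)) ≈ 0#
    root′ i with x*y≈0⇒x≈0∨y≈0 (trans (sym (quotient-correct cs (r zero) (r (suc i))))
                 (x≈y⇒x-y≈0 (trans (root (suc i)) (sym (root zero)))))
    ... | inj₁ eq = contradiction (r-injective (x-y≈0⇒x≈y eq)) λ ()
    ... | inj₂ eq = eq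

  -- The polynomial is x^(2+n) - x, with lower coefficients 0, -1, 0, ..., 0; an exponent of at
  -- least 2 keeps the coefficient -1 below the leading one.
  x^[2+n]≈x-roots : ∀ n (r : Fin (3 ℕ.+ n) → Carrier) →
    (∀ {i j} → r i ≈ r j → i ≡ j) → ¬ (∀ i → r i ^ (2 ℕ.+ n) ≈ r i)
  x^[2+n]≈x-roots n r r-injective fixed =
    monic-roots (0# Vec.∷ - 1# Vec.∷ Vec.replicate n 0#) r r-injective λ i → begin
      0# + r i * (- 1# + r i * evaluate (Vec.replicate n 0#) (r i))  ≈⟨ +-congˡ (*-congˡ (+-congˡ (*-congˡ (power n (r i))))) ⟩
      0# + r i * (- 1# + r i * r i ^ n)                          ≈⟨ solve 2 (λ x y → :0 :+ x :* (:- :1 :+ x :* y) := x :* (x :* y) :- x) refl (r i) (r i ^ n) ⟩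
      r i ^ (2 ℕ.+ n) - r i                                      ≈⟨ x≈y⇒x-y≈0 (fixed i) ⟩
      0#                                                         ∎
    where
    power : ∀ n x → evaluate (Vec.replicate n 0#) x ≈ x ^ n
    power zero    x = refl
    power (suc n) x = trans (+-identityˡ _) (*-congˡ (power n x))

-- The quadratic extension

2+n<[2+n]^2 : ∀ n → 2 ℕ.+ n ℕ.< (2 ℕ.+ n) ℕ.^ 2
2+n<[2+n]^2 n = ≡.subst (λ m → 2 ℕ.+ n ℕ.< (2 ℕ.+ n) ℕ.* m) (≡.sym (ℕ.*-identityʳ (2 ℕ.+ n)))
  (ℕ.m<m*n (2 ℕ.+ n) (2 ℕ.+ n) (ℕ.s≤s (ℕ.s≤s ℕ.z≤n)))

module Extension {c ℓ c′ ℓ′ q} (q-primePower : IsPrimePower q)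
  (F : FiniteField c ℓ q) (E : QuadraticExtension F c′ ℓ′) where
  private
    module F where
      open FiniteField F public
      open FieldLemmas F public
  open QuadraticExtension E hiding (zero)
  open FieldLemmas field₂
  open IntegerSolver commutativeRing
  open IsRingHomomorphism isRingHomomorphism public
    using () renaming (⟦⟧-cong to ι-cong; +-homo to ι-+; *-homo to ι-*; -‿homo to ι-neg; 0#-homo to ι-0; 1#-homo to ι-1)
  open Exp commutativeSemiring using (_^_; ^-congˡ; ^-congʳ; ^-assocʳ; ^-distrib-*)
  open ≈-Reasoning setoid
  private
    module F^ = Exp F.commutativeSemiring

  ι-≉0 : ∀ {x} → x F.≉ F.0# → ι x ≉ 0#
  ι-≉0 {x} x≉0 ιx≈0 = let y , xy≈1 = F.inverse x x≉0 in 1≉0 (begin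
    1#           ≈⟨ ι-1 ⟨
    ι F.1#       ≈⟨ ι-cong xy≈1 ⟨
    ι (x F.* y)  ≈⟨ ι-* x y ⟩
    ι x * ι y    ≈⟨ *-congʳ ιx≈0 ⟩
    0# * ι y     ≈⟨ zeroˡ _ ⟩
    0#           ∎)

  ι-injective : ∀ {x y} → ι x ≈ ι y → x F.≈ y
  ι-injective {x} {y} ιx≈ιy with (x F.- y) F.≟ F.0#
  ... | yes x-y≈0 = F.x-y≈0⇒x≈y x-y≈0
  ... | no  x-y≉0 = contradiction (begin
    ι (x F.- y)        ≈⟨ ι-+ x (F.- y) ⟩
    ι x + ι (F.- y)    ≈⟨ +-congˡ (ι-neg y) ⟩
    ι x - ι y          ≈⟨ x≈y⇒x-y≈0 ιx≈ιy ⟩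
    0#                 ∎) (ι-≉0 x-y≉0)

  ι-^ : ∀ x n → ι (x F^.^ n) ≈ ι x ^ n
  ι-^ x zero    = ι-1
  ι-^ x (suc n) = trans (ι-* x _) (*-congˡ (ι-^ x n))

  conj-cong : ∀ {x y} → x ≈ y → conj x ≈ conj y
  conj-cong = ^-congˡ q

  conj-* : ∀ x y → conj (x * y) ≈ conj x * conj y
  conj-* x y = ^-distrib-* x y q

  conj-ι : ∀ x → conj (ι x) ≈ ι x
  conj-ι x = trans (sym (ι-^ x q)) (ι-cong (F.fermat x))

  conj-1 : conj 1# ≈ 1#
  conj-1 = trans (conj-cong (sym ι-1)) (trans (conj-ι F.1#) ι-1)

  conj-conj : ∀ x → conj (conj x) ≈ x
  conj-conj x = trans (^-assocʳ x q q) (trans (^-congʳ x (≡.cong (q ℕ.*_) (≡.sym (ℕ.*-identityʳ q)))) (fermat x))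

  -- `conj` is an iterate of the Frobenius map of `E`: q is a power of p, and p × 1 vanishes in `E`
  -- because its order q² is a power of p as well.
  conj-+ : ∀ x y → conj (x + y) ≈ conj x + conj y
  conj-+ = let p , k , p-prime , q≡p^1+k = q-primePower in
    ≡.subst (λ n → ∀ x y → (x + y) ^ n ≈ x ^ n + y ^ n) (≡.sym q≡p^1+k)
      (frobenius^-+ p-prime (p×1≈0 {p} (suc k ℕ.* 2) (≡.trans (≡.cong (ℕ._^ 2) q≡p^1+k) (ℕ.^-*-assoc p (suc k) 2))) (suc k))

  conj-≉0 : ∀ {x} → x ≉ 0# → conj x ≉ 0#
  conj-≉0 {x} x≉0 conjx≈0 = let y , xy≈1 = inverse x x≉0 in
    x*y≈1⇒x≉0 (trans (sym (conj-* x y)) (trans (conj-cong xy≈1) conj-1)) conjx≈0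

  -- Otherwise every element of `E` would be a root of x^q - x; since q < q², one can pick q + 1
  -- distinct ones, too many for the degree.
  ¬conj≈id : ¬ (∀ x → conj x ≈ x)
  ¬conj≈id conj≈id with F.card-nonzero
  -- q = 1 would leave no unit in `F`, but `F.1#` is one.
  ... | zero  , _ , N≅0 = contradiction (Inverse.to N≅0 (F.1# , F.1≉0)) λ ()
  ... | suc n , 2+n≡q , _ = x^[2+n]≈x-roots n (λ i → from (inject≤ i (≤-q^2)))
    (λ eq → Fin.inject≤-injective ≤-q^2 ≤-q^2 _ _ (≡.trans (≡.sym (strictlyInverseˡ _)) (≡.trans (to-cong eq) (strictlyInverseˡ _))))
    (λ i → trans (^-congʳ _ 2+n≡q) (conj≈id _))
    where
    open Inverse cardinality
    ≤-q^2 : 3 ℕ.+ n ℕ.≤ q ℕ.^ 2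
    ≤-q^2 = ≡.subst (λ q → 3 ℕ.+ n ℕ.≤ q ℕ.^ 2) 2+n≡q (2+n<[2+n]^2 n)

  private
    abstract
      -- Any element moved by `conj` serves: together with 1 it will be a basis of `E` over `F`.
      -- Nothing but the inequality matters, so the search stays opaque.
      generator : ∃ λ θ → conj θ ≉ θ
      generator = card-¬∀⇒∃¬ {S = setoid} cardinality (λ x → conj x ≟ x)
        (λ x≈y cx≈x → trans (conj-cong (sym x≈y)) (trans cx≈x x≈y)) ¬conj≈id

    θ = proj₁ generator
    θ′ = conj θ

    θ′-θ≉0 : θ′ - θ ≉ 0#
    θ′-θ≉0 eq = proj₂ generator (x-y≈0⇒x≈y eq)

    conj-line : ∀ x y → conj (ι x + ι y * θ) ≈ ι x + ι y * θ′
    conj-line x y = trans (conj-+ _ _) (+-cong (conj-ι x) (trans (conj-* _ _) (*-congʳ (conj-ι y))))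

    -- Conjugation fixes the coordinates and replaces θ by θ′. Subtracting an equation from its
    -- conjugate leaves (θ′ - θ) y = (θ′ - θ) y′, where θ′ - θ can be cancelled.
    line-injective : ∀ {x y x′ y′} → ι x + ι y * θ ≈ ι x′ + ι y′ * θ → x F.≈ x′ × y F.≈ y′
    line-injective {x} {y} {x′} {y′} eq = ι-injective ιx≈ , ι-injective ιy≈
      where
      ιy≈ : ι y ≈ ι y′
      ιy≈ = *-cancelˡ-≉0 θ′-θ≉0 (begin
        (θ′ - θ) * ι y                               ≈⟨ solve 4 (λ x y t t′ → (t′ :- t) :* y := (x :+ y :* t′) :- (x :+ y :* t)) refl (ι x) (ι y) θ θ′ ⟩
        (ι x + ι y * θ′) - (ι x + ι y * θ)           ≈⟨ +-cong (trans (sym (conj-line x y)) (trans (conj-cong eq) (conj-line x′ y′))) (-‿cong eq) ⟩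
        (ι x′ + ι y′ * θ′) - (ι x′ + ι y′ * θ)       ≈⟨ solve 4 (λ x y t t′ → (x :+ y :* t′) :- (x :+ y :* t) := (t′ :- t) :* y) refl (ι x′) (ι y′) θ θ′ ⟩
        (θ′ - θ) * ι y′                              ∎)
      ιx≈ : ι x ≈ ι x′
      ιx≈ = begin
        ι x                                ≈⟨ solve 2 (λ x y → x := (x :+ y) :- y) refl (ι x) (ι y * θ) ⟩
        (ι x + ι y * θ) - ι y * θ          ≈⟨ +-cong eq (-‿cong (*-congʳ ιy≈)) ⟩
        (ι x′ + ι y′ * θ) - ι y′ * θ       ≈⟨ solve 2 (λ x y → (x :+ y) :- y := x) refl (ι x′) (ι y′ * θ) ⟩
        ι x′                               ∎

    card-F×F : HasCardinality (×-setoid F.setoid F.setoid) (q ℕ.^ 2)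
    card-F×F = ≡.subst (HasCardinality (×-setoid F.setoid F.setoid)) (≡.cong (q ℕ.*_) (≡.sym (ℕ.*-identityʳ q))) (card-× F.cardinality F.cardinality)

    abstract
      -- A count replaces the dimension argument: an injection of the q² pairs into the q² elements
      -- of `E` is onto.
      coordinates : ∀ z → ∃₂ λ x y → ι x + ι y * θ ≈ z
      coordinates z =
        let (x , y) , eq = card-injective⇒surjective {S = ×-setoid F.setoid F.setoid} {T = setoid} card-F×F cardinality
              (λ (x , y) → ι x + ι y * θ) line-injective z
        in x , y , eq

  abstract
    -- For z = x + yθ, comparison with the conjugate x + yθ′ gives (θ′ - θ) y = 0, hence y = 0.
    conj-fixed⇒ι : ∀ {z} → conj z ≈ z → ∃ λ x → ι x ≈ z
    conj-fixed⇒ι {z} conjz≈z = let x , y , xyθ≈z = coordinates z in x , fixed x y xyθ≈z conjz≈z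

      where
      fixed : ∀ x y → ι x + ι y * θ ≈ z → conj z ≈ z → ι x ≈ z
      fixed x y xyθ≈z conjz≈z = begin
        ι x              ≈⟨ solve 2 (λ x t → x := x :+ :0 :* t) refl (ι x) θ ⟩
        ι x + 0# * θ     ≈⟨ +-congˡ (*-congʳ (sym ιy≈0)) ⟩
        ι x + ι y * θ    ≈⟨ xyθ≈z ⟩
        z                ∎
        where
        ιy≈0 : ι y ≈ 0#
        ιy≈0 = *-cancelˡ-≉0 θ′-θ≉0 (begin
          (θ′ - θ) * ι y                               ≈⟨ solve 4 (λ x y t t′ → (t′ :- t) :* y := (x :+ y :* t′) :- (x :+ y :* t)) refl (ι x) (ι y) θ θ′ ⟩
          (ι x + ι y * θ′) - (ι x + ι y * θ)           ≈⟨ x≈y⇒x-y≈0 (trans (sym (conj-line x y)) (trans (conj-cong xyθ≈z) (trans conjz≈z (sym xyθ≈z)))) ⟩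
          0#                                           ≈⟨ zeroʳ _ ⟨
          (θ′ - θ) * 0#                                ∎)

  NormOne : Carrier → Set ℓ′
  NormOne u = u * conj u ≈ 1#

  -- The elements of norm one are 1 and the conj (θ + t) / (θ + t), t ∈ F.
  card-normOne : HasCardinality (Subsetoid setoid NormOne) (suc q)
  card-normOne = card-correspondence (card-⊎ (Identity.inverse (≡.setoid (Fin 1))) F.cardinality)
    R total surjective
    (λ {s} {s′} {u} {u′} → functional {s} {s′} {u} {u′}) (λ {s} {s′} {u} {u′} → injective {s} {s′} {u} {u′})
    where
    module S = Setoid (⊎-setoid (≡.setoid (Fin 1)) F.setoid)

    R : Fin 1 ⊎ F.Carrier → ∃ NormOne → Set ℓ′
    R (inj₁ _) (u , _) = u ≈ 1#
    R (inj₂ t) (u , _) = u * (θ + ι t) ≈ θ′ + ι t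

    conj-θ+ : ∀ t → conj (θ + ι t) ≈ θ′ + ι t
    conj-θ+ t = trans (conj-+ θ (ι t)) (+-congˡ (conj-ι t))

    -- If θ + t vanished, so would its conjugate θ′ + t, and with it the difference θ′ - θ.
    θ+≉0 : ∀ t → θ + ι t ≉ 0#
    θ+≉0 t eq = θ′-θ≉0 (begin
      θ′ - θ                        ≈⟨ solve 3 (λ a b t → a :- b := (a :+ t) :- (b :+ t)) refl θ′ θ (ι t) ⟩
      (θ′ + ι t) - (θ + ι t)        ≈⟨ +-congʳ (conj-θ+ t) ⟨
      conj (θ + ι t) - (θ + ι t)    ≈⟨ +-cong (conj-cong (trans eq (sym ι-0))) (-‿cong (trans eq (sym ι-0))) ⟩
      conj (ι F.0#) - ι F.0#        ≈⟨ x≈y⇒x-y≈0 (conj-ι F.0#) ⟩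
      0#                            ∎)

    total : ∀ s → ∃ (R s)
    total (inj₁ _) = (1# , trans (*-identityˡ _) conj-1) , refl
    total (inj₂ t) = (z′ * w , norm) , (begin
      z′ * w * z    ≈⟨ solve 3 (λ a b c → a :* b :* c := a :* (c :* b)) refl z′ w z ⟩
      z′ * (z * w)  ≈⟨ trans (*-congˡ zw≈1) (*-identityʳ z′) ⟩
      z′            ∎)
      where
      z = θ + ι t
      z′ = θ′ + ι t
      w = proj₁ (inverse z (θ+≉0 t))
      zw≈1 = proj₂ (inverse z (θ+≉0 t))
      norm : NormOne (z′ * w)
      norm = begin
        z′ * w * conj (z′ * w)            ≈⟨ *-congˡ (conj-* z′ w) ⟩
        z′ * w * (conj z′ * conj w)       ≈⟨ *-congˡ (*-congʳ (trans (conj-cong (sym (conj-θ+ t))) (conj-conj z))) ⟩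
        z′ * w * (z * conj w)             ≈⟨ solve 4 (λ a b c d → a :* b :* (c :* d) := (c :* b) :* (a :* d)) refl z′ w z (conj w) ⟩
        z * w * (z′ * conj w)             ≈⟨ *-cong zw≈1 (trans (*-congʳ (sym (conj-θ+ t))) (trans (sym (conj-* z w)) (trans (conj-cong zw≈1) conj-1))) ⟩
        1# * 1#                           ≈⟨ *-identityˡ 1# ⟩
        1#                                ∎

    surjective : ∀ u → ∃ λ s → R s u
    surjective (u , uū≈1) with u ≟ 1#
    ... | yes u≈1 = inj₁ zero , u≈1
    ... | no  u≉1 = inj₂ (proj₁ fixed) , (begin
      u * (θ + ι (proj₁ fixed))   ≈⟨ *-congˡ (+-congˡ (proj₂ fixed)) ⟩
      u * (θ + t)                 ≈⟨ solve 4 (λ u a b w → u :* (a :+ (u :* a :- b) :* w) := (b :+ (u :* a :- b) :* w) :+ (u :* a :- b) :* (:1 :- (:1 :- u) :* w)) refl u θ θ′ w ⟩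
      (θ′ + t) + (u * θ - θ′) * (1# - (1# - u) * w)  ≈⟨ +-congˡ (trans (*-congˡ (x≈y⇒x-y≈0 (sym dw≈1))) (zeroʳ _)) ⟩
      (θ′ + t) + 0#               ≈⟨ +-identityʳ _ ⟩
      θ′ + t                      ≈⟨ +-congˡ (proj₂ fixed) ⟨
      θ′ + ι (proj₁ fixed)        ∎)
      where
      ū = conj u
      d≉0 : 1# - u ≉ 0#
      d≉0 d≈0 = u≉1 (sym (x-y≈0⇒x≈y d≈0))
      w = proj₁ (inverse (1# - u) d≉0)
      dw≈1 = proj₂ (inverse (1# - u) d≉0)
      t = (u * θ - θ′) * w
      neg-conj : ∀ x → conj (- x) ≈ - conj x
      neg-conj x = trans (solve 2 (λ a b → a := (a :+ b) :- b) refl (conj (- x)) (conj x))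
        (trans (+-congʳ (trans (sym (conj-+ (- x) x)) (trans (conj-cong (trans (-‿inverseˡ x) (sym ι-0))) (trans (conj-ι F.0#) ι-0)))) (+-identityˡ _))
      conj-t : conj t ≈ (ū * θ′ - θ) * conj w
      conj-t = trans (conj-* _ _) (*-congʳ (trans (conj-+ _ _) (+-cong (conj-* u θ) (trans (neg-conj θ′) (-‿cong (conj-conj θ))))))
      d′w′≈1 : (1# - ū) * conj w ≈ 1#
      d′w′≈1 = trans (*-congʳ (sym (trans (conj-+ 1# (- u)) (+-cong conj-1 (neg-conj u))))) (trans (sym (conj-* _ w)) (trans (conj-cong dw≈1) conj-1))
      -- As u ū = 1, multiplying numerator and denominator of conj t = (ūθ′ - θ)/(1 - ū) by u gives
      -- (θ′ - uθ)/(u - 1) = t. The denominators are cleared by the factor u (1 - u)(1 - ū).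
      conj-t≈t : conj t ≈ t
      conj-t≈t = *-cancelˡ-≉0 (*-≉0 (x*y≈1⇒x≉0 uū≈1) (*-≉0 d≉0 (x*y≈1⇒x≉0 d′w′≈1))) (begin
        u * ((1# - u) * (1# - ū)) * conj t                      ≈⟨ *-congˡ conj-t ⟩
        u * ((1# - u) * (1# - ū)) * ((ū * θ′ - θ) * conj w)     ≈⟨ solve 5 (λ u v a b w′ → u :* ((:1 :- u) :* (:1 :- v)) :* ((v :* b :- a) :* w′) := (u :* v :* b :- u :* a) :* (:1 :- u) :* ((:1 :- v) :* w′)) refl u ū θ θ′ (conj w) ⟩
        (u * ū * θ′ - u * θ) * (1# - u) * ((1# - ū) * conj w)   ≈⟨ *-cong (*-congʳ (+-congʳ (*-congʳ uū≈1))) d′w′≈1 ⟩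
        (1# * θ′ - u * θ) * (1# - u) * 1#                       ≈⟨ solve 3 (λ u a b → (:1 :* b :- u :* a) :* (:1 :- u) :* :1 := (u :* a :- b) :* (u :- :1)) refl u θ θ′ ⟩
        (u * θ - θ′) * (u - 1#)                                 ≈⟨ *-congˡ (+-congˡ (-‿cong uū≈1)) ⟨
        (u * θ - θ′) * (u - u * ū)                              ≈⟨ *-congˡ (*-identityʳ _) ⟨
        (u * θ - θ′) * ((u - u * ū) * 1#)                       ≈⟨ *-congˡ (*-congˡ dw≈1) ⟨
        (u * θ - θ′) * ((u - u * ū) * ((1# - u) * w))           ≈⟨ solve 5 (λ u v a b w → (u :* a :- b) :* ((u :- u :* v) :* ((:1 :- u) :* w)) := u :* ((:1 :- u) :* (:1 :- v)) :* ((u :* a :- b) :* w)) refl u ū θ θ′ w ⟩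
        u * ((1# - u) * (1# - ū)) * t                           ∎)
      fixed = conj-fixed⇒ι conj-t≈t

    1-not-quotient : ∀ {u t} → u ≈ 1# → u * (θ + ι t) ≉ θ′ + ι t
    1-not-quotient {u} {t} u≈1 eq = θ′-θ≉0 (begin
      θ′ - θ                             ≈⟨ solve 3 (λ a b t → a :- b := (a :+ t) :- :1 :* (b :+ t)) refl θ′ θ (ι t) ⟩
      (θ′ + ι t) - 1# * (θ + ι t)        ≈⟨ x≈y⇒x-y≈0 (trans (sym eq) (*-congʳ u≈1)) ⟩
      0#                                 ∎)

    functional : ∀ {s s′ u u′} → R s u → R s′ u′ → s S.≈ s′ → proj₁ u ≈ proj₁ u′
    functional {inj₁ _} u≈1 u′≈1 (inj₁ _) = trans u≈1 (sym u′≈1)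
    functional {inj₂ t} {inj₂ t′} {u , _} {u′ , _} ut≈ u′t≈ (inj₂ t≈t′) = *-cancelˡ-≉0 (θ+≉0 t)
      (trans (*-comm _ u) (trans ut≈ (trans (+-congˡ (ι-cong t≈t′)) (trans (sym u′t≈) (trans (*-congˡ (+-congˡ (ι-cong (F.sym t≈t′)))) (*-comm u′ _))))))

    -- t ↦ (θ′ + t)/(θ + t) is a Möbius map with determinant θ - θ′, which is nonzero; for the same
    -- reason it never takes the value 1.
    injective : ∀ {s s′ u u′} → R s u → R s′ u′ → proj₁ u ≈ proj₁ u′ → s S.≈ s′
    injective {inj₁ zero} {inj₁ zero} _ _ _ = inj₁ ≡.refl
    injective {inj₁ _} {inj₂ _} u≈1 u′t≈ u≈u′ = contradiction u′t≈ (1-not-quotient (trans (sym u≈u′) u≈1))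
    injective {inj₂ _} {inj₁ _} ut≈ u′≈1 u≈u′ = contradiction ut≈ (1-not-quotient (trans u≈u′ u′≈1))
    injective {inj₂ t} {inj₂ t′} {u , _} {u′ , _} ut≈ u′t≈ u≈u′ = inj₂ (ι-injective (*-cancelˡ-≉0 θ′-θ≉0 (begin
      (θ′ - θ) * ι t                                          ≈⟨ solve 4 (λ a b s t → (b :- a) :* s := (b :+ t) :* (a :+ s) :- (b :+ s) :* (a :+ t) :+ (b :- a) :* t) refl θ θ′ (ι t) (ι t′) ⟩
      (θ′ + ι t′) * (θ + ι t) - (θ′ + ι t) * (θ + ι t′) + (θ′ - θ) * ι t′  ≈⟨ +-congʳ (x≈y⇒x-y≈0 cross) ⟩
      0# + (θ′ - θ) * ι t′                                    ≈⟨ +-identityˡ _ ⟩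
      (θ′ - θ) * ι t′                                         ∎)))
      where
      cross : (θ′ + ι t′) * (θ + ι t) ≈ (θ′ + ι t) * (θ + ι t′)
      cross = begin
        (θ′ + ι t′) * (θ + ι t)        ≈⟨ *-congʳ (trans (*-congʳ u≈u′) u′t≈) ⟨
        u * (θ + ι t′) * (θ + ι t)     ≈⟨ solve 3 (λ u a b → u :* a :* b := u :* b :* a) refl u (θ + ι t′) (θ + ι t) ⟩
        u * (θ + ι t) * (θ + ι t′)     ≈⟨ *-congʳ ut≈ ⟩
        (θ′ + ι t) * (θ + ι t′)        ∎

-- Substitution in quadratic forms

-- These expressions are instantiated both in the ring and in the syntax of its solver.
module Expressions {x} {X : Set x} (_+_ _*_ : X → X → X) (0# : X) where
  open Vector using ([]; _∷_)
  infixl 6 _+′_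
  infixl 7 _*′_
  private
    _+′_ = _+_
    _*′_ = _*_

  -- The trailing `0#` makes this the unfolding of `sum` over three indices, so that `⊗` and `⟨_,_⟩`
  -- agree with these expressions by computation.
  sum₃ : Vector X 3 → X
  sum₃ f = f 0F +′ (f 1F +′ (f 2F +′ 0#))

  column : (Fin 3 → Fin 3 → X) → Fin 3 → Vector X 3
  column A j i = A i j

  apply : (Fin 3 → Fin 3 → X) → Vector X 3 → Vector X 3
  apply A x i = sum₃ (λ j → A i j *′ x j)

  value : Vector X 6 → Vector X 3 → X
  value a x =
    a 0F *′ (x 0F *′ x 0F) +′ a 1F *′ (x 0F *′ x 1F) +′ a 2F *′ (x 0F *′ x 2F)
    +′ a 3F *′ (x 1F *′ x 1F) +′ a 4F *′ (x 1F *′ x 2F) +′ a 5F *′ (x 2F *′ x 2F)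

  -- The polarisation Q(x + y) - Q(x) - Q(y), which is why the square terms occur doubled. It gives
  -- the mixed coefficients of a substituted form without division by 2.
  polar : Vector X 6 → Vector X 3 → Vector X 3 → X
  polar a x y =
    a 0F *′ (x 0F *′ y 0F +′ x 0F *′ y 0F) +′ a 1F *′ (x 0F *′ y 1F +′ x 1F *′ y 0F) +′ a 2F *′ (x 0F *′ y 2F +′ x 2F *′ y 0F)
    +′ a 3F *′ (x 1F *′ y 1F +′ x 1F *′ y 1F) +′ a 4F *′ (x 1F *′ y 2F +′ x 2F *′ y 1F) +′ a 5F *′ (x 2F *′ y 2F +′ x 2F *′ y 2F)

  -- The form with value a (A v) at v.
  pullback : (Fin 3 → Fin 3 → X) → Vector X 6 → Vector X 6
  pullback A a =
    value a (column A 0F) ∷ polar a (column A 0F) (column A 1F) ∷ polar a (column A 0F) (column A 2F)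
    ∷ value a (column A 1F) ∷ polar a (column A 1F) (column A 2F) ∷ value a (column A 2F) ∷ []

  pairing : Vector X 6 → Vector X 6 → X
  pairing a b = a 0F *′ b 0F +′ (a 1F *′ b 1F +′ (a 2F *′ b 2F +′ (a 3F *′ b 3F +′ (a 4F *′ b 4F +′ (a 5F *′ b 5F +′ 0#)))))

  -- The entries of A M Aᵀ, with the matrix of `symMatrix` inlined so that the formula also makes
  -- sense in the syntax of the solver.
  congruent : (Fin 3 → Fin 3 → X) → Vector X 6 → Fin 3 → Fin 3 → X
  congruent A y i j = sum₃ (λ k → apply A (λ l → M l k) i *′ A j k)
    where
    M : Fin 3 → Fin 3 → X
    M = (y 0F ∷ y 1F ∷ y 2F ∷ []) ∷ (y 1F ∷ y 3F ∷ y 4F ∷ []) ∷ (y 2F ∷ y 4F ∷ y 5F ∷ []) ∷ []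

module Pullbacks {c ℓ} (R : CommutativeRing c ℓ) where
  open Vector using ([]; _∷_)
  open CommutativeRing R
  open Forms R
  open IntegerSolver R
  open Mult semiring using (×-congʳ)
  open Expressions _+_ _*_ 0# public
  open ≈-Reasoning setoid
  private
    module P {n : ℕ} = Expressions {X = Polynomial n} _:+_ _:*_ :0

    disc : ∀ {n} (a₀ a₁ a₂ a₃ a₄ a₅ : Polynomial n) → Polynomial n
    disc a₀ a₁ a₂ a₃ a₄ a₅ = 4 :× (a₀ :* a₃ :* a₅) :+ a₁ :* a₂ :* a₄
      :- a₀ :* (a₄ :* a₄) :- a₃ :* (a₂ :* a₂) :- a₅ :* (a₁ :* a₁)

    discᵥ : ∀ {n} → Vector (Polynomial n) 6 → Polynomial n
    discᵥ a = disc (a 0F) (a 1F) (a 2F) (a 3F) (a 4F) (a 5F)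

    I : ∀ {n} → Fin 3 → Fin 3 → Polynomial n
    I = (:1 ∷ :0 ∷ :0 ∷ []) ∷ (:0 ∷ :1 ∷ :0 ∷ []) ∷ (:0 ∷ :0 ∷ :1 ∷ []) ∷ []

  transform : Matrix → LinearForm → LinearForm
  transform A l j = sum₃ (λ i → l i * A i j)

  -- The witness is the square of det A. The discriminant is the half-determinant of a ternary form,
  -- so the identity has integer coefficients and holds in characteristic two as well.
  pullback-det : ∀ A a → ∃ λ d → discriminant (pullback A a) ≈ d * discriminant a
  pullback-det A a = _ , solve 15 (λ a₀ a₁ a₂ a₃ a₄ a₅ x₀ x₁ x₂ y₀ y₁ y₂ z₀ z₁ z₂ →
    let a = a₀ ∷ a₁ ∷ a₂ ∷ a₃ ∷ a₄ ∷ a₅ ∷ []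
        det = x₀ :* (y₁ :* z₂ :- y₂ :* z₁) :- x₁ :* (y₀ :* z₂ :- y₂ :* z₀) :+ x₂ :* (y₀ :* z₁ :- y₁ :* z₀)
    in discᵥ (P.pullback ((x₀ ∷ y₀ ∷ z₀ ∷ []) ∷ (x₁ ∷ y₁ ∷ z₁ ∷ []) ∷ (x₂ ∷ y₂ ∷ z₂ ∷ []) ∷ []) a) := (det :* det) :* discᵥ a)
    refl (a 0F) (a 1F) (a 2F) (a 3F) (a 4F) (a 5F) (A 0F 0F) (A 1F 0F) (A 2F 0F) (A 0F 1F) (A 1F 1F) (A 2F 1F) (A 0F 2F) (A 1F 2F) (A 2F 2F)

  value-pullback : ∀ A a x → value (pullback A a) x ≈ value a (apply A x)
  value-pullback A a x = solve 18 (λ a₀ a₁ a₂ a₃ a₄ a₅ x₀ x₁ x₂ y₀ y₁ y₂ z₀ z₁ z₂ s₀ s₁ s₂ →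
    let a = a₀ ∷ a₁ ∷ a₂ ∷ a₃ ∷ a₄ ∷ a₅ ∷ []
        A = (x₀ ∷ y₀ ∷ z₀ ∷ []) ∷ (x₁ ∷ y₁ ∷ z₁ ∷ []) ∷ (x₂ ∷ y₂ ∷ z₂ ∷ []) ∷ []
        s = s₀ ∷ s₁ ∷ s₂ ∷ []
    in P.value (P.pullback A a) s := P.value a (P.apply A s))
    refl (a 0F) (a 1F) (a 2F) (a 3F) (a 4F) (a 5F) (A 0F 0F) (A 1F 0F) (A 2F 0F) (A 0F 1F) (A 1F 1F) (A 2F 1F) (A 0F 2F) (A 1F 2F) (A 2F 2F)
    (x 0F) (x 1F) (x 2F)

  polar-pullback : ∀ A a x y → polar (pullback A a) x y ≈ polar a (apply A x) (apply A y)
  polar-pullback A a x y = solve 21 (λ a₀ a₁ a₂ a₃ a₄ a₅ x₀ x₁ x₂ y₀ y₁ y₂ z₀ z₁ z₂ s₀ s₁ s₂ t₀ t₁ t₂ →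
    let a = a₀ ∷ a₁ ∷ a₂ ∷ a₃ ∷ a₄ ∷ a₅ ∷ []
        A = (x₀ ∷ y₀ ∷ z₀ ∷ []) ∷ (x₁ ∷ y₁ ∷ z₁ ∷ []) ∷ (x₂ ∷ y₂ ∷ z₂ ∷ []) ∷ []
        s = s₀ ∷ s₁ ∷ s₂ ∷ []
        t = t₀ ∷ t₁ ∷ t₂ ∷ []
    in P.polar (P.pullback A a) s t := P.polar a (P.apply A s) (P.apply A t))
    refl (a 0F) (a 1F) (a 2F) (a 3F) (a 4F) (a 5F) (A 0F 0F) (A 1F 0F) (A 2F 0F) (A 0F 1F) (A 1F 1F) (A 2F 1F) (A 0F 2F) (A 1F 2F) (A 2F 2F)
    (x 0F) (x 1F) (x 2F) (y 0F) (y 1F) (y 2F)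

  -- The duality that turns the action on points into substitution in conics: on a rank one matrix v
  -- vᵀ both sides are the value of `a` at A v, and both are linear in the matrix.
  pairing-congruent : ∀ A a y →
    ⟨ a , (λ { 0F → congruent A y 0F 0F ; 1F → congruent A y 0F 1F ; 2F → congruent A y 0F 2F
             ; 3F → congruent A y 1F 1F ; 4F → congruent A y 1F 2F ; 5F → congruent A y 2F 2F }) ⟩ ≈ ⟨ pullback A a , y ⟩
  pairing-congruent A a y = solve 21 (λ a₀ a₁ a₂ a₃ a₄ a₅ x₀ x₁ x₂ y₀ y₁ y₂ z₀ z₁ z₂ s₀ s₁ s₂ s₃ s₄ s₅ →
    let a = a₀ ∷ a₁ ∷ a₂ ∷ a₃ ∷ a₄ ∷ a₅ ∷ []
        A = (x₀ ∷ y₀ ∷ z₀ ∷ []) ∷ (x₁ ∷ y₁ ∷ z₁ ∷ []) ∷ (x₂ ∷ y₂ ∷ z₂ ∷ []) ∷ []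
        s = s₀ ∷ s₁ ∷ s₂ ∷ s₃ ∷ s₄ ∷ s₅ ∷ []
        N = P.congruent A s
    in P.pairing a (N 0F 0F ∷ N 0F 1F ∷ N 0F 2F ∷ N 1F 1F ∷ N 1F 2F ∷ N 2F 2F ∷ []) := P.pairing (P.pullback A a) s)
    refl (a 0F) (a 1F) (a 2F) (a 3F) (a 4F) (a 5F) (A 0F 0F) (A 1F 0F) (A 2F 0F) (A 0F 1F) (A 1F 1F) (A 2F 1F) (A 0F 2F) (A 1F 2F) (A 2F 2F)
    (y 0F) (y 1F) (y 2F) (y 3F) (y 4F) (y 5F)

  value-⊡ : ∀ l m x → value (l ⊡ m) x ≈ sum₃ (λ i → l i * x i) * sum₃ (λ i → m i * x i)
  value-⊡ l m x = solve 9 (λ l₀ l₁ l₂ m₀ m₁ m₂ x₀ x₁ x₂ →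
    P.value (l₀ :* m₀ ∷ l₀ :* m₁ :+ l₁ :* m₀ ∷ l₀ :* m₂ :+ l₂ :* m₀ ∷ l₁ :* m₁ ∷ l₁ :* m₂ :+ l₂ :* m₁ ∷ l₂ :* m₂ ∷ []) (x₀ ∷ x₁ ∷ x₂ ∷ [])
    := P.sum₃ (l₀ :* x₀ ∷ l₁ :* x₁ ∷ l₂ :* x₂ ∷ []) :* P.sum₃ (m₀ :* x₀ ∷ m₁ :* x₁ ∷ m₂ :* x₂ ∷ []))
    refl (l 0F) (l 1F) (l 2F) (m 0F) (m 1F) (m 2F) (x 0F) (x 1F) (x 2F)

  polar-⊡ : ∀ l m x y → polar (l ⊡ m) x y ≈
    sum₃ (λ i → l i * x i) * sum₃ (λ i → m i * y i) + sum₃ (λ i → l i * y i) * sum₃ (λ i → m i * x i)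
  polar-⊡ l m x y = solve 12 (λ l₀ l₁ l₂ m₀ m₁ m₂ x₀ x₁ x₂ y₀ y₁ y₂ →
    P.polar (l₀ :* m₀ ∷ l₀ :* m₁ :+ l₁ :* m₀ ∷ l₀ :* m₂ :+ l₂ :* m₀ ∷ l₁ :* m₁ ∷ l₁ :* m₂ :+ l₂ :* m₁ ∷ l₂ :* m₂ ∷ []) (x₀ ∷ x₁ ∷ x₂ ∷ []) (y₀ ∷ y₁ ∷ y₂ ∷ [])
    := P.sum₃ (l₀ :* x₀ ∷ l₁ :* x₁ ∷ l₂ :* x₂ ∷ []) :* P.sum₃ (m₀ :* y₀ ∷ m₁ :* y₁ ∷ m₂ :* y₂ ∷ [])
       :+ P.sum₃ (l₀ :* y₀ ∷ l₁ :* y₁ ∷ l₂ :* y₂ ∷ []) :* P.sum₃ (m₀ :* x₀ ∷ m₁ :* x₁ ∷ m₂ :* x₂ ∷ []))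
    refl (l 0F) (l 1F) (l 2F) (m 0F) (m 1F) (m 2F) (x 0F) (x 1F) (x 2F) (y 0F) (y 1F) (y 2F)

  congruent-sym : ∀ A y i j → congruent A y i j ≈ congruent A y j i
  congruent-sym A y i j = solve 12 (λ x₀ x₁ x₂ y₀ y₁ y₂ s₀ s₁ s₂ s₃ s₄ s₅ →
    -- Only the two rows `A i` and `A j` matter; the third row is filler, so one identity covers all
    -- i and j.
    let A = (x₀ ∷ x₁ ∷ x₂ ∷ []) ∷ (y₀ ∷ y₁ ∷ y₂ ∷ []) ∷ (y₀ ∷ y₁ ∷ y₂ ∷ []) ∷ []
        N = P.congruent A (s₀ ∷ s₁ ∷ s₂ ∷ s₃ ∷ s₄ ∷ s₅ ∷ [])
    in N 0F 1F := N 1F 0F)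
    refl (A i 0F) (A i 1F) (A i 2F) (A j 0F) (A j 1F) (A j 2F) (y 0F) (y 1F) (y 2F) (y 3F) (y 4F) (y 5F)

  infix 4 _≈ᴹ_
  _≈ᴹ_ : Matrix → Matrix → Set _
  A ≈ᴹ B = ∀ i j → A i j ≈ B i j

  sum₃-cong : ∀ {f g : Vector Carrier 3} → f ≋ g → sum₃ f ≈ sum₃ g
  sum₃-cong f≋g = +-cong (f≋g 0F) (+-cong (f≋g 1F) (+-congʳ (f≋g 2F)))

  value-cong : ∀ {a b x y} → a ≋ b → x ≋ y → value a x ≈ value b y
  value-cong a≋b x≋y = +-cong (+-cong (+-cong (+-cong (+-cong
    (*-cong (a≋b 0F) (*-cong (x≋y 0F) (x≋y 0F))) (*-cong (a≋b 1F) (*-cong (x≋y 0F) (x≋y 1F))))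
    (*-cong (a≋b 2F) (*-cong (x≋y 0F) (x≋y 2F)))) (*-cong (a≋b 3F) (*-cong (x≋y 1F) (x≋y 1F))))
    (*-cong (a≋b 4F) (*-cong (x≋y 1F) (x≋y 2F)))) (*-cong (a≋b 5F) (*-cong (x≋y 2F) (x≋y 2F)))

  polar-cong : ∀ {a b x y u v} → a ≋ b → x ≋ y → u ≋ v → polar a x u ≈ polar b y v
  polar-cong {x = x} {y} {u} {v} a≋b x≋y u≋v = +-cong (+-cong (+-cong (+-cong (+-cong
    (*-cong (a≋b 0F) (xu 0F 0F)) (*-cong (a≋b 1F) (xu 0F 1F))) (*-cong (a≋b 2F) (xu 0F 2F)))
    (*-cong (a≋b 3F) (xu 1F 1F))) (*-cong (a≋b 4F) (xu 1F 2F))) (*-cong (a≋b 5F) (xu 2F 2F))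
    where
    xu : ∀ i j → x i * u j + x j * u i ≈ y i * v j + y j * v i
    xu i j = +-cong (*-cong (x≋y i) (u≋v j)) (*-cong (x≋y j) (u≋v i))

  pullback-cong : ∀ {A B a b} → A ≈ᴹ B → a ≋ b → pullback A a ≋ pullback B b
  pullback-cong {A} {B} A≈B a≋b = λ where
    0F → value-cong {x = column A _} {column B _} a≋b (λ i → A≈B i 0F)
    1F → polar-cong {x = column A _} {column B _} {column A _} {column B _} a≋b (λ i → A≈B i 0F) (λ i → A≈B i 1F)
    2F → polar-cong {x = column A _} {column B _} {column A _} {column B _} a≋b (λ i → A≈B i 0F) (λ i → A≈B i 2F)
    3F → value-cong {x = column A _} {column B _} a≋b (λ i → A≈B i 1F)
    4F → polar-cong {x = column A _} {column B _} {column A _} {column B _} a≋b (λ i → A≈B i 1F) (λ i → A≈B i 2F)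
    5F → value-cong {x = column A _} {column B _} a≋b (λ i → A≈B i 2F)

  -- The columns of `B ⊗ A` are, by computation, the images under `B` of the columns of `A`, so
  -- substitution is contravariant.
  pullback-⊗ : ∀ A B a → pullback A (pullback B a) ≋ pullback (B ⊗ A) a
  pullback-⊗ A B a = λ where
    0F → value-pullback B a (column A 0F)
    1F → polar-pullback B a (column A 0F) (column A 1F)
    2F → polar-pullback B a (column A 0F) (column A 2F)
    3F → value-pullback B a (column A 1F)
    4F → polar-pullback B a (column A 1F) (column A 2F)
    5F → value-pullback B a (column A 2F)

  pullback-I₃ : ∀ a → pullback I₃ a ≋ a
  pullback-I₃ a = λ where
    0F → solve 6 (λ a₀ a₁ a₂ a₃ a₄ a₅ → P.pullback I (a₀ ∷ a₁ ∷ a₂ ∷ a₃ ∷ a₄ ∷ a₅ ∷ []) 0F := a₀) refl (a 0F) (a 1F) (a 2F) (a 3F) (a 4F) (a 5F)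
    1F → solve 6 (λ a₀ a₁ a₂ a₃ a₄ a₅ → P.pullback I (a₀ ∷ a₁ ∷ a₂ ∷ a₃ ∷ a₄ ∷ a₅ ∷ []) 1F := a₁) refl (a 0F) (a 1F) (a 2F) (a 3F) (a 4F) (a 5F)
    2F → solve 6 (λ a₀ a₁ a₂ a₃ a₄ a₅ → P.pullback I (a₀ ∷ a₁ ∷ a₂ ∷ a₃ ∷ a₄ ∷ a₅ ∷ []) 2F := a₂) refl (a 0F) (a 1F) (a 2F) (a 3F) (a 4F) (a 5F)
    3F → solve 6 (λ a₀ a₁ a₂ a₃ a₄ a₅ → P.pullback I (a₀ ∷ a₁ ∷ a₂ ∷ a₃ ∷ a₄ ∷ a₅ ∷ []) 3F := a₃) refl (a 0F) (a 1F) (a 2F) (a 3F) (a 4F) (a 5F)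
    4F → solve 6 (λ a₀ a₁ a₂ a₃ a₄ a₅ → P.pullback I (a₀ ∷ a₁ ∷ a₂ ∷ a₃ ∷ a₄ ∷ a₅ ∷ []) 4F := a₄) refl (a 0F) (a 1F) (a 2F) (a 3F) (a 4F) (a 5F)
    5F → solve 6 (λ a₀ a₁ a₂ a₃ a₄ a₅ → P.pullback I (a₀ ∷ a₁ ∷ a₂ ∷ a₃ ∷ a₄ ∷ a₅ ∷ []) 5F := a₅) refl (a 0F) (a 1F) (a 2F) (a 3F) (a 4F) (a 5F)

  pullback-· : ∀ A k a → pullback A (k · a) ≋ k · pullback A a
  pullback-· A k a = go
    where
    scale : ∀ m₀ m₁ m₂ m₃ m₄ m₅ →
      k * a 0F * m₀ + k * a 1F * m₁ + k * a 2F * m₂ + k * a 3F * m₃ + k * a 4F * m₄ + k * a 5F * m₅ ≈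
      k * (a 0F * m₀ + a 1F * m₁ + a 2F * m₂ + a 3F * m₃ + a 4F * m₄ + a 5F * m₅)
    scale = solve 13 (λ k a₀ a₁ a₂ a₃ a₄ a₅ m₀ m₁ m₂ m₃ m₄ m₅ →
      k :* a₀ :* m₀ :+ k :* a₁ :* m₁ :+ k :* a₂ :* m₂ :+ k :* a₃ :* m₃ :+ k :* a₄ :* m₄ :+ k :* a₅ :* m₅ :=
      k :* (a₀ :* m₀ :+ a₁ :* m₁ :+ a₂ :* m₂ :+ a₃ :* m₃ :+ a₄ :* m₄ :+ a₅ :* m₅))
      refl k (a 0F) (a 1F) (a 2F) (a 3F) (a 4F) (a 5F)
    value-· : ∀ x → value (k · a) x ≈ k * value a x
    value-· x = scale _ _ _ _ _ _
    polar-· : ∀ x y → polar (k · a) x y ≈ k * polar a x y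
    polar-· x y = scale _ _ _ _ _ _

    go : pullback A (k · a) ≋ k · pullback A a
    go 0F = value-· (column A 0F)
    go 1F = polar-· (column A 0F) (column A 1F)
    go 2F = polar-· (column A 0F) (column A 2F)
    go 3F = value-· (column A 1F)
    go 4F = polar-· (column A 1F) (column A 2F)
    go 5F = value-· (column A 2F)

  pullback-inverse : ∀ A B → B ⊗ A ≈ᴹ I₃ → ∀ a → pullback A (pullback B a) ≋ a
  pullback-inverse A B BA≈I a i = trans (pullback-⊗ A B a i)
    (trans (pullback-cong {a = a} {a} BA≈I (λ _ → refl) i) (pullback-I₃ a i))

  pullback-⊡ : ∀ A l m → pullback A (l ⊡ m) ≋ transform A l ⊡ transform A m
  pullback-⊡ A l m = λ where
    0F → value-⊡ l m (column A 0F)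
    1F → polar-⊡ l m (column A 0F) (column A 1F)
    2F → polar-⊡ l m (column A 0F) (column A 2F)
    3F → value-⊡ l m (column A 1F)
    4F → polar-⊡ l m (column A 1F) (column A 2F)
    5F → value-⊡ l m (column A 2F)

  ⊡-cong : ∀ {l l′ m m′} → l ≋ l′ → m ≋ m′ → l ⊡ m ≋ l′ ⊡ m′
  ⊡-cong l≋ m≋ = λ where
    0F → *-cong (l≋ 0F) (m≋ 0F)
    1F → +-cong (*-cong (l≋ 0F) (m≋ 1F)) (*-cong (l≋ 1F) (m≋ 0F))
    2F → +-cong (*-cong (l≋ 0F) (m≋ 2F)) (*-cong (l≋ 2F) (m≋ 0F))
    3F → *-cong (l≋ 1F) (m≋ 1F)
    4F → +-cong (*-cong (l≋ 1F) (m≋ 2F)) (*-cong (l≋ 2F) (m≋ 1F))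
    5F → *-cong (l≋ 2F) (m≋ 2F)

  ⊡-comm : ∀ l m → l ⊡ m ≋ m ⊡ l
  ⊡-comm l m = λ where
    0F → *-comm _ _
    1F → trans (+-cong (*-comm _ _) (*-comm _ _)) (+-comm _ _)
    2F → trans (+-cong (*-comm _ _) (*-comm _ _)) (+-comm _ _)
    3F → *-comm _ _
    4F → trans (+-cong (*-comm _ _) (*-comm _ _)) (+-comm _ _)
    5F → *-comm _ _

  ·-⊡ : ∀ k l m → k · (l ⊡ m) ≋ (k · l) ⊡ m
  ·-⊡ k l m = λ { 0F → sym (*-assoc _ _ _) ; 1F → cross 0F 1F ; 2F → cross 0F 2F
                ; 3F → sym (*-assoc _ _ _) ; 4F → cross 1F 2F ; 5F → sym (*-assoc _ _ _) }
    where
    cross : ∀ i j → k * (l i * m j + l j * m i) ≈ k * l i * m j + k * l j * m i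
    cross i j = trans (distribˡ _ _ _) (+-cong (sym (*-assoc _ _ _)) (sym (*-assoc _ _ _)))

  transform-cong : ∀ A {l m} → l ≋ m → transform A l ≋ transform A m
  transform-cong A l≋m j = sum₃-cong (λ i → *-congʳ {A i j} (l≋m i))

  transform-· : ∀ A k l → transform A (k · l) ≋ k · transform A l
  transform-· A k l j = solve 7 (λ k l₀ l₁ l₂ x₀ x₁ x₂ →
    P.sum₃ (k :* l₀ :* x₀ ∷ k :* l₁ :* x₁ ∷ k :* l₂ :* x₂ ∷ []) := k :* P.sum₃ (l₀ :* x₀ ∷ l₁ :* x₁ ∷ l₂ :* x₂ ∷ []))
    refl k (l 0F) (l 1F) (l 2F) (A 0F j) (A 1F j) (A 2F j)

  transform-inverse : ∀ A B → A ⊗ B ≈ᴹ I₃ → ∀ l → transform B (transform A l) ≋ l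
  transform-inverse A B AB≈I l j = begin
    transform B (transform A l) j            ≈⟨ solve 15 (λ l₀ l₁ l₂ x₀ x₁ x₂ y₀ y₁ y₂ z₀ z₁ z₂ b₀ b₁ b₂ →
      let l = l₀ ∷ l₁ ∷ l₂ ∷ []
          b = b₀ ∷ b₁ ∷ b₂ ∷ []
          A = (x₀ ∷ y₀ ∷ z₀ ∷ []) ∷ (x₁ ∷ y₁ ∷ z₁ ∷ []) ∷ (x₂ ∷ y₂ ∷ z₂ ∷ []) ∷ []
      in P.sum₃ (λ i → P.sum₃ (λ k → l k :* A k i) :* b i) := P.sum₃ (λ k → l k :* P.sum₃ (λ i → A k i :* b i)))
      refl (l 0F) (l 1F) (l 2F) (A 0F 0F) (A 1F 0F) (A 2F 0F) (A 0F 1F) (A 1F 1F) (A 2F 1F) (A 0F 2F) (A 1F 2F) (A 2F 2F) (B 0F j) (B 1F j) (B 2F j) ⟩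
    sum₃ (λ k → l k * (A ⊗ B) k j)           ≈⟨ sum₃-cong (λ k → *-congˡ {l k} (AB≈I k j)) ⟩
    sum₃ (λ k → l k * I₃ k j)                ≈⟨ select j ⟩
    l j                                      ∎
    where
    select : ∀ j → sum₃ (λ k → l k * I₃ k j) ≈ l j
    select 0F = solve 3 (λ x y z → x :* :1 :+ (y :* :0 :+ (z :* :0 :+ :0)) := x) refl (l 0F) (l 1F) (l 2F)
    select 1F = solve 3 (λ x y z → x :* :0 :+ (y :* :1 :+ (z :* :0 :+ :0)) := y) refl (l 0F) (l 1F) (l 2F)
    select 2F = solve 3 (λ x y z → x :* :0 :+ (y :* :0 :+ (z :* :1 :+ :0)) := z) refl (l 0F) (l 1F) (l 2F)

  discriminant-cong : ∀ {a b} → a ≋ b → discriminant a ≈ discriminant b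
  discriminant-cong a≋b = +-cong (+-cong (+-cong (+-cong (×-congʳ 4 (*-cong (*-cong (a≋b 0F) (a≋b 3F)) (a≋b 5F)))
    (*-cong (*-cong (a≋b 1F) (a≋b 2F)) (a≋b 4F)))
    (-‿cong (*-cong (a≋b 0F) (*-cong (a≋b 4F) (a≋b 4F))))) (-‿cong (*-cong (a≋b 3F) (*-cong (a≋b 2F) (a≋b 2F)))))
    (-‿cong (*-cong (a≋b 5F) (*-cong (a≋b 1F) (a≋b 1F))))

  discriminant-· : ∀ k a → discriminant (k · a) ≈ k * k * k * discriminant a
  discriminant-· k a = solve 7 (λ k a₀ a₁ a₂ a₃ a₄ a₅ →
    disc (k :* a₀) (k :* a₁) (k :* a₂) (k :* a₃) (k :* a₄) (k :* a₅) := k :* k :* k :* disc a₀ a₁ a₂ a₃ a₄ a₅)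
    refl k (a 0F) (a 1F) (a 2F) (a 3F) (a 4F) (a 5F)

  discriminant-⊡ : ∀ l m → discriminant (l ⊡ m) ≈ 0#
  discriminant-⊡ l m = solve 6 (λ l₀ l₁ l₂ m₀ m₁ m₂ →
    disc (l₀ :* m₀) (l₀ :* m₁ :+ l₁ :* m₀) (l₀ :* m₂ :+ l₂ :* m₀) (l₁ :* m₁) (l₁ :* m₂ :+ l₂ :* m₁) (l₂ :* m₂) := :0)
    refl (l 0F) (l 1F) (l 2F) (m 0F) (m 1F) (m 2F)

-- Hyperplanes on a line of the orbit

module Proportionality {c ℓ q} (K : FiniteField c ℓ q) where
  open FiniteField K
  open FieldLemmas K
  open Forms commutativeRing

  ∝-refl : ∀ {n} {u : Vector Carrier n} → u ∝ u
  ∝-refl = 1# , 1≉0 , λ i → sym (*-identityˡ _)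

  ∝-trans : ∀ {n} {u v w : Vector Carrier n} → u ∝ v → v ∝ w → u ∝ w
  ∝-trans (k , k≉0 , u≋kv) (m , m≉0 , v≋mw) =
    k * m , *-≉0 k≉0 m≉0 , λ i → trans (u≋kv i) (trans (*-congˡ (v≋mw i)) (sym (*-assoc _ _ _)))

  ∝-sym : ∀ {n} {u v : Vector Carrier n} → u ∝ v → v ∝ u
  ∝-sym {u = u} {v} (k , k≉0 , u≋kv) = let k⁻¹ , kk⁻¹≈1 = inverse k k≉0 ; k⁻¹k≈1 = trans (*-comm k⁻¹ k) kk⁻¹≈1 in
    k⁻¹ , x*y≈1⇒x≉0 k⁻¹k≈1 ,
    λ i → sym (trans (*-congˡ (u≋kv i)) (trans (sym (*-assoc _ _ _)) (trans (*-congʳ k⁻¹k≈1) (*-identityˡ _))))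

  ≋⇒∝ : ∀ {n} {u v : Vector Carrier n} → u ≋ v → u ∝ v
  ≋⇒∝ u≋v = 1# , 1≉0 , λ i → trans (u≋v i) (sym (*-identityˡ _))

  ∝-nonzero : ∀ {n} {u v : Vector Carrier n} → u ∝ v → ¬ (∀ i → u i ≈ 0#) → ¬ (∀ i → v i ≈ 0#)
  ∝-nonzero (k , _ , u≋kv) u≉0 v≈0 = u≉0 (λ i → trans (u≋kv i) (trans (*-congˡ (v≈0 i)) (zeroʳ k)))

  open Sum semiring using (sum-cong-≋; *-distribˡ-sum)
  open Pullbacks commutativeRing

  ⟨⟩-·ʳ : ∀ {n} (a : Vector Carrier n) k u v → u ≋ k · v → ⟨ a , u ⟩ ≈ k * ⟨ a , v ⟩
  ⟨⟩-·ʳ a k u v u≋kv = trans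
    (sum-cong-≋ (λ i → trans (*-congˡ (u≋kv i)) (trans (sym (*-assoc _ _ _)) (trans (*-congʳ (*-comm _ k)) (*-assoc _ _ _)))))
    (sym (*-distribˡ-sum k (λ i → a i * v i)))

  ⟨⟩-congˡ : ∀ {n} (a b v : Vector Carrier n) → a ≋ b → ⟨ a , v ⟩ ≈ ⟨ b , v ⟩
  ⟨⟩-congˡ a b v a≋b = sum-cong-≋ (λ i → *-congʳ {v i} (a≋b i))

  pullback-∝ : ∀ A {a b} → a ∝ b → pullback A a ∝ pullback A b
  pullback-∝ A {a} {b} (k , k≉0 , a≋kb) = k , k≉0 ,
    λ i → trans (pullback-cong {A} {A} {a} {k · b} (λ _ _ → refl) a≋kb i) (pullback-· A k b i)

  transform-reflects-∝ : ∀ A → GL₃ A → ∀ l m → transform A l ∝ transform A m → l ∝ m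
  transform-reflects-∝ A (B , AB≈I , _) l m (k , k≉0 , Al≋kAm) = k , k≉0 , λ i →
    trans (sym (transform-inverse A B AB≈I l i)) (trans (transform-cong B Al≋kAm i)
      (trans (transform-· B k (transform A m) i) (*-congˡ (transform-inverse A B AB≈I m i))))

  GL₃-inverse : ∀ A ((B , _) : GL₃ A) → GL₃ B
  GL₃-inverse A (_ , AB≈I , BA≈I) = A , BA≈I , AB≈I

module Hyperplanes {c ℓ q} (F : FiniteField c ℓ q) where
  open Vector using ([]; _∷_)
  open FiniteField F
  open FieldLemmas F
  open IntegerSolver commutativeRing
  open Forms commutativeRing
  open Pullbacks commutativeRing
  open Proportionality F
  open Projective F
  open ≈-Reasoning setoid

  -- Positions 0, 3, 5 hold the coefficients of the squares; the two equations are those of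
  -- vanishing on the standard line.
  Balanced : Pred QuadraticForm ℓ
  Balanced a = a 0F ≈ a 3F × a 5F ≈ a 3F

  private
    diagonal : Vector Carrier 2 → Vector Carrier 6
    diagonal s = s 0F ∷ 0# ∷ 0# ∷ - (s 0F + s 1F) ∷ 0# ∷ s 1F ∷ []

    ⟨_,diagonal⟩ : ∀ a s → ⟨ a , diagonal s ⟩ ≈ s 0F * (a 0F - a 3F) + s 1F * (a 5F - a 3F)
    ⟨ a ,diagonal⟩ s = solve 8 (λ a₀ a₁ a₂ a₃ a₄ a₅ x y →
      a₀ :* x :+ (a₁ :* :0 :+ (a₂ :* :0 :+ (a₃ :* (:- (x :+ y)) :+ (a₄ :* :0 :+ (a₅ :* y :+ :0))))) :=
      x :* (a₀ :- a₃) :+ y :* (a₅ :- a₃))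
      refl (a 0F) (a 1F) (a 2F) (a 3F) (a 4F) (a 5F) (s 0F) (s 1F)

    flatten : Matrix → Vector Carrier 6
    flatten M = λ { 0F → M 0F 0F ; 1F → M 0F 1F ; 2F → M 0F 2F ; 3F → M 1F 1F ; 4F → M 1F 2F ; 5F → M 2F 2F }

    symMatrix-flatten : ∀ M → (∀ i j → M i j ≈ M j i) → symMatrix (flatten M) ≈ᴹ M
    symMatrix-flatten M M-sym = λ where
      0F 0F → refl
      0F 1F → refl
      0F 2F → refl
      1F 0F → M-sym 0F 1F
      1F 1F → refl
      1F 2F → refl
      2F 0F → M-sym 0F 2F
      2F 1F → M-sym 1F 2F
      2F 2F → refl

    flatten-symMatrix : ∀ y {M} → symMatrix y ≈ᴹ M → y ≋ flatten M
    flatten-symMatrix y y≈M = λ where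
      0F → y≈M 0F 0F
      1F → y≈M 0F 1F
      2F → y≈M 0F 2F
      3F → y≈M 1F 1F
      4F → y≈M 1F 2F
      5F → y≈M 2F 2F

    -- Invertibility of M ↦ A M Aᵀ in dual form: every functional `b` is the pullback along `A` of
    -- its pullback along `B`, so its value at `y` is read off from A M Aᵀ. This guarantees that
    -- images of points are points.
    congruent-≋0 : ∀ A → GL₃ A → ∀ y → (∀ i → flatten (congruent A y) i ≈ 0#) → ∀ b → ⟨ b , y ⟩ ≈ 0#
    congruent-≋0 A (B , _ , BA≈I) y AyAᵀ≈0 b = begin
      ⟨ b , y ⟩                                        ≈⟨ ⟨⟩-congˡ (pullback A (pullback B b)) b y (pullback-inverse A B BA≈I b) ⟨
      ⟨ pullback A (pullback B b) , y ⟩                ≈⟨ pairing-congruent A (pullback B b) y ⟨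
      ⟨ pullback B b , flatten (congruent A y) ⟩       ≈⟨ ⟨⟩-·ʳ (pullback B b) 0# (flatten (congruent A y)) (flatten (congruent A y)) (λ i → trans (AyAᵀ≈0 i) (sym (zeroˡ _))) ⟩
      0# * ⟨ pullback B b , flatten (congruent A y) ⟩  ≈⟨ zeroˡ _ ⟩
      0#                                               ∎

  module _ (L : Line 5) (L∈o₁₄,₁ : o₁₄,₁ L) where
    private
      A = proj₁ L∈o₁₄,₁
      A∈GL₃ = proj₁ (proj₂ L∈o₁₄,₁)
      on-L = proj₂ (proj₂ L∈o₁₄,₁)

    contains⇒balanced : ∀ H → Contains L H → Balanced (pullback A (form H))
    contains⇒balanced H L⊆H =
      -- The points with parameters (1 , 0) and (0 , 1) already give the two equations.
      x-y≈0⇒x≈y (trans (solve 2 (λ x y → x := :1 :* x :+ :0 :* y) refl _ _) (vanish (1# ∷ 0# ∷ []) (λ eq → 1≉0 (eq 0F)))) ,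
      x-y≈0⇒x≈y (trans (solve 2 (λ x y → y := :0 :* x :+ :1 :* y) refl _ _) (vanish (0# ∷ 1# ∷ []) (λ eq → 1≉0 (eq 1F))))
      where
      a = pullback A (form H)
      vanish : ∀ s → ¬ (∀ i → s i ≈ 0#) → s 0F * (a 0F - a 3F) + s 1F * (a 5F - a 3F) ≈ 0#
      vanish s s≉0 = begin
        s 0F * (a 0F - a 3F) + s 1F * (a 5F - a 3F)   ≈⟨ ⟨ a ,diagonal⟩ s ⟨
        ⟨ a , diagonal s ⟩                            ≈⟨ pairing-congruent A (form H) (diagonal s) ⟨
        ⟨ form H , coords P ⟩                         ≈⟨ L⊆H P (Equivalence.from (on-L P) (Q , (point s s≉0 , ∝-refl) , 1# , 1≉0 , λ i j → trans (symMatrix-flatten M (congruent-sym A (diagonal s)) i j) (sym (*-identityˡ _)))) ⟩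
        0#                                            ∎
        where
        M = congruent A (diagonal s)
        Q P : Point 5
        Q = point (diagonal s) (λ eq → s≉0 (λ { 0F → eq 0F ; 1F → eq 5F }))
        -- Were the image zero, the coordinate functionals 0 and 5 would recover both parameters of
        -- `s` as zero.
        P = point (flatten M) (λ eq → s≉0 (λ where
          0F → trans (solve 3 (λ x y z → x := :1 :* x :+ (:0 :* :0 :+ (:0 :* :0 :+ (:0 :* y :+ (:0 :* :0 :+ (:0 :* z :+ :0)))))) refl (s 0F) (- (s 0F + s 1F)) (s 1F))
            (congruent-≋0 A A∈GL₃ (diagonal s) eq (1# ∷ 0# ∷ 0# ∷ 0# ∷ 0# ∷ 0# ∷ []))
          1F → trans (solve 3 (λ x y z → z := :0 :* x :+ (:0 :* :0 :+ (:0 :* :0 :+ (:0 :* y :+ (:0 :* :0 :+ (:1 :* z :+ :0)))))) refl (s 0F) (- (s 0F + s 1F)) (s 1F))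
            (congruent-≋0 A A∈GL₃ (diagonal s) eq (0# ∷ 0# ∷ 0# ∷ 0# ∷ 0# ∷ 1# ∷ []))))

    balanced⇒contains : ∀ H → Balanced (pullback A (form H)) → Contains L H
    balanced⇒contains H (a₀≈a₃ , a₅≈a₃) P P∈L =
      let Q , (s , k′ , _ , Q≋k′s) , k , _ , P≈kAQAᵀ = Equivalence.to (on-L P) P∈L
          a = pullback A (form H)
      in begin
        ⟨ form H , coords P ⟩                               ≈⟨ ⟨⟩-·ʳ (form H) k (coords P) (flatten (congruent A (coords Q))) (λ i → trans (flatten-symMatrix (coords P) {λ i j → k * congruent A (coords Q) i j} P≈kAQAᵀ i) (flatten-· k (congruent A (coords Q)) i)) ⟩
        k * ⟨ form H , flatten (congruent A (coords Q)) ⟩   ≈⟨ *-congˡ (pairing-congruent A (form H) (coords Q)) ⟩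
        k * ⟨ a , coords Q ⟩                                ≈⟨ *-congˡ (⟨⟩-·ʳ a k′ (coords Q) (diagonal (coords s)) Q≋k′s) ⟩
        k * (k′ * ⟨ a , diagonal (coords s) ⟩)              ≈⟨ *-congˡ (*-congˡ (⟨ a ,diagonal⟩ (coords s))) ⟩
        k * (k′ * (_ * (a 0F - a 3F) + _ * (a 5F - a 3F)))  ≈⟨ *-congˡ (*-congˡ (+-cong (*-congˡ (x≈y⇒x-y≈0 a₀≈a₃)) (*-congˡ (x≈y⇒x-y≈0 a₅≈a₃)))) ⟩
        k * (k′ * (_ * 0# + _ * 0#))                        ≈⟨ solve 4 (λ k k′ x y → k :* (k′ :* (x :* :0 :+ y :* :0)) := :0) refl k k′ _ _ ⟩
        0#                                                  ∎
      where
      flatten-· : ∀ k M → flatten (λ i j → k * M i j) ≋ k · flatten M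
      flatten-· k M = λ { 0F → refl ; 1F → refl ; 2F → refl ; 3F → refl ; 4F → refl ; 5F → refl }

    module _ {p} (𝒬 : Pred QuadraticForm p) (𝒬-resp : ∀ {a b} → a ∝ b → 𝒬 a → 𝒬 b)
      (𝒬-pullback : ∀ A → GL₃ A → ∀ a → 𝒬 a → 𝒬 (pullback A a)) where

      -- The transfer from L to the standard line: an invariant class of hyperplanes on L is counted
      -- by any family `f` that lists its balanced forms once up to scalars. Pullback along `A`
      -- leads from hyperplanes on L to balanced forms, pullback along the inverse leads back.
      count-balanced : ∀ {s ℓₛ n} {S : Setoid s ℓₛ} → HasCardinality S n →
        (f : Setoid.Carrier S → QuadraticForm) → (∀ i → ¬ (∀ j → f i j ≈ 0#)) → (∀ i → Balanced (f i)) → (∀ i → 𝒬 (f i)) →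
        (∀ {i j} → Setoid._≈_ S i j → f i ∝ f j) → (∀ {i j} → f i ∝ f j → Setoid._≈_ S i j) →
        (∀ a → ¬ (∀ j → a j ≈ 0#) → Balanced a → 𝒬 a → ∃ λ i → a ∝ f i) →
        Count ((λ H → 𝒬 (form H)) ∩ Contains L) n
      count-balanced {S = S} S≅n f f≉0 f-balanced f-𝒬 f-cong f-injective f-surjective =
        card-correspondence S≅n
          (λ i H → pullback A (form (proj₁ H)) ∝ f i)
          (λ i → let a = pullback B (f i) ; Aa∝fi = ≋⇒∝ (pullback-inverse A B BA≈I (f i))
                     H = point a (λ a≈0 → ∝-nonzero (∝-sym Aa∝fi) (f≉0 i) (pullback-zero A a≈0))
                 in (H , 𝒬-pullback B (GL₃-inverse A A∈GL₃) (f i) (f-𝒬 i) , balanced⇒contains H (balanced-∝ (∝-sym Aa∝fi) (f-balanced i))) , Aa∝fi)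
          (λ (H , 𝒬H , L⊆H) → f-surjective (pullback A (form H))
            (λ Aa≈0 → nonzero H (λ j → trans (sym (pullback-inverse B A AB≈I (form H) j)) (pullback-zero B Aa≈0 j)))
            (contains⇒balanced H L⊆H) (𝒬-pullback A A∈GL₃ (form H) 𝒬H))
          (λ {i} {j} {H} {H′} AH∝ AH′∝ i≈j → reflect (proj₁ H) (proj₁ H′) (∝-trans AH∝ (∝-trans (f-cong i≈j) (∝-sym AH′∝))))
          (λ AH∝ AH′∝ H∝H′ → f-injective (∝-trans (∝-sym AH∝) (∝-trans (pullback-∝ A H∝H′) AH′∝)))
        where
        B = proj₁ A∈GL₃
        AB≈I = proj₁ (proj₂ A∈GL₃)
        BA≈I = proj₂ (proj₂ A∈GL₃)

        pullback-zero : ∀ A {a} → (∀ j → a j ≈ 0#) → ∀ j → pullback A a j ≈ 0#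
        pullback-zero A {a} a≈0 j = trans (pullback-cong {A} {A} {a} {0# · a} (λ _ _ → refl) (λ i → trans (a≈0 i) (sym (zeroˡ _))) j)
          (trans (pullback-· A 0# a j) (zeroˡ _))

        balanced-∝ : ∀ {a b} → a ∝ b → Balanced a → Balanced b
        balanced-∝ (k , k≉0 , a≋kb) (a₀≈a₃ , a₅≈a₃) =
          *-cancelˡ-≉0 k≉0 (trans (sym (a≋kb 0F)) (trans a₀≈a₃ (a≋kb 3F))) ,
          *-cancelˡ-≉0 k≉0 (trans (sym (a≋kb 5F)) (trans a₅≈a₃ (a≋kb 3F)))

        reflect : ∀ H H′ → pullback A (form H) ∝ pullback A (form H′) → form H ∝ form H′
        reflect H H′ AH∝AH′ = ∝-trans (∝-sym (≋⇒∝ (pullback-inverse B A AB≈I (form H))))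
          (∝-trans (pullback-∝ B AH∝AH′) (≋⇒∝ (pullback-inverse B A AB≈I (form H′))))

-- Invariance of the hyperplane classes under scaling and substitution

module RationalClasses {c ℓ q} (F : FiniteField c ℓ q) where
  open FiniteField F
  open FieldLemmas F
  open Forms commutativeRing
  open Pullbacks commutativeRing
  open Proportionality F

  DoubleLine RealPair : Pred QuadraticForm (c ⊔ ℓ)
  DoubleLine a = ∃₂ λ k (l : LinearForm) → a ≋ k · (l ⊡ l)
  RealPair a = ∃₂ λ (l m : LinearForm) → ¬ (l ∝ m) × a ≋ l ⊡ m

  Nonsingular : Pred QuadraticForm ℓ
  Nonsingular a = discriminant a ≉ 0#

  doubleLine-resp : ∀ {a b} → a ∝ b → DoubleLine a → DoubleLine b
  doubleLine-resp {a} {b} a∝b (k , l , a≋) = let j , _ , b≋ = ∝-sym a∝b in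
    j * k , l , λ i → trans (b≋ i) (trans (*-congˡ (a≋ i)) (sym (*-assoc _ _ _)))

  doubleLine-pullback : ∀ A → GL₃ A → ∀ a → DoubleLine a → DoubleLine (pullback A a)
  doubleLine-pullback A _ a (k , l , a≋) = k , transform A l , λ i →
    trans (pullback-cong {A} {A} {a} {k · (l ⊡ l)} (λ _ _ → refl) a≋ i)
      (trans (pullback-· A k (l ⊡ l) i) (*-congˡ (pullback-⊡ A l l i)))

  ·-∝ : ∀ {n} k {l : Vector Carrier n} → k ≉ 0# → k · l ∝ l
  ·-∝ k k≉0 = k , k≉0 , λ _ → refl

  realPair-resp : ∀ {a b} → a ∝ b → RealPair a → RealPair b
  realPair-resp a∝b (l , m , l≁m , a≋) = let j , j≉0 , b≋ = ∝-sym a∝b in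
    j · l , m , (λ jl∝m → l≁m (∝-trans (∝-sym (·-∝ j j≉0)) jl∝m)) ,
    λ i → trans (b≋ i) (trans (*-congˡ (a≋ i)) (·-⊡ j l m i))

  realPair-pullback : ∀ A → GL₃ A → ∀ a → RealPair a → RealPair (pullback A a)
  realPair-pullback A A∈GL₃ a (l , m , l≁m , a≋) =
    transform A l , transform A m , l≁m ∘ transform-reflects-∝ A A∈GL₃ l m , λ i →
    trans (pullback-cong {A} {A} {a} {l ⊡ m} (λ _ _ → refl) a≋ i) (pullback-⊡ A l m i)

  realPair-singular : ∀ a → RealPair a → discriminant a ≈ 0#
  realPair-singular a (l , m , _ , a≋) = trans (discriminant-cong {a} {l ⊡ m} a≋) (discriminant-⊡ l m)

  nonsingular-resp : ∀ {a b} → a ∝ b → Nonsingular a → Nonsingular b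
  nonsingular-resp {a} {b} (k , _ , a≋) a-ns b-s = a-ns
    (trans (discriminant-cong a≋) (trans (discriminant-· k b) (trans (*-congˡ b-s) (zeroʳ _))))

  -- `pullback-det` carries singularity forward, and `a` is the pullback of its own pullback along
  -- the inverse. The contrapositive thus avoids discussing whether det A vanishes.
  nonsingular-pullback : ∀ A → GL₃ A → ∀ a → Nonsingular a → Nonsingular (pullback A a)
  nonsingular-pullback A (B , AB≈I , _) a a-ns Aa-s = a-ns
    (trans (discriminant-cong (λ i → sym (pullback-inverse B A AB≈I a i)))
      (trans (proj₂ (pullback-det B (pullback A a))) (trans (*-congˡ Aa-s) (zeroʳ _))))

module ImaginaryClass {c ℓ c′ ℓ′ q} (q-primePower : IsPrimePower q)
  (F : FiniteField c ℓ q) (E : QuadraticExtension F c′ ℓ′) where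
  open QuadraticExtension E
  open Extension q-primePower F E
  private
    module F where
      open FiniteField F public
      open Forms (FiniteField.commutativeRing F) public
      open Pullbacks (FiniteField.commutativeRing F) public
      open Proportionality F public
  open Forms commutativeRing
  open Pullbacks commutativeRing
  open Proportionality field₂
  open FieldLemmas field₂

  ImaginaryPair : Pred F.QuadraticForm (c ⊔ c′ ⊔ ℓ′)
  ImaginaryPair a = ∃₂ λ k (l : LinearForm) →
    ¬ (l ∝ (conj ∘ l)) × (ι ∘ a) ≋ ι k · (l ⊡ (conj ∘ l))

  private
    infixl 6 _⊕_
    infixl 7 _⊛_
    -- These two combinators push ι through a polynomial expression along its syntax tree, so that
    -- the proofs below copy the shape of `value` and `polar`.
    _⊕_ : ∀ {x y x′ y′} → ι x ≈ x′ → ι y ≈ y′ → ι (x F.+ y) ≈ x′ + y′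
    ιx ⊕ ιy = trans (ι-+ _ _) (+-cong ιx ιy)

    _⊛_ : ∀ {x y x′ y′} → ι x ≈ x′ → ι y ≈ y′ → ι (x F.* y) ≈ x′ * y′
    ιx ⊛ ιy = trans (ι-* _ _) (*-cong ιx ιy)

    ι-value : ∀ a x → ι (F.value a x) ≈ value (ι ∘ a) (ι ∘ x)
    ι-value a x = refl ⊛ (refl ⊛ refl) ⊕ refl ⊛ (refl ⊛ refl) ⊕ refl ⊛ (refl ⊛ refl)
      ⊕ refl ⊛ (refl ⊛ refl) ⊕ refl ⊛ (refl ⊛ refl) ⊕ refl ⊛ (refl ⊛ refl)

    ι-polar : ∀ a x y → ι (F.polar a x y) ≈ polar (ι ∘ a) (ι ∘ x) (ι ∘ y)
    ι-polar a x y = refl ⊛ xy 0F 0F ⊕ refl ⊛ xy 0F 1F ⊕ refl ⊛ xy 0F 2F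
      ⊕ refl ⊛ xy 1F 1F ⊕ refl ⊛ xy 1F 2F ⊕ refl ⊛ xy 2F 2F
      where
      xy : ∀ i j → ι (x i F.* y j F.+ x j F.* y i) ≈ ι (x i) * ι (y j) + ι (x j) * ι (y i)
      xy i j = refl ⊛ refl ⊕ refl ⊛ refl

    ιᴹ : F.Matrix → Matrix
    ιᴹ A i j = ι (A i j)

    ι-pullback : ∀ A a → ι ∘ F.pullback A a ≋ pullback (ιᴹ A) (ι ∘ a)
    ι-pullback A a = λ where
      0F → ι-value a (F.column A 0F)
      1F → ι-polar a (F.column A 0F) (F.column A 1F)
      2F → ι-polar a (F.column A 0F) (F.column A 2F)
      3F → ι-value a (F.column A 1F)
      4F → ι-polar a (F.column A 1F) (F.column A 2F)
      5F → ι-value a (F.column A 2F)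

    ι-I₃ : ∀ i j → ι (F.I₃ i j) ≈ I₃ i j
    ι-I₃ = λ where
      0F 0F → ι-1
      0F 1F → ι-0
      0F 2F → ι-0
      1F 0F → ι-0
      1F 1F → ι-1
      1F 2F → ι-0
      2F 0F → ι-0
      2F 1F → ι-0
      2F 2F → ι-1

    ι-GL₃ : ∀ A → F.GL₃ A → GL₃ (ιᴹ A)
    ι-GL₃ A (B , AB≈I , BA≈I) = ιᴹ B , product A B AB≈I , product B A BA≈I
      where
      product : ∀ A B → (∀ i j → (A F.⊗ B) i j F.≈ F.I₃ i j) → ∀ i j → (ιᴹ A ⊗ ιᴹ B) i j ≈ I₃ i j
      product A B AB≈I i j = trans (sym (refl ⊛ refl ⊕ (refl ⊛ refl ⊕ (refl ⊛ refl ⊕ ι-0)))) (trans (ι-cong (AB≈I i j)) (ι-I₃ i j))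

    -- The entries of the matrix come from `F` and are fixed by `conj`; hence a rational
    -- substitution keeps two conjugate factors conjugate.
    conj-transform : ∀ A l → conj ∘ transform (ιᴹ A) l ≋ transform (ιᴹ A) (conj ∘ l)
    conj-transform A l j = trans (conj-+ _ _) (+-cong (term 0F) (trans (conj-+ _ _) (+-cong (term 1F)
      (trans (conj-+ _ _) (+-cong (term 2F) (trans (conj-cong (sym ι-0)) (trans (conj-ι F.0#) ι-0)))))))
      where
      term : ∀ i → conj (l i * ι (A i j)) ≈ conj (l i) * ι (A i j)
      term i = trans (conj-* _ _) (*-congˡ (conj-ι (A i j)))

  imaginaryPair-resp : ∀ {a b} → a F.∝ b → ImaginaryPair a → ImaginaryPair b
  imaginaryPair-resp a∝b (k , l , l≁l̄ , a≋) = let j , _ , b≋ = F.∝-sym a∝b in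
    j F.* k , l , l≁l̄ , λ i → trans (ι-cong (b≋ i)) (trans (ι-* _ _) (trans (*-congˡ (a≋ i))
      (trans (sym (*-assoc _ _ _)) (*-congʳ (sym (ι-* _ _))))))

  imaginaryPair-pullback : ∀ A → F.GL₃ A → ∀ a → ImaginaryPair a → ImaginaryPair (F.pullback A a)
  imaginaryPair-pullback A A∈GL₃ a (k , l , l≁l̄ , a≋) =
    k , transform (ιᴹ A) l ,
    (λ Al∝ → l≁l̄ (transform-reflects-∝ (ιᴹ A) (ι-GL₃ A A∈GL₃) l (conj ∘ l) (∝-trans Al∝ (≋⇒∝ (conj-transform A l))))) ,
    λ i → trans (ι-pullback A a i)
      (trans (pullback-cong {ιᴹ A} {ιᴹ A} {ι ∘ a} {ι k · (l ⊡ (conj ∘ l))} (λ _ _ → refl) a≋ i)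
      (trans (pullback-· (ιᴹ A) (ι k) (l ⊡ (conj ∘ l)) i) (*-congˡ (trans (pullback-⊡ (ιᴹ A) l (conj ∘ l) i)
        (⊡-cong {transform (ιᴹ A) l} {transform (ιᴹ A) l} (λ _ → refl) (λ j → sym (conj-transform A l j)) i)))))

-- Normalised forms with two linear factors

-- The common features of the units of `F` and the norm-one elements of `E`. Inverses may depend on
-- a membership proof, as they do for units. `square-one⇒∈` ensures that the self-inverse members
-- are all the square roots of one in `K`.
record InverseClosed {c ℓ n} (K : FiniteField c ℓ n) g : Set (c ⊔ ℓ ⊔ Level.suc g) where
  open FiniteField K
  field
    G             : Pred Carrier g
    inv           : ∀ u → G u → Carrier
    inv-∈         : ∀ u u∈G → G (inv u u∈G)
    *-inv         : ∀ u u∈G → u * inv u u∈G ≈ 1#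
    square-one⇒∈  : ∀ {u} → u * u ≈ 1# → G u

module Torus {c ℓ g n} (K : FiniteField c ℓ n) (T : InverseClosed K g) where
  open Vector using ([]; _∷_)
  open FiniteField K
  open InverseClosed T
  open FieldLemmas K
  open IntegerSolver commutativeRing
  open Forms commutativeRing
  open Pullbacks commutativeRing
  open Proportionality K
  open ≈-Reasoning setoid

  Pairs : Setoid _ _
  Pairs = ×-setoid (Subsetoid setoid G) (Subsetoid setoid G)
  open Setoid Pairs using () renaming (Carrier to Pair; _≈_ to _≈ₚ_)

  private
    bar : ∃ G → ∃ G
    bar (u , u∈G) = inv u u∈G , inv-∈ u u∈G

    *-bar : ∀ (u : ∃ G) → proj₁ u * proj₁ (bar u) ≈ 1#
    *-bar (u , u∈G) = *-inv u u∈G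

    bar-unique : ∀ (u : ∃ G) {v} → proj₁ u * v ≈ 1# → proj₁ (bar u) ≈ v
    bar-unique u = inverse-unique (*-bar u)

    bar-cong : ∀ {u v : ∃ G} → proj₁ u ≈ proj₁ v → proj₁ (bar u) ≈ proj₁ (bar v)
    bar-cong {u} {v} u≈v = bar-unique u (trans (*-congʳ u≈v) (*-bar v))

    bar-bar : ∀ (u : ∃ G) → proj₁ (bar (bar u)) ≈ proj₁ u
    bar-bar u = bar-unique (bar u) (trans (*-comm _ _) (*-bar u))

    bar-swap : ∀ {u v : ∃ G} → proj₁ u ≈ proj₁ (bar v) → proj₁ (bar u) ≈ proj₁ v
    bar-swap {u} {v} u≈v̄ = trans (bar-cong {u} {bar v} u≈v̄) (bar-bar v)

  σ : Pair → Pair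
  σ (u , v) = bar u , bar v

  -- Being fixed by σ, expressed by squares: this is decidable and does not involve the chosen
  -- inverses.
  Fixed : Pred Pair ℓ
  Fixed ((u , _) , (v , _)) = u * u ≈ 1# × v * v ≈ 1#

  Moving : Setoid _ _
  Moving = Subsetoid Pairs (∁ Fixed)

  private
    fixed-resp : ∀ {x y} → x ≈ₚ y → Fixed x → Fixed y
    fixed-resp (u≈ , v≈) (uu≈1 , vv≈1) = trans (*-cong (sym u≈) (sym u≈)) uu≈1 , trans (*-cong (sym v≈) (sym v≈)) vv≈1

    self-inverse : ∀ (u : ∃ G) → proj₁ u ≈ proj₁ (bar u) → proj₁ u * proj₁ u ≈ 1#
    self-inverse u u≈ū = trans (*-congˡ u≈ū) (*-bar u)

    σ-fixed : ∀ x → x ≈ₚ σ x → Fixed x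
    σ-fixed (u , v) (u≈ū , v≈v̄) = self-inverse u u≈ū , self-inverse v v≈v̄

    σ-moving : ∀ x → ¬ Fixed x → ¬ Fixed (σ x)
    σ-moving x x-moving (ūū≈1 , v̄v̄≈1) = x-moving (σ-fixed x (bar-swap′ ūū≈1 , bar-swap′ v̄v̄≈1))
      where
      bar-swap′ : ∀ {u} → proj₁ (bar u) * proj₁ (bar u) ≈ 1# → proj₁ u ≈ proj₁ (bar u)
      bar-swap′ {u} ūū≈1 = trans (sym (bar-bar u)) (bar-unique (bar u) ūū≈1)

  fixed⇒≈σ : ∀ x → Fixed x → x ≈ₚ σ x
  fixed⇒≈σ (u , v) (uu≈1 , vv≈1) = sym (bar-unique u uu≈1) , sym (bar-unique v vv≈1)

  inversion : Setoid.Carrier Moving → Setoid.Carrier Moving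
  inversion (x , x-moving) = σ x , σ-moving x x-moving

  inversion-cong : ∀ x y → Setoid._≈_ Moving x y → Setoid._≈_ Moving (inversion x) (inversion y)
  inversion-cong ((u , v) , _) ((u′ , v′) , _) (u≈ , v≈) = bar-cong {u} {u′} u≈ , bar-cong {v} {v′} v≈

  inversion-involutive : ∀ x → Setoid._≈_ Moving (inversion (inversion x)) x
  inversion-involutive ((u , v) , _) = bar-bar u , bar-bar v

  module Inversion = Involution Moving inversion inversion-cong inversion-involutive

  SquareRootsOfOne : Setoid _ _
  SquareRootsOfOne = Subsetoid setoid (λ u → u * u ≈ 1#)

  card-inversion-orbits : ∀ {m f} → HasCardinality (Subsetoid setoid G) m → HasCardinality SquareRootsOfOne f →
    ∃ λ h → f ℕ.* f ℕ.+ (h ℕ.+ h) ≡.≡ m ℕ.* m × HasCardinality Inversion.Orbits h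
  card-inversion-orbits {m} {f} G≅m μ≅f =
    let k , f*f+k≡m*m , moving≅k = card-complement {S = Pairs} (card-× G≅m G≅m)
          (λ ((u , _) , (v , _)) → (u * u ≟ 1#) ×-dec (v * v ≟ 1#)) (λ {x} {y} → fixed-resp {x} {y})
          (card-correspondence {T = Subsetoid Pairs Fixed} (card-× μ≅f μ≅f)
            (λ ((u , _) , (v , _)) (((u′ , _) , (v′ , _)) , _) → u ≈ u′ × v ≈ v′)
            (λ ((u , uu≈1) , (v , vv≈1)) → (((u , square-one⇒∈ uu≈1) , (v , square-one⇒∈ vv≈1)) , uu≈1 , vv≈1) , refl , refl)
            (λ (((u , _) , (v , _)) , uu≈1 , vv≈1) → ((u , uu≈1) , (v , vv≈1)) , refl , refl)
            (λ (u≈ , v≈) (u′≈ , v′≈) (u≈u′ , v≈v′) → trans (sym u≈) (trans u≈u′ u′≈) , trans (sym v≈) (trans v≈v′ v′≈))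
            (λ (u≈ , v≈) (u′≈ , v′≈) (u≈u′ , v≈v′) → trans u≈ (trans u≈u′ (sym u′≈)) , trans v≈ (trans v≈v′ (sym v′≈))))
        h , h+h≡k , orbits≅h = Inversion.card-orbits moving≅k (λ (x , x-moving) x≈σx → x-moving (σ-fixed x x≈σx))
    in h , ≡.trans (≡.cong (f ℕ.* f ℕ.+_) h+h≡k) f*f+k≡m*m , orbits≅h

  factor : Pair → LinearForm
  factor ((u , _) , (v , _)) = 1# ∷ u ∷ v ∷ []

  conic : Pair → QuadraticForm
  conic x = factor x ⊡ factor (σ x)

  conic-normalised : ∀ x → conic x 0F ≈ 1# × conic x 3F ≈ 1# × conic x 5F ≈ 1#
  conic-normalised (u , v) = *-identityˡ 1# , *-bar u , *-bar v

  conic-cong : ∀ {x y} → x ≈ₚ y → conic x ≋ conic y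
  conic-cong {x@(u , v)} {y@(u′ , v′)} (u≈ , v≈) = ⊡-cong {factor x} {factor y} {factor (σ x)} {factor (σ y)}
    (λ { 0F → refl ; 1F → u≈ ; 2F → v≈ }) (λ { 0F → refl ; 1F → bar-cong {u} {u′} u≈ ; 2F → bar-cong {v} {v′} v≈ })

  conic-σ : ∀ x → conic (σ x) ≋ conic x
  conic-σ x@(u , v) i = trans
    (⊡-cong {factor (σ x)} {factor (σ x)} {factor (σ (σ x))} {factor x} (λ _ → refl) (λ { 0F → refl ; 1F → bar-bar u ; 2F → bar-bar v }) i)
    (⊡-comm (factor (σ x)) (factor x) i)

  conic-orbit : ∀ x y → x ≈ₚ y ⊎ x ≈ₚ σ y → conic x ≋ conic y
  conic-orbit x y (inj₁ x≈y)  = conic-cong {x} {y} x≈y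
  conic-orbit x y (inj₂ x≈σy) = λ i → trans (conic-cong {x} {σ y} x≈σy i) (conic-σ y i)

  -- Both factors have leading coefficient 1, so the scalar would be 1 and the pair would be fixed
  -- by σ.
  moving⇒factors≁ : ∀ x → ¬ Fixed x → ¬ (factor x ∝ factor (σ x))
  moving⇒factors≁ x x-moving (k , _ , eq) = x-moving (σ-fixed x (reduce-k (eq 1F) , reduce-k (eq 2F)))
    where
    k≈1 : k ≈ 1#
    k≈1 = sym (trans (eq 0F) (*-identityʳ k))
    reduce-k : ∀ {u v} → u ≈ k * v → u ≈ v
    reduce-k u≈kv = trans u≈kv (trans (*-congʳ k≈1) (*-identityˡ _))

  private
    -- An element and its inverse are the two roots of T² - τT + 1, where τ is their sum.
    same-trace : ∀ (u v : ∃ G) → proj₁ u + proj₁ (bar u) ≈ proj₁ v + proj₁ (bar v) →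
                 proj₁ u ≈ proj₁ v ⊎ proj₁ u ≈ proj₁ (bar v)
    same-trace u v eq = ⊎.map x-y≈0⇒x≈y x-y≈0⇒x≈y (x*y≈0⇒x≈0∨y≈0 (begin
      (a - b) * (a - b̄)            ≈⟨ solve 3 (λ a b b̄ → (a :- b) :* (a :- b̄) := a :* a :+ b :* b̄ :- a :* (b :+ b̄)) refl a b b̄ ⟩
      a * a + b * b̄ - a * (b + b̄)  ≈⟨ +-cong (+-congˡ (*-bar v)) (-‿cong (*-congˡ (sym eq))) ⟩
      a * a + 1# - a * (a + ā)     ≈⟨ +-congʳ (+-congˡ (*-bar u)) ⟨
      a * a + a * ā - a * (a + ā)  ≈⟨ solve 2 (λ a ā → a :* a :+ a :* ā :- a :* (a :+ ā) := :0) refl a ā ⟩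
      0#                           ∎))
      where
      a = proj₁ u
      ā = proj₁ (bar u)
      b = proj₁ v
      b̄ = proj₁ (bar v)

    -- The equation says (u - ū)(v - v̄) = 0.
    twisted : ∀ {u ū v v̄} → u * v + ū * v̄ ≈ u * v̄ + ū * v → u ≈ ū ⊎ v ≈ v̄
    twisted {u} {ū} {v} {v̄} eq = ⊎.map x-y≈0⇒x≈y x-y≈0⇒x≈y (x*y≈0⇒x≈0∨y≈0
      (trans (solve 4 (λ a b c d → (a :- b) :* (c :- d) := (a :* c :+ b :* d) :- (a :* d :+ b :* c)) refl u ū v v̄) (x≈y⇒x-y≈0 eq)))

  -- The coefficients of X₀X₁ and X₀X₂ determine u and v up to separate inversions. The coefficient
  -- of X₁X₂ couples them: if only one was inverted, `twisted` shows that u or v is its own inverse,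
  -- and the inversion can be made simultaneous or undone.
  conic-injective : ∀ x y → conic x ≋ conic y → x ≈ₚ y ⊎ x ≈ₚ σ y
  conic-injective (u , v) (u′ , v′) eq = combine (same-trace u u′ (trace u u′ (eq 1F))) (same-trace v v′ (trace v v′ (eq 2F)))
    where
    trace : ∀ (u u′ : ∃ G) → 1# * proj₁ (bar u) + proj₁ u * 1# ≈ 1# * proj₁ (bar u′) + proj₁ u′ * 1# → proj₁ u + proj₁ (bar u) ≈ proj₁ u′ + proj₁ (bar u′)
    trace u u′ eq = trans (simplify u) (trans eq (sym (simplify u′)))
      where
      simplify : ∀ u → proj₁ u + proj₁ (bar u) ≈ 1# * proj₁ (bar u) + proj₁ u * 1#
      simplify u = solve 2 (λ a b → a :+ b := :1 :* b :+ a :* :1) refl (proj₁ u) (proj₁ (bar u))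

    combine : _ → _ → (u , v) ≈ₚ (u′ , v′) ⊎ (u , v) ≈ₚ σ (u′ , v′)
    combine (inj₁ u≈u′) (inj₁ v≈v′) = inj₁ (u≈u′ , v≈v′)
    combine (inj₂ u≈ū′) (inj₂ v≈v̄′) = inj₂ (u≈ū′ , v≈v̄′)
    combine (inj₁ u≈u′) (inj₂ v≈v̄′) = [ (λ u′≈ū′ → inj₂ (trans u≈u′ u′≈ū′ , v≈v̄′)) , (λ v′≈v̄′ → inj₁ (u≈u′ , trans v≈v̄′ (sym v′≈v̄′))) ]′
      (twisted (begin
        proj₁ u′ * proj₁ v′ + proj₁ (bar u′) * proj₁ (bar v′)       ≈⟨ +-cong (*-cong (sym u≈u′) (sym (bar-swap {v} {v′} v≈v̄′))) (trans (*-comm _ _) (*-cong (sym v≈v̄′) (sym (bar-cong {u} {u′} u≈u′)))) ⟩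
        proj₁ u * proj₁ (bar v) + proj₁ v * proj₁ (bar u)           ≈⟨ eq 4F ⟩
        proj₁ u′ * proj₁ (bar v′) + proj₁ v′ * proj₁ (bar u′)       ≈⟨ +-congˡ (*-comm _ _) ⟩
        proj₁ u′ * proj₁ (bar v′) + proj₁ (bar u′) * proj₁ v′       ∎))
    combine (inj₂ u≈ū′) (inj₁ v≈v′) = [ (λ u′≈ū′ → inj₁ (trans u≈ū′ (sym u′≈ū′) , v≈v′)) , (λ v′≈v̄′ → inj₂ (u≈ū′ , trans v≈v′ v′≈v̄′)) ]′
      (twisted (begin
        proj₁ u′ * proj₁ v′ + proj₁ (bar u′) * proj₁ (bar v′)       ≈⟨ +-cong (*-cong (sym (bar-swap {u} {u′} u≈ū′)) (sym v≈v′)) (*-cong (sym u≈ū′) (sym (bar-cong {v} {v′} v≈v′))) ⟩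
        proj₁ (bar u) * proj₁ v + proj₁ u * proj₁ (bar v)           ≈⟨ trans (+-comm _ _) (+-congˡ (*-comm _ _)) ⟩
        proj₁ u * proj₁ (bar v) + proj₁ v * proj₁ (bar u)           ≈⟨ eq 4F ⟩
        proj₁ u′ * proj₁ (bar v′) + proj₁ v′ * proj₁ (bar u′)       ≈⟨ +-congˡ (*-comm _ _) ⟩
        proj₁ u′ * proj₁ (bar v′) + proj₁ (bar u′) * proj₁ v′       ∎))

  module Factorisation (l m : LinearForm) (l₀m₀≈1 : l 0F * m 0F ≈ 1#) (l₁m₁≈1 : l 1F * m 1F ≈ 1#) (l₂m₂≈1 : l 2F * m 2F ≈ 1#)
    (u∈G : G (l 1F * m 0F)) (v∈G : G (l 2F * m 0F)) where

    -- The ratios lᵢ/l₀, since m₀ is the inverse of l₀. Their inverses are the corresponding ratios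
    -- mᵢ/m₀ = l₀mᵢ of the other factor.
    roots : Pair
    roots = (l 1F * m 0F , u∈G) , (l 2F * m 0F , v∈G)

    private
      inverse-of-ratio : ∀ i (x∈G : G (l i * m 0F)) → l i * m i ≈ 1# → inv (l i * m 0F) x∈G ≈ l 0F * m i
      inverse-of-ratio i x∈G lᵢmᵢ≈1 = bar-unique (_ , x∈G) (begin
        l i * m 0F * (l 0F * m i)    ≈⟨ solve 4 (λ a b c d → a :* b :* (c :* d) := (c :* b) :* (a :* d)) refl (l i) (m 0F) (l 0F) (m i) ⟩
        l 0F * m 0F * (l i * m i)    ≈⟨ trans (*-cong l₀m₀≈1 lᵢmᵢ≈1) (*-identityˡ 1#) ⟩
        1#                           ∎)

      ū = inverse-of-ratio 1F u∈G l₁m₁≈1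
      v̄ = inverse-of-ratio 2F v∈G l₂m₂≈1

    conic-roots : l ⊡ m ≋ conic roots
    conic-roots = λ
      { 0F → trans l₀m₀≈1 (sym (*-identityˡ 1#))
      ; 1F → +-cong (trans (sym ū) (sym (*-identityˡ _))) (sym (*-identityʳ _))
      ; 2F → +-cong (trans (sym v̄) (sym (*-identityˡ _))) (sym (*-identityʳ _))
      ; 3F → trans l₁m₁≈1 (sym (*-inv _ u∈G))
      ; 4F → +-cong (cross (l 1F) (m 2F) v̄) (cross (l 2F) (m 1F) ū)
      ; 5F → trans l₂m₂≈1 (sym (*-inv _ v∈G))
      }
      where
      cross : ∀ a b {c} → c ≈ l 0F * b → a * b ≈ a * m 0F * c
      cross a b {c} c≈ = begin
        a * b                      ≈⟨ trans (*-congʳ l₀m₀≈1) (*-identityˡ _) ⟨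
        l 0F * m 0F * (a * b)      ≈⟨ solve 4 (λ x y a b → x :* y :* (a :* b) := a :* y :* (x :* b)) refl (l 0F) (m 0F) a b ⟩
        a * m 0F * (l 0F * b)      ≈⟨ *-congˡ c≈ ⟨
        a * m 0F * c               ∎

    -- Self-inverse ratios mean lᵢm₀ = l₀mᵢ; multiplication by l₀ gives lᵢ = l₀²mᵢ, whence the
    -- scalar.
    fixed⇒∝ : Fixed roots → l ∝ m
    fixed⇒∝ (uu≈1 , vv≈1) = l 0F * l 0F , *-≉0 l₀≉0 l₀≉0 , λ
      { 0F → trans (sym (*-identityʳ _)) (trans (*-congˡ (sym l₀m₀≈1)) (sym (*-assoc _ _ _)))
      ; 1F → scale 1F (trans (sym (bar-unique (_ , u∈G) uu≈1)) ū)
      ; 2F → scale 2F (trans (sym (bar-unique (_ , v∈G) vv≈1)) v̄)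
      }
      where
      l₀≉0 = x*y≈1⇒x≉0 l₀m₀≈1
      scale : ∀ i → l i * m 0F ≈ l 0F * m i → l i ≈ l 0F * l 0F * m i
      scale i eq = begin
        l i                        ≈⟨ trans (*-congʳ l₀m₀≈1) (*-identityˡ _) ⟨
        l 0F * m 0F * l i          ≈⟨ solve 3 (λ x y a → x :* y :* a := x :* (a :* y)) refl (l 0F) (m 0F) (l i) ⟩
        l 0F * (l i * m 0F)        ≈⟨ *-congˡ eq ⟩
        l 0F * (l 0F * m i)        ≈⟨ *-assoc _ _ _ ⟨
        l 0F * l 0F * m i          ∎

-- Normalised singular forms

module SingularConics {c ℓ q} (F : FiniteField c ℓ q) where
  open Vector using ([]; _∷_)
  open FiniteField F
  open FieldLemmas F
  open IntegerSolver commutativeRing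
  open Forms commutativeRing
  open ≈-Reasoning setoid

  square≈0⇒≈0 : ∀ {x} → x * x ≈ 0# → x ≈ 0#
  square≈0⇒≈0 = [ id , id ]′ ∘ x*y≈0⇒x≈0∨y≈0

  SquareRootsOfOne : Setoid _ _
  SquareRootsOfOne = Subsetoid setoid (λ u → u * u ≈ 1#)

  card-square-roots-even : 1# + 1# ≈ 0# → HasCardinality SquareRootsOfOne 1
  card-square-roots-even 2≈0 = card-correspondence (card-singleton 1#)
    (λ s t → proj₁ s ≈ proj₁ t)
    (λ (x , x≈1) → (x , trans (*-cong x≈1 x≈1) (*-identityˡ 1#)) , refl)
    (λ (u , uu≈1) → (u , x-y≈0⇒x≈y (square≈0⇒≈0 (begin
      (u - 1#) * (u - 1#)                      ≈⟨ solve 1 (λ u → (u :- :1) :* (u :- :1) := (u :* u :- :1) :+ (:1 :+ :1) :* (:1 :- u)) refl u ⟩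
      (u * u - 1#) + (1# + 1#) * (1# - u)      ≈⟨ +-cong (x≈y⇒x-y≈0 uu≈1) (*-congʳ 2≈0) ⟩
      0# + 0# * (1# - u)                       ≈⟨ trans (+-identityˡ _) (zeroˡ _) ⟩
      0#                                       ∎))) , refl)
    (λ s≈t s′≈t′ s≈s′ → trans (sym s≈t) (trans s≈s′ s′≈t′))
    (λ s≈t s′≈t′ t≈t′ → trans s≈t (trans t≈t′ (sym s′≈t′)))

  card-square-roots-odd : 1# + 1# ≉ 0# → HasCardinality SquareRootsOfOne 2
  card-square-roots-odd 2≉0 = card-correspondence (card-⊎ (card-singleton 1#) (card-singleton (- 1#)))
    (λ { (inj₁ s) t → proj₁ s ≈ proj₁ t ; (inj₂ s) t → proj₁ s ≈ proj₁ t })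
    (λ { (inj₁ (x , x≈1)) → (x , trans (*-cong x≈1 x≈1) (*-identityˡ 1#)) , refl
       ; (inj₂ (x , x≈-1)) → (x , trans (*-cong x≈-1 x≈-1) (solve 0 ((:- :1) :* (:- :1) := :1) refl)) , refl })
    (λ (u , uu≈1) → [ (λ eq → inj₁ (u , x-y≈0⇒x≈y eq) , refl) , (λ eq → inj₂ (u , x-y≈0⇒x≈y eq) , refl) ]′
      (x*y≈0⇒x≈0∨y≈0 (trans (solve 1 (λ u → (u :- :1) :* (u :- (:- :1)) := u :* u :- :1) refl u) (x≈y⇒x-y≈0 uu≈1))))
    (λ { {inj₁ _} s≈t s′≈t′ (inj₁ s≈s′) → trans (sym s≈t) (trans s≈s′ s′≈t′)
       ; {inj₂ _} s≈t s′≈t′ (inj₂ s≈s′) → trans (sym s≈t) (trans s≈s′ s′≈t′) })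
    (λ { {inj₁ _} {inj₁ _} s≈t s′≈t′ t≈t′ → inj₁ (trans s≈t (trans t≈t′ (sym s′≈t′)))
       ; {inj₂ _} {inj₂ _} s≈t s′≈t′ t≈t′ → inj₂ (trans s≈t (trans t≈t′ (sym s′≈t′)))
       ; {inj₁ (_ , x≈1)} {inj₂ (_ , y≈-1)} s≈t s′≈t′ t≈t′ → contradiction (trans (sym x≈1) (trans s≈t (trans t≈t′ (trans (sym s′≈t′) y≈-1)))) 1≉-1
       ; {inj₂ (_ , x≈-1)} {inj₁ (_ , y≈1)} s≈t s′≈t′ t≈t′ → contradiction (trans (sym y≈1) (trans s′≈t′ (trans (sym t≈t′) (trans (sym s≈t) x≈-1)))) 1≉-1 })
    where
    1≉-1 : 1# ≉ - 1#
    1≉-1 1≈-1 = 2≉0 (trans (+-congˡ 1≈-1) (-‿inverseʳ 1#))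

  Triples : Setoid c ℓ
  Triples = ×-setoid setoid (×-setoid setoid setoid)

  affine : Carrier × Carrier × Carrier → QuadraticForm
  affine (b , c , d) = 1# ∷ b ∷ c ∷ 1# ∷ d ∷ 1# ∷ []

  Singular : Pred (Carrier × Carrier × Carrier) ℓ
  Singular t = discriminant (affine t) ≈ 0#

  private
    2# 4# : Carrier
    2# = 1# + 1#
    4# = 2# * 2#

    -- The quadratic form x² - bxy + y² at (1 , s), the direction of slope s.
    ε : Carrier → Carrier → Carrier
    ε b s = 1# - b * s + s * s

    ε-cong : ∀ {b b′ s s′} → b ≈ b′ → s ≈ s′ → ε b s ≈ ε b′ s′
    ε-cong b≈ s≈ = +-cong (+-congˡ (-‿cong (*-cong b≈ s≈))) (*-cong s≈ s≈)

    -- With x = c - 2 and y = d - b the conic for fixed b is (b² - 4)x = x² - bxy + y². It passes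
    -- through the origin and meets x = 0 there only.
    discriminant-affine : ∀ b c d →
      discriminant (affine (b , c , d)) ≈ (b * b - 4#) * (c - 2#) - ((c - 2#) * (c - 2#) - b * (c - 2#) * (d - b) + (d - b) * (d - b))
    discriminant-affine = solve 3 (λ b c d →
      4 :× (:1 :* :1 :* :1) :+ b :* c :* d :- :1 :* (d :* d) :- :1 :* (c :* c) :- :1 :* (b :* b) :=
      (b :* b :- (:1 :+ :1) :* (:1 :+ :1)) :* (c :- (:1 :+ :1)) :- ((c :- (:1 :+ :1)) :* (c :- (:1 :+ :1)) :- b :* (c :- (:1 :+ :1)) :* (d :- b) :+ (d :- b) :* (d :- b)))
      refl

    -- On the line y = sx the factor x splits off; it accounts for the base point, and the other
    -- factor gives x = (b² - 4)/ε for the second intersection.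
    discriminant-slope : ∀ {b c d s} → d ≈ b + s * (c - 2#) →
      discriminant (affine (b , c , d)) ≈ (c - 2#) * ((b * b - 4#) - (c - 2#) * ε b s)
    discriminant-slope {b} {c} {d} {s} d≈ = begin
      discriminant (affine (b , c , d))                       ≈⟨ discriminant-affine b c d ⟩
      (b * b - 4#) * x - (x * x - b * x * (d - b) + (d - b) * (d - b))
        ≈⟨ +-congˡ (-‿cong (+-cong (+-congˡ (-‿cong (*-congˡ y≈))) (*-cong y≈ y≈))) ⟩
      (b * b - 4#) * x - (x * x - b * x * (s * x) + s * x * (s * x))
        ≈⟨ solve 4 (λ b x s f → (b :* b :- f) :* x :- (x :* x :- b :* x :* (s :* x) :+ s :* x :* (s :* x)) := x :* ((b :* b :- f) :- x :* (:1 :- b :* s :+ s :* s))) refl b x s 4# ⟩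
      x * ((b * b - 4#) - x * ε b s)                          ∎
      where
      x = c - 2#
      y≈ : d - b ≈ s * x
      y≈ = trans (+-congʳ d≈) (solve 2 (λ b y → b :+ y :- b := y) refl b (s * x))

    -- A uniform description of b = ±2. In characteristic two b² = 4 means b = 0 = 1 + 1; otherwise
    -- u = b/2.
    halve : ∀ {b} → b * b ≈ 4# → ∃ λ u → b ≈ u + u × u * u ≈ 1#
    halve {b} bb≈4 with 2# ≟ 0#
    ... | yes 2≈0 = 1# , trans (square≈0⇒≈0 (trans bb≈4 (trans (*-congʳ 2≈0) (zeroˡ _)))) (sym 2≈0) , *-identityˡ 1#
    ... | no  2≉0 = let h , 2h≈1 = inverse 2# 2≉0 in b * h ,
      (begin
        b                    ≈⟨ *-identityʳ b ⟨
        b * 1#               ≈⟨ *-congˡ 2h≈1 ⟨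
        b * (2# * h)         ≈⟨ solve 2 (λ b h → b :* ((:1 :+ :1) :* h) := b :* h :+ b :* h) refl b h ⟩
        b * h + b * h        ∎) ,
      (begin
        b * h * (b * h)      ≈⟨ solve 2 (λ b h → b :* h :* (b :* h) := b :* b :* (h :* h)) refl b h ⟩
        b * b * (h * h)      ≈⟨ *-congʳ bb≈4 ⟩
        4# * (h * h)         ≈⟨ solve 1 (λ h → (:1 :+ :1) :* (:1 :+ :1) :* (h :* h) := (:1 :+ :1) :* h :* ((:1 :+ :1) :* h)) refl h ⟩
        2# * h * (2# * h)    ≈⟨ trans (*-cong 2h≈1 2h≈1) (*-identityˡ 1#) ⟩
        1#                   ∎)

    -- In characteristic two the double carries no information about u, so the squares must be used:
    -- (u - u′)² = 1 - 2u′² + u′² = 1 - u′² = 0.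
    halves-agree : ∀ {b b′ u u′} → b ≈ u + u → u * u ≈ 1# → b′ ≈ u′ + u′ → u′ * u′ ≈ 1# → b ≈ b′ → u ≈ u′
    halves-agree {b} {b′} {u} {u′} b≈2u uu≈1 b′≈2u′ u′u′≈1 b≈b′ = x-y≈0⇒x≈y (square≈0⇒≈0 (begin
      (u - u′) * (u - u′)                    ≈⟨ solve 2 (λ u v → (u :- v) :* (u :- v) := u :* u :- (u :+ u) :* v :+ v :* v) refl u u′ ⟩
      u * u - (u + u) * u′ + u′ * u′         ≈⟨ +-cong (+-cong uu≈1 (-‿cong (*-congʳ (trans (sym b≈2u) (trans b≈b′ b′≈2u′))))) refl ⟩
      1# - (u′ + u′) * u′ + u′ * u′          ≈⟨ solve 1 (λ v → :1 :- (v :+ v) :* v :+ v :* v := :1 :- v :* v) refl u′ ⟩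
      1# - u′ * u′                           ≈⟨ x≈y⇒x-y≈0 (sym u′u′≈1) ⟩
      0#                                     ∎))

    ε-double : ∀ {b u} s → b ≈ u + u → u * u ≈ 1# → ε b s ≈ (s - u) * (s - u)
    ε-double {b} {u} s b≈2u uu≈1 = begin
      1# - b * s + s * s             ≈⟨ +-congʳ (+-cong (sym uu≈1) (-‿cong (*-congʳ b≈2u))) ⟩
      u * u - (u + u) * s + s * s    ≈⟨ solve 2 (λ u s → u :* u :- (u :+ u) :* s :+ s :* s := (s :- u) :* (s :- u)) refl u s ⟩
      (s - u) * (s - u)              ∎

    double⇒bb≈4 : ∀ {b u} → b ≈ u + u → u * u ≈ 1# → b * b ≈ 4#
    double⇒bb≈4 {b} {u} b≈2u uu≈1 = begin
      b * b                ≈⟨ *-cong b≈2u b≈2u ⟩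
      (u + u) * (u + u)    ≈⟨ solve 1 (λ u → (u :+ u) :* (u :+ u) := (:1 :+ :1) :* (:1 :+ :1) :* (u :* u)) refl u ⟩
      4# * (u * u)         ≈⟨ trans (*-congˡ uu≈1) (*-identityʳ _) ⟩
      4#                   ∎

    Slopes : Setoid _ _
    Slopes = ×-setoid setoid setoid

    Zero : Pred (Carrier × Carrier) ℓ
    Zero (b , s) = ε b s ≈ 0#

    -- ε b s = 0 forces s to be a unit and b to be s + s⁻¹, so the solutions form a graph over the
    -- units.
    card-Zero : ∀ {k} → HasCardinality Nonzero k → HasCardinality (Subsetoid Slopes Zero) k
    card-Zero N≅k = card-correspondence {T = Subsetoid Slopes Zero} N≅k
      (λ s t → proj₁ s ≈ proj₂ (proj₁ t))
      (λ (s , s≉0) → let s⁻¹ , ss⁻¹≈1 = inverse s s≉0 in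
        ((s + s⁻¹ , s) , (begin
          1# - (s + s⁻¹) * s + s * s   ≈⟨ solve 2 (λ s r → :1 :- (s :+ r) :* s :+ s :* s := :1 :- s :* r) refl s s⁻¹ ⟩
          1# - s * s⁻¹                 ≈⟨ x≈y⇒x-y≈0 (sym ss⁻¹≈1) ⟩
          0#                           ∎)) , refl)
      (λ ((b , s) , ε≈0) → (s , λ s≈0 → 1≉0 (begin
          1#                    ≈⟨ solve 1 (λ b → :1 := :1 :- b :* :0 :+ :0 :* :0) refl b ⟩
          ε b 0#                ≈⟨ ε-cong refl (sym s≈0) ⟩
          ε b s                 ≈⟨ ε≈0 ⟩
          0#                    ∎)) , refl)
      (λ {s} {s′} {t} {t′} s≈t s′≈t′ s≈s′ → b-determined (proj₂ s) s≈t (proj₂ t) (proj₂ t′) (trans (sym s≈t) (trans s≈s′ s′≈t′)) , trans (sym s≈t) (trans s≈s′ s′≈t′))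
      (λ s≈t s′≈t′ (_ , t≈t′) → trans s≈t (trans t≈t′ (sym s′≈t′)))
      where
      b-determined : ∀ {s₀ b b′ s s′} → s₀ ≉ 0# → s₀ ≈ s → ε b s ≈ 0# → ε b′ s′ ≈ 0# → s ≈ s′ → b ≈ b′
      b-determined {s₀} {b} {b′} {s} {s′} s₀≉0 s₀≈s ε≈0 ε′≈0 s≈s′ = *-cancelˡ-≉0 (λ s≈0 → s₀≉0 (trans s₀≈s s≈0)) (begin
        s * b                            ≈⟨ solve 2 (λ s b → s :* b := :1 :+ s :* s :- (:1 :- b :* s :+ s :* s)) refl s b ⟩
        1# + s * s - ε b s               ≈⟨ +-congˡ (-‿cong (trans ε≈0 (sym (trans (ε-cong refl s≈s′) ε′≈0)))) ⟩
        1# + s * s - ε b′ s              ≈⟨ solve 2 (λ s b → s :* b := :1 :+ s :* s :- (:1 :- b :* s :+ s :* s)) refl s b′ ⟨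
        s * b′                           ∎)

    NonZero : Setoid _ _
    NonZero = Subsetoid Slopes (∁ Zero)

    -- Lines of slope s through the point c = 2, d = b of the conic of singular
    -- forms with given b; for b = ±2 this conic is a double line of slope u,
    -- and its points other than (2 , b) are then labelled by u + x instead.
    OnSlope : Carrier × Carrier → Carrier × Carrier × Carrier → Set _
    OnSlope (b , s) (b′ , c , d) =
      (b * b ≉ 4# × d ≈ b + s * (c - 2#)) ⊎
      (∃ λ u → b ≈ u + u × u * u ≈ 1# × d ≈ b + u * (c - 2#) × s ≈ u + (c - 2#))

    -- The left summand labels the q base points with c = 2, one for each b; the right one labels
    -- the points with c ≉ 2. The slopes with ε = 0 are left out because their lines meet no further
    -- point when b² ≉ 4. `Lift` only equalises universe levels.
    Parametrises : Carrier ⊎ ∃ (∁ Zero) → ∃ Singular → Set _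
    Parametrises (inj₁ b) ((b′ , c′ , d) , _) = Lift c (b ≈ b′ × c′ ≈ 2# × d ≈ b)
    Parametrises (inj₂ ((b , s) , _)) (t@(b′ , c , d) , _) = b ≈ b′ × c ≉ 2# × OnSlope (b , s) t

    Source : Setoid _ _
    Source = ⊎-setoid setoid NonZero

    2+x-2 : ∀ x → 2# + x - 2# ≈ x
    2+x-2 = solve 1 (λ x → (:1 :+ :1) :+ x :- (:1 :+ :1) := x) refl

    slope-singular : ∀ {b s x} → x * ((b * b - 4#) - x * ε b s) ≈ 0# → Singular (b , 2# + x , b + s * x)
    slope-singular {b} {s} {x} eq = trans (discriminant-slope (+-congˡ (*-congˡ (sym (2+x-2 x)))))
      (trans (*-cong (2+x-2 x) (+-congˡ (-‿cong (*-congʳ (2+x-2 x))))) eq)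

    total : ∀ s → ∃ (Parametrises s)
    total (inj₁ b) = ((b , 2# , b) , trans (discriminant-affine b 2# b)
      (solve 2 (λ b f → (b :* b :- f) :* (:1 :+ :1 :- (:1 :+ :1)) :- ((:1 :+ :1 :- (:1 :+ :1)) :* (:1 :+ :1 :- (:1 :+ :1)) :- b :* (:1 :+ :1 :- (:1 :+ :1)) :* (b :- b) :+ (b :- b) :* (b :- b)) := :0) refl b 4#)) ,
      lift (refl , refl , refl)
    total (inj₂ ((b , s) , ε≉0)) with (b * b) ≟ 4#
    ... | no bb≉4 = ((b , 2# + x , b + s * x) , slope-singular (trans (*-congˡ (x≈y⇒x-y≈0 (sym xε≈))) (zeroʳ x))) ,
      refl , (λ 2+x≈2 → *-≉0 (λ eq → bb≉4 (x-y≈0⇒x≈y eq)) e⁻¹≉0 (trans (sym (2+x-2 x)) (x≈y⇒x-y≈0 2+x≈2))) ,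
      inj₁ (bb≉4 , +-congˡ (*-congˡ (sym (2+x-2 x))))
      where
      e⁻¹ = proj₁ (inverse (ε b s) ε≉0)
      ee⁻¹≈1 = proj₂ (inverse (ε b s) ε≉0)
      e⁻¹≉0 = x*y≈1⇒x≉0 (trans (*-comm e⁻¹ _) ee⁻¹≈1)
      -- The second intersection of the line with the conic; b² ≉ 4 keeps it away from the base
      -- point.
      x = (b * b - 4#) * e⁻¹
      xε≈ : x * ε b s ≈ b * b - 4#
      xε≈ = trans (*-assoc _ _ _) (trans (*-congˡ (trans (*-comm _ _) ee⁻¹≈1)) (*-identityʳ _))
    -- For b = 2u the conic is (y - ux)² = 0, so any x gives a singular form on the line of slope u.
    -- Taking x = s - u makes x nonzero, as its square is ε b s.
    ... | yes bb≈4 = let u , b≈2u , uu≈1 = halve bb≈4 ; x = s - u in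
      ((b , 2# + x , b + u * x) , slope-singular (begin
        x * ((b * b - 4#) - x * ε b u)               ≈⟨ *-congˡ (+-cong (x≈y⇒x-y≈0 bb≈4) (-‿cong (*-congˡ (ε-double u b≈2u uu≈1)))) ⟩
        x * (0# - x * ((u - u) * (u - u)))           ≈⟨ solve 2 (λ x u → x :* (:0 :- x :* ((u :- u) :* (u :- u))) := :0) refl x u ⟩
        0#                                           ∎)) ,
      refl , (λ 2+x≈2 → ε≉0 (trans (ε-double s b≈2u uu≈1) (trans (*-congʳ (trans (sym (2+x-2 x)) (x≈y⇒x-y≈0 2+x≈2))) (zeroˡ _)))) ,
      inj₂ (u , b≈2u , uu≈1 , +-congˡ (*-congˡ (sym (2+x-2 x))) , trans (solve 2 (λ s u → s := u :+ (s :- u)) refl s u) (+-congˡ (sym (2+x-2 x))))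

    surjective : ∀ t → ∃ λ s → Parametrises s t
    surjective ((b , c , d) , singular) with c ≟ 2#
    ... | yes c≈2 = inj₁ b , lift (refl , c≈2 , x-y≈0⇒x≈y (square≈0⇒≈0 (begin
      (d - b) * (d - b)                       ≈⟨ solve 4 (λ b d z f → z :* z := :- ((b :* b :- f) :* :0 :- (:0 :* :0 :- b :* :0 :* z :+ z :* z))) refl b d (d - b) 4# ⟩
      - ((b * b - 4#) * 0# - (0# * 0# - b * 0# * (d - b) + (d - b) * (d - b)))
        ≈⟨ -‿cong (+-cong (*-congˡ x≈0) (-‿cong (+-congʳ (+-cong (*-cong x≈0 x≈0) (-‿cong (*-congʳ (*-congˡ x≈0))))))) ⟨
      - ((b * b - 4#) * x - (x * x - b * x * (d - b) + (d - b) * (d - b)))   ≈⟨ -‿cong (discriminant-affine b c d) ⟨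
      - discriminant (affine (b , c , d))     ≈⟨ trans (-‿cong singular) (solve 0 (:- :0 := :0) refl) ⟩
      0#                                      ∎)))
      where
      x = c - 2#
      x≈0 : x ≈ 0#
      x≈0 = x≈y⇒x-y≈0 c≈2
    ... | no c≉2 = by-slope ((b * b) ≟ 4#)
      where
      x = c - 2#
      x≉0 : x ≉ 0#
      x≉0 x≈0 = c≉2 (x-y≈0⇒x≈y x≈0)
      x⁻¹ = proj₁ (inverse x x≉0)
      xx⁻¹≈1 = proj₂ (inverse x x≉0)
      s = (d - b) * x⁻¹
      d≈ : d ≈ b + s * x
      d≈ = begin
        d                       ≈⟨ solve 2 (λ d b → d := b :+ (d :- b) :* :1) refl d b ⟩
        b + (d - b) * 1#        ≈⟨ +-congˡ (*-congˡ xx⁻¹≈1) ⟨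
        b + (d - b) * (x * x⁻¹) ≈⟨ +-congˡ (solve 3 (λ y x r → y :* (x :* r) := y :* r :* x) refl (d - b) x x⁻¹) ⟩
        b + s * x               ∎
      -- Off the base point the factor x of `discriminant-slope` can be cancelled.
      bb-4≈xε : b * b - 4# ≈ x * ε b s
      bb-4≈xε = [ (λ x≈0 → contradiction x≈0 x≉0) , x-y≈0⇒x≈y ]′ (x*y≈0⇒x≈0∨y≈0 (trans (sym (discriminant-slope d≈)) singular))

      by-slope : Dec (b * b ≈ 4#) → _
      by-slope (no bb≉4) = inj₂ ((b , s) , λ ε≈0 → bb≉4 (x-y≈0⇒x≈y (trans bb-4≈xε (trans (*-congˡ ε≈0) (zeroʳ x))))) ,
        refl , c≉2 , inj₁ (bb≉4 , d≈)
      by-slope (yes bb≈4) = inj₂ ((b , u + x) , λ ε≈0 → x≉0 (trans (solve 2 (λ u x → x := u :+ x :- u) refl u x) (square≈0⇒≈0 (trans (sym (ε-double (u + x) b≈2u uu≈1)) ε≈0)))) ,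
        refl , c≉2 , inj₂ (u , b≈2u , uu≈1 , trans d≈ (+-congˡ (*-congʳ s≈u)) , refl)
        where
        u = proj₁ (halve bb≈4)
        b≈2u = proj₁ (proj₂ (halve bb≈4))
        uu≈1 = proj₂ (proj₂ (halve bb≈4))
        -- With b² = 4 and x ≉ 0 the equation of the conic reduces to ε b s = (s - u)² = 0.
        s≈u : s ≈ u
        s≈u = x-y≈0⇒x≈y (square≈0⇒≈0 (trans (sym (ε-double s b≈2u uu≈1))
          (*-cancelˡ-≉0 x≉0 (trans (sym bb-4≈xε) (trans (x≈y⇒x-y≈0 bb≈4) (sym (zeroʳ x)))))))

    x-slope : ∀ {b s b′ c d} → b ≈ b′ → c ≉ 2# → d ≈ b + s * (c - 2#) → Singular (b′ , c , d) → (c - 2#) * ε b s ≈ b * b - 4#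
    x-slope {b} {s} {b′} {c} {d} b≈b′ c≉2 d≈ singular =
      [ (λ x≈0 → contradiction (x-y≈0⇒x≈y x≈0) c≉2) , sym ∘ x-y≈0⇒x≈y ]′ (x*y≈0⇒x≈0∨y≈0 (trans (sym (discriminant-slope {b} {c} {d} {s} d≈))
        (trans (discriminant-affine b c d) (trans (+-cong (*-congʳ (+-congʳ (*-cong b≈b′ b≈b′))) (-‿cong (+-cong (+-congˡ (-‿cong (*-cong (*-congʳ b≈b′) y≈))) (*-cong y≈ y≈))))
          (trans (sym (discriminant-affine b′ c d)) singular)))))
      where
      y≈ : d - b ≈ d - b′
      y≈ = +-congˡ (-‿cong b≈b′)

    2-cancel : ∀ {c c′} → c - 2# ≈ c′ - 2# → c ≈ c′
    2-cancel {c} {c′} eq = x-y≈0⇒x≈y (trans (solve 2 (λ c d → c :- d := (c :- (:1 :+ :1)) :- (d :- (:1 :+ :1))) refl c c′) (x≈y⇒x-y≈0 eq))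

    functional : ∀ {s s′ t t′} → Parametrises s t → Parametrises s′ t′ → Setoid._≈_ Source s s′ → Setoid._≈_ Triples (proj₁ t) (proj₁ t′)
    functional {inj₁ _} (lift (b≈ , c≈2 , d≈b)) (lift (b′≈ , c′≈2 , d′≈b′)) (inj₁ b≈b′) =
      trans (sym b≈) (trans b≈b′ b′≈) , trans c≈2 (sym c′≈2) , trans d≈b (trans b≈b′ (sym d′≈b′))
    functional {inj₂ ((b , s) , ε≉0)} {inj₂ ((b′ , s′) , _)} {_ , singular} {_ , singular′} (b≈ , c≉2 , inj₁ (bb≉4 , d≈)) (b′≈ , c′≉2 , inj₁ (_ , d′≈)) (inj₂ (b≈b′ , s≈s′)) =
      trans (sym b≈) (trans b≈b′ b′≈) , 2-cancel x≈x′ , trans d≈ (trans (+-cong b≈b′ (*-cong s≈s′ x≈x′)) (sym d′≈))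
      where
      x≈x′ = *-cancelˡ-≉0 ε≉0 (trans (*-comm _ _) (trans (x-slope b≈ c≉2 d≈ singular)
        (trans (+-congʳ (*-cong b≈b′ b≈b′)) (trans (sym (x-slope b′≈ c′≉2 d′≈ singular′)) (trans (*-congˡ (ε-cong (sym b≈b′) (sym s≈s′))) (*-comm _ _))))))
    functional {inj₂ _} {inj₂ _} (_ , _ , inj₁ (bb≉4 , _)) (_ , _ , inj₂ (_ , b′≈2u , uu≈1 , _)) (inj₂ (b≈b′ , _)) =
      contradiction (trans (*-cong b≈b′ b≈b′) (double⇒bb≈4 b′≈2u uu≈1)) bb≉4
    functional {inj₂ _} {inj₂ _} (_ , _ , inj₂ (_ , b≈2u , uu≈1 , _)) (_ , _ , inj₁ (b′b′≉4 , _)) (inj₂ (b≈b′ , _)) =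
      contradiction (trans (*-cong (sym b≈b′) (sym b≈b′)) (double⇒bb≈4 b≈2u uu≈1)) b′b′≉4
    functional {inj₂ _} {inj₂ _} (b≈ , _ , inj₂ (u , b≈2u , uu≈1 , d≈ , s≈)) (b′≈ , _ , inj₂ (u′ , b′≈2u′ , u′u′≈1 , d′≈ , s′≈)) (inj₂ (b≈b′ , s≈s′)) =
      trans (sym b≈) (trans b≈b′ b′≈) , 2-cancel x≈x′ , trans d≈ (trans (+-cong b≈b′ (*-cong u≈u′ x≈x′)) (sym d′≈))
      where
      u≈u′ = halves-agree b≈2u uu≈1 b′≈2u′ u′u′≈1 b≈b′
      x≈x′ = trans (solve 2 (λ u x → x := u :+ x :- u) refl u _) (trans (+-cong (trans (sym s≈) (trans s≈s′ s′≈)) (-‿cong u≈u′)) (solve 2 (λ u x → u :+ x :- u := x) refl u′ _))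

    injective : ∀ {s s′ t t′} → Parametrises s t → Parametrises s′ t′ → Setoid._≈_ Triples (proj₁ t) (proj₁ t′) → Setoid._≈_ Source s s′
    injective {inj₁ _} {inj₁ _} (lift (b≈ , _)) (lift (b′≈ , _)) (b≈b′ , _) = inj₁ (trans b≈ (trans b≈b′ (sym b′≈)))
    injective {inj₁ _} {inj₂ _} (lift (_ , c≈2 , _)) (_ , c′≉2 , _) (_ , c≈c′ , _) = contradiction (trans (sym c≈c′) c≈2) c′≉2
    injective {inj₂ _} {inj₁ _} (_ , c≉2 , _) (lift (_ , c′≈2 , _)) (_ , c≈c′ , _) = contradiction (trans c≈c′ c′≈2) c≉2
    injective {inj₂ ((b , s) , _)} {inj₂ ((b′ , s′) , _)} {(_ , c , d) , _} {(_ , c′ , d′) , _} (b≈ , c≉2 , on) (b′≈ , _ , on′) (b≈b′ , c≈c′ , d≈d′) = inj₂ (β≈β′ , slope on on′)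
      where
      β≈β′ : b ≈ b′
      β≈β′ = trans b≈ (trans b≈b′ (sym b′≈))
      x≈x′ : c - 2# ≈ c′ - 2#
      x≈x′ = +-congʳ c≈c′
      slope : OnSlope (b , s) (b , c , d) → OnSlope (b′ , s′) (b′ , c′ , d′) → s ≈ s′
      slope (inj₁ (_ , d≈)) (inj₁ (_ , d′≈)) = *-cancelˡ-≉0 (λ x≈0 → c≉2 (x-y≈0⇒x≈y x≈0)) (begin
        (c - 2#) * s                      ≈⟨ solve 3 (λ x s b → x :* s := b :+ s :* x :- b) refl (c - 2#) s b ⟩
        b + s * (c - 2#) - b              ≈⟨ +-cong (trans (sym d≈) (trans d≈d′ d′≈)) (-‿cong β≈β′) ⟩
        b′ + s′ * (c′ - 2#) - b′          ≈⟨ solve 3 (λ x s b → b :+ s :* x :- b := x :* s) refl (c′ - 2#) s′ b′ ⟩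
        (c′ - 2#) * s′                    ≈⟨ *-congʳ x≈x′ ⟨
        (c - 2#) * s′                     ∎)
      slope (inj₁ (bb≉4 , _)) (inj₂ (_ , b′≈2u , uu≈1 , _)) = contradiction (trans (*-cong β≈β′ β≈β′) (double⇒bb≈4 b′≈2u uu≈1)) bb≉4
      slope (inj₂ (_ , b≈2u , uu≈1 , _)) (inj₁ (b′b′≉4 , _)) = contradiction (trans (*-cong (sym β≈β′) (sym β≈β′)) (double⇒bb≈4 b≈2u uu≈1)) b′b′≉4
      slope (inj₂ (_ , b≈2u , uu≈1 , _ , s≈)) (inj₂ (_ , b′≈2u′ , u′u′≈1 , _ , s′≈)) =
        trans s≈ (trans (+-cong (halves-agree b≈2u uu≈1 b′≈2u′ u′u′≈1 β≈β′) x≈x′) (sym s′≈))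

  singular-resp : ∀ {s t} → Setoid._≈_ Triples s t → Singular s → Singular t
  singular-resp {b , c , d} {b′ , c′ , d′} (b≈ , c≈ , d≈) singular = trans (discriminant-affine b′ c′ d′) (trans
    (sym (+-cong (*-cong (+-congʳ (*-cong b≈ b≈)) x≈) (-‿cong (+-cong (+-cong (*-cong x≈ x≈) (-‿cong (*-cong (*-cong b≈ x≈) y≈))) (*-cong y≈ y≈)))))
    (trans (sym (discriminant-affine b c d)) singular))
    where
    x≈ = +-congʳ { - 2#} c≈
    y≈ = +-cong d≈ (-‿cong b≈)

  -- Here m is the number of pairs (b , s) with ε ≉ 0, so q + m counts the singular triples. The
  -- sizes are described by equations, which `nonsingular-total` solves for s.
  card-nonsingular : ∀ {k} → HasCardinality Nonzero k →
    ∃₂ λ m s → k ℕ.+ m ≡.≡ q ℕ.* q × q ℕ.+ m ℕ.+ s ≡.≡ q ℕ.* (q ℕ.* q) × HasCardinality (Subsetoid Triples (∁ Singular)) s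
  card-nonsingular N≅k =
    let m , k+m≡q*q , NZ≅m = card-complement {S = Slopes} (card-× cardinality cardinality) (λ (b , s) → ε b s ≟ 0#)
          (λ (b≈ , s≈) ε≈0 → trans (ε-cong (sym b≈) (sym s≈)) ε≈0) (card-Zero N≅k)
        singular≅ = card-correspondence {S = Source} {T = Subsetoid Triples Singular} (card-⊎ cardinality NZ≅m)
          Parametrises total surjective (λ {s} {s′} {t} {t′} → functional {s} {s′} {t} {t′}) (λ {s} {s′} {t} {t′} → injective {s} {s′} {t} {t′})
        s , q+m+s≡ , ns≅s = card-complement {S = Triples} (card-× cardinality (card-× cardinality cardinality))
          (λ t → discriminant (affine t) ≟ 0#) (λ {s} {t} → singular-resp {s} {t}) singular≅
    in m , s , k+m≡q*q , q+m+s≡ , ns≅s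

-- The four counts

module BalancedForms {c ℓ q} (F : FiniteField c ℓ q) where
  open Vector using ([]; _∷_)
  open FiniteField F
  open FieldLemmas F
  open IntegerSolver commutativeRing
  open Forms commutativeRing
  open Proportionality F
  open Hyperplanes F using (Balanced)
  open ≈-Reasoning setoid

  Normalised : Pred QuadraticForm ℓ
  Normalised a = a 0F ≈ 1# × a 3F ≈ 1# × a 5F ≈ 1#

  normalised⇒balanced : ∀ a → Normalised a → Balanced a
  normalised⇒balanced _ (a₀≈1 , a₃≈1 , a₅≈1) = trans a₀≈1 (sym a₃≈1) , trans a₅≈1 (sym a₃≈1)

  normalised⇒nonzero : ∀ a → Normalised a → ¬ (∀ i → a i ≈ 0#)
  normalised⇒nonzero _ (a₀≈1 , _) a≈0 = 1≉0 (trans (sym a₀≈1) (a≈0 0F))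

  normalise : ∀ a → Balanced a → a 0F ≉ 0# → ∃ λ b → a ∝ b × Normalised b
  normalise a (a₀≈a₃ , a₅≈a₃) a₀≉0 = let k , a₀k≈1 = inverse (a 0F) a₀≉0 ; ka₀≈1 = trans (*-comm k _) a₀k≈1 in
    k · a , ∝-sym (k , x*y≈1⇒x≉0 ka₀≈1 , λ _ → refl) ,
    ka₀≈1 , trans (*-congˡ (sym a₀≈a₃)) ka₀≈1 , trans (*-congˡ (trans a₅≈a₃ (sym a₀≈a₃))) ka₀≈1

  normalised-∝⇒≋ : ∀ a b → Normalised a → Normalised b → a ∝ b → a ≋ b
  normalised-∝⇒≋ _ _ (a₀≈1 , _) (b₀≈1 , _) (k , _ , a≋kb) i = trans (a≋kb i) (trans (*-congʳ k≈1) (*-identityˡ _))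
    where
    k≈1 : k ≈ 1#
    k≈1 = sym (trans (sym a₀≈1) (trans (a≋kb 0F) (trans (*-congˡ b₀≈1) (*-identityʳ k))))

  -- Up to scalars the balanced forms make up a projective 3-space; this is the plane complementary
  -- to the chart `affine`.
  AtInfinity : Pred QuadraticForm ℓ
  AtInfinity a = a 0F ≈ 0# × a 3F ≈ 0# × a 5F ≈ 0#

  atInfinity⇒balanced : ∀ a → AtInfinity a → Balanced a
  atInfinity⇒balanced _ (a₀≈0 , a₃≈0 , a₅≈0) = trans a₀≈0 (sym a₃≈0) , trans a₅≈0 (sym a₃≈0)

  balanced⇒atInfinity : ∀ a → Balanced a → a 0F ≈ 0# → AtInfinity a
  balanced⇒atInfinity _ (a₀≈a₃ , a₅≈a₃) a₀≈0 = a₀≈0 , trans (sym a₀≈a₃) a₀≈0 , trans a₅≈a₃ (trans (sym a₀≈a₃) a₀≈0)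

  normalised≁atInfinity : ∀ a b → Normalised a → AtInfinity b → ¬ (a ∝ b)
  normalised≁atInfinity _ _ (a₀≈1 , _) (b₀≈0 , _) (k , _ , a≋kb) = 1≉0 (trans (sym a₀≈1) (trans (a≋kb 0F) (trans (*-congˡ b₀≈0) (zeroʳ k))))

  discriminant-atInfinity : ∀ a → AtInfinity a → discriminant a ≈ a 1F * a 2F * a 4F
  discriminant-atInfinity a (a₀≈0 , a₃≈0 , a₅≈0) = begin
    discriminant a   ≈⟨ solve 6 (λ x b c y d z → 4 :× (x :* y :* z) :+ b :* c :* d :- x :* (d :* d) :- y :* (c :* c) :- z :* (b :* b) :=
                         b :* c :* d :+ (x :* (4 :× (y :* z) :- d :* d) :- y :* (c :* c) :- z :* (b :* b))) refl (a 0F) (a 1F) (a 2F) (a 3F) (a 4F) (a 5F) ⟩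
    a 1F * a 2F * a 4F + (a 0F * _ - a 3F * (a 2F * a 2F) - a 5F * (a 1F * a 1F))
                     ≈⟨ +-congˡ (+-cong (+-cong (*-congʳ a₀≈0) (-‿cong (*-congʳ a₃≈0))) (-‿cong (*-congʳ a₅≈0))) ⟩
    a 1F * a 2F * a 4F + (0# * _ - 0# * (a 2F * a 2F) - 0# * (a 1F * a 1F))
                     ≈⟨ solve 4 (λ t e c b → t :+ (:0 :* e :- :0 :* c :- :0 :* b) := t) refl (a 1F * a 2F * a 4F) _ (a 2F * a 2F) (a 1F * a 1F) ⟩
    a 1F * a 2F * a 4F  ∎

  infinite : Carrier × Carrier × Carrier → QuadraticForm
  infinite (b , c , d) = 0# ∷ b ∷ c ∷ 0# ∷ d ∷ 0# ∷ []

  infinite-∝ : ∀ a → AtInfinity a → ∀ k b c d → k ≉ 0# → a 1F ≈ k * b → a 2F ≈ k * c → a 4F ≈ k * d → a ∝ infinite (b , c , d)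
  infinite-∝ _ (a₀≈0 , a₃≈0 , a₅≈0) k _ _ _ k≉0 b≈ c≈ d≈ = k , k≉0 , λ where
    0F → trans a₀≈0 (sym (zeroʳ k))
    1F → b≈
    2F → c≈
    3F → trans a₃≈0 (sym (zeroʳ k))
    4F → d≈
    5F → trans a₅≈0 (sym (zeroʳ k))

  divide : ∀ {x} (x≉0 : x ≉ 0#) y → y ≈ x * (y * proj₁ (inverse x x≉0))
  divide {x} x≉0 y = let x⁻¹ , xx⁻¹≈1 = inverse x x≉0 in begin
    y               ≈⟨ *-identityˡ y ⟨
    1# * y          ≈⟨ *-congʳ xx⁻¹≈1 ⟨
    x * x⁻¹ * y     ≈⟨ solve 3 (λ x r y → x :* r :* y := x :* (y :* r)) refl x x⁻¹ y ⟩
    x * (y * x⁻¹)   ∎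

-- Double lines, real pairs and non-singular conics on L

module RationalCounts {c ℓ q} (F : FiniteField c ℓ q) (L : Projective.Line F 5) (L∈o₁₄,₁ : Projective.o₁₄,₁ F L) where
  open Vector using ([]; _∷_)
  open FiniteField F
  open Forms commutativeRing
  open Projective F
  open FieldLemmas F
  open IntegerSolver commutativeRing
  open Pullbacks commutativeRing
  open Proportionality F
  open Hyperplanes F
  open RationalClasses F
  open BalancedForms F
  open SingularConics F

  units : InverseClosed F ℓ
  units = record
    { G            = _≉ 0#
    ; inv          = λ u u≉0 → proj₁ (inverse u u≉0)
    ; inv-∈        = λ u u≉0 → x*y≈1⇒x≉0 (trans (*-comm _ u) (proj₂ (inverse u u≉0)))
    ; *-inv        = λ u u≉0 → proj₂ (inverse u u≉0)
    ; square-one⇒∈ = x*y≈1⇒x≉0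
    }

  module UnitTorus = Torus F units
  open UnitTorus hiding (SquareRootsOfOne)

  private
    normal-product : ∀ {a} l m → Normalised a → a ≋ l ⊡ m → l 0F * m 0F ≈ 1# × l 1F * m 1F ≈ 1# × l 2F * m 2F ≈ 1#
    normal-product _ _ (a₀≈1 , a₃≈1 , a₅≈1) a≋ = trans (sym (a≋ 0F)) a₀≈1 , trans (sym (a≋ 3F)) a₃≈1 , trans (sym (a≋ 5F)) a₅≈1

    ratio-≉0 : ∀ {x y x′ y′} → x * y ≈ 1# → x′ * y′ ≈ 1# → x′ * y ≉ 0#
    ratio-≉0 xy≈1 x′y′≈1 = *-≉0 (x*y≈1⇒x≉0 x′y′≈1) (x*y≈1⇒x≉0 (trans (*-comm _ _) xy≈1))

  -- A double line is a conic whose pair is fixed by σ, for then its two factors coincide. There is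
  -- none at infinity: zero diagonal coefficients klᵢ² make the whole form vanish.
  count-doubleLines : ∀ {f} → HasCardinality SquareRootsOfOne f → Count (𝓗₁ ∩ Contains L) (f ℕ.* f)
  count-doubleLines μ≅f = count-balanced L L∈o₁₄,₁ DoubleLine doubleLine-resp doubleLine-pullback
    (card-× μ≅f μ≅f) (conic ∘ pair) (λ s → normalised⇒nonzero (conic (pair s)) (conic-normalised (pair s))) (λ s → normalised⇒balanced (conic (pair s)) (conic-normalised (pair s)))
    (λ s → 1# , factor (pair s) , λ i → trans (⊡-cong {factor (pair s)} {factor (pair s)} {factor (σ (pair s))} {factor (pair s)} (λ _ → refl)
      (λ { 0F → refl ; 1F → sym (proj₁ (fixed s)) ; 2F → sym (proj₂ (fixed s)) }) i) (sym (*-identityˡ _)))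
    (λ {s} {t} s≈t → ≋⇒∝ (conic-cong {pair s} {pair t} s≈t))
    -- The second alternative of `conic-injective` is harmless here, as each pair is its own
    -- inverse.
    (λ {s} {t} s∝t → [ id , (λ s≈σt → trans (proj₁ s≈σt) (sym (proj₁ (fixed t))) , trans (proj₂ s≈σt) (sym (proj₂ (fixed t)))) ]′
      (conic-injective (pair s) (pair t) (normalised-∝⇒≋ (conic (pair s)) (conic (pair t)) (conic-normalised (pair s)) (conic-normalised (pair t)) s∝t)))
    surjective
    where
    pair : _ → Setoid.Carrier Pairs
    pair ((u , uu≈1) , (v , vv≈1)) = (u , x*y≈1⇒x≉0 uu≈1) , (v , x*y≈1⇒x≉0 vv≈1)

    fixed : ∀ s → Setoid._≈_ Pairs (pair s) (σ (pair s))
    fixed s@((_ , uu≈1) , (_ , vv≈1)) = fixed⇒≈σ (pair s) (uu≈1 , vv≈1)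

    atInfinity⇒zero : ∀ a → AtInfinity a → DoubleLine a → ∀ i → a i ≈ 0#
    atInfinity⇒zero a (a₀≈0 , a₃≈0 , a₅≈0) (k , l , a≋) with k ≟ 0#
    ... | yes k≈0 = λ i → trans (a≋ i) (trans (*-congʳ k≈0) (zeroˡ _))
    ... | no  k≉0 = λ i → trans (a≋ i) (trans (*-congˡ (trans (⊡-cong {l} {λ _ → 0#} {l} {λ _ → 0#} l≈0 l≈0 i) (zero-⊡ i))) (zeroʳ k))
      where
      root : ∀ {x y} → x ≈ k * (y * y) → x ≈ 0# → y ≈ 0#
      root x≈ x≈0 = square≈0⇒≈0 ([ (λ k≈0 → contradiction k≈0 k≉0) , id ]′ (x*y≈0⇒x≈0∨y≈0 (trans (sym x≈) x≈0)))
      l≈0 : ∀ i → l i ≈ 0#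
      l≈0 = λ { 0F → root (a≋ 0F) a₀≈0 ; 1F → root (a≋ 3F) a₃≈0 ; 2F → root (a≋ 5F) a₅≈0 }
      zero-⊡ : (λ _ → 0#) ⊡ (λ _ → 0#) ≋ (λ _ → 0#)
      zero-⊡ = λ { 0F → zeroˡ 0# ; 1F → 0*0+0*0 ; 2F → 0*0+0*0 ; 3F → zeroˡ 0# ; 4F → 0*0+0*0 ; 5F → zeroˡ 0# }
        where
        0*0+0*0 : 0# * 0# + 0# * 0# ≈ 0#
        0*0+0*0 = trans (+-cong (zeroˡ 0#) (zeroˡ 0#)) (+-identityˡ 0#)

    surjective : ∀ a → ¬ (∀ j → a j ≈ 0#) → Balanced a → DoubleLine a → ∃ λ s → a ∝ conic (pair s)
    surjective a a≉0 a-balanced a-double with a 0F ≟ 0#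
    ... | yes a₀≈0 = contradiction (atInfinity⇒zero a (balanced⇒atInfinity a a-balanced a₀≈0) a-double) a≉0
    ... | no  a₀≉0 =
      let b , a∝b , b-normal = normalise a a-balanced a₀≉0
          k , l , b≋ = doubleLine-resp a∝b a-double
          b≋kl⊡l = λ i → trans (b≋ i) (·-⊡ k l l i)
          p₀ , p₁ , p₂ = normal-product (k · l) l b-normal b≋kl⊡l
          -- kl² is read as the product of kl and l. The resulting ratios klᵢl₀ have square
          -- (kl₀²)(klᵢ²) = 1.
          module R = Factorisation (k · l) l p₀ p₁ p₂ (ratio-≉0 p₀ p₁) (ratio-≉0 p₀ p₂)
          s = (_ , square 1F k l p₀ p₁) , (_ , square 2F k l p₀ p₂)
      in s , ∝-trans a∝b (≋⇒∝ (λ i → trans (b≋kl⊡l i) (trans (R.conic-roots i) (conic-cong {R.roots} {pair s} (refl , refl) i))))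
      where
      square : ∀ i k (l : LinearForm) → k * l 0F * l 0F ≈ 1# → k * l i * l i ≈ 1# → k * l i * l 0F * (k * l i * l 0F) ≈ 1#
      square i k l p₀ pᵢ = trans (solve 3 (λ k x y → k :* x :* y :* (k :* x :* y) := k :* y :* y :* (k :* x :* x)) refl k (l i) (l 0F))
        (trans (*-cong p₀ pᵢ) (*-identityˡ 1#))

  private
    Corners : Setoid _ _
    Corners = ×-setoid (≡.setoid (Fin 3)) setoid

    -- The three sides of the coordinate triangle of PG(2,q), each without one vertex.
    corner : Fin 3 × Carrier → QuadraticForm
    corner (0F , t) = infinite (0# , 1# , t)
    corner (1F , t) = infinite (t , 0# , 1#)
    corner (2F , t) = infinite (1# , t , 0#)

    corner-atInfinity : ∀ s → AtInfinity (corner s)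
    corner-atInfinity = λ { (0F , _) → refl , refl , refl ; (1F , _) → refl , refl , refl ; (2F , _) → refl , refl , refl }

    corner-nonzero : ∀ s → ¬ (∀ i → corner s i ≈ 0#)
    corner-nonzero = λ { (0F , _) eq → 1≉0 (eq 2F) ; (1F , _) eq → 1≉0 (eq 4F) ; (2F , _) eq → 1≉0 (eq 1F) }

    corner-realPair : ∀ s → RealPair (corner s)
    corner-realPair (0F , t) = (1# ∷ t ∷ 0# ∷ []) , (0# ∷ 0# ∷ 1# ∷ []) , (λ (k , _ , eq) → 1≉0 (trans (eq 0F) (zeroʳ k))) , λ where
      0F → sym (zeroʳ 1#)
      1F → solve 1 (λ t → :0 := :1 :* :0 :+ t :* :0) refl t
      2F → solve 0 (:1 := :1 :* :1 :+ :0 :* :0) refl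
      3F → sym (zeroʳ t)
      4F → solve 1 (λ t → t := t :* :1 :+ :0 :* :0) refl t
      5F → sym (zeroˡ 1#)
    corner-realPair (1F , t) = (0# ∷ 1# ∷ 0# ∷ []) , (t ∷ 0# ∷ 1# ∷ []) , (λ (k , _ , eq) → 1≉0 (trans (eq 1F) (zeroʳ k))) , λ where
      0F → sym (zeroˡ t)
      1F → solve 1 (λ t → t := :0 :* :0 :+ :1 :* t) refl t
      2F → solve 1 (λ t → :0 := :0 :* :1 :+ :0 :* t) refl t
      3F → sym (zeroʳ 1#)
      4F → solve 0 (:1 := :1 :* :1 :+ :0 :* :0) refl
      5F → sym (zeroˡ 1#)
    corner-realPair (2F , t) = (1# ∷ 0# ∷ 0# ∷ []) , (0# ∷ 1# ∷ t ∷ []) , (λ (k , _ , eq) → 1≉0 (trans (eq 0F) (zeroʳ k))) , λ where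
      0F → sym (zeroʳ 1#)
      1F → solve 0 (:1 := :1 :* :1 :+ :0 :* :0) refl
      2F → solve 1 (λ t → t := :1 :* t :+ :0 :* :0) refl t
      3F → sym (zeroˡ 1#)
      4F → solve 1 (λ t → :0 := :0 :* t :+ :0 :* :1) refl t
      5F → sym (zeroˡ t)

    corner-cong : ∀ {s t} → Setoid._≈_ Corners s t → corner s ∝ corner t
    corner-cong {0F , _} (≡.refl , t≈) = ≋⇒∝ λ { 0F → refl ; 1F → refl ; 2F → refl ; 3F → refl ; 4F → t≈ ; 5F → refl }
    corner-cong {1F , _} (≡.refl , t≈) = ≋⇒∝ λ { 0F → refl ; 1F → t≈ ; 2F → refl ; 3F → refl ; 4F → refl ; 5F → refl }
    corner-cong {2F , _} (≡.refl , t≈) = ≋⇒∝ λ { 0F → refl ; 1F → refl ; 2F → t≈ ; 3F → refl ; 4F → refl ; 5F → refl }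

    corner-injective : ∀ {s t} → corner s ∝ corner t → Setoid._≈_ Corners s t
    corner-injective {0F , _} {0F , _} (k , _ , eq) = ≡.refl , trans (eq 4F) (trans (*-congʳ (trans (sym (*-identityʳ k)) (sym (eq 2F)))) (*-identityˡ _))
    corner-injective {1F , _} {1F , _} (k , _ , eq) = ≡.refl , trans (eq 1F) (trans (*-congʳ (trans (sym (*-identityʳ k)) (sym (eq 4F)))) (*-identityˡ _))
    corner-injective {2F , _} {2F , _} (k , _ , eq) = ≡.refl , trans (eq 2F) (trans (*-congʳ (trans (sym (*-identityʳ k)) (sym (eq 1F)))) (*-identityˡ _))
    corner-injective {0F , _} {1F , _} (k , _ , eq) = contradiction (trans (eq 2F) (zeroʳ k)) 1≉0
    corner-injective {1F , _} {2F , _} (k , _ , eq) = contradiction (trans (eq 4F) (zeroʳ k)) 1≉0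
    corner-injective {2F , _} {0F , _} (k , _ , eq) = contradiction (trans (eq 1F) (zeroʳ k)) 1≉0
    corner-injective {1F , _} {0F , _} (k , k≉0 , eq) = contradiction (trans (sym (*-identityʳ k)) (sym (eq 2F))) k≉0
    corner-injective {2F , _} {1F , _} (k , k≉0 , eq) = contradiction (trans (sym (*-identityʳ k)) (sym (eq 4F))) k≉0
    corner-injective {0F , _} {2F , _} (k , k≉0 , eq) = contradiction (trans (sym (*-identityʳ k)) (sym (eq 1F))) k≉0

    -- In the cyclic order b, c, d the first three clauses look for a zero followed by a nonzero
    -- coordinate. This puts each vertex of the triangle on just one of its two sides, hence 3q
    -- points in all.
    corner-surjective : ∀ a → AtInfinity a → ¬ (∀ i → a i ≈ 0#) → a 1F * a 2F * a 4F ≈ 0# → ∃ λ s → a ∝ corner s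
    corner-surjective a a∞ a≉0 bcd≈0 = choose (a 1F ≟ 0#) (a 2F ≟ 0#) (a 4F ≟ 0#)
      where
      ≈k*0 : ∀ {x k} → x ≈ 0# → x ≈ k * 0#
      ≈k*0 x≈0 = trans x≈0 (sym (zeroʳ _))
      choose : Dec (a 1F ≈ 0#) → Dec (a 2F ≈ 0#) → Dec (a 4F ≈ 0#) → ∃ λ s → a ∝ corner s
      choose (yes b≈0) (no c≉0) _ = (0F , _) , infinite-∝ a a∞ (a 2F) 0# 1# _ c≉0 (≈k*0 b≈0) (sym (*-identityʳ _)) (divide c≉0 _)
      choose _ (yes c≈0) (no d≉0) = (1F , _) , infinite-∝ a a∞ (a 4F) _ 0# 1# d≉0 (divide d≉0 _) (≈k*0 c≈0) (sym (*-identityʳ _))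
      choose (no b≉0) _ (yes d≈0) = (2F , _) , infinite-∝ a a∞ (a 1F) 1# _ 0# b≉0 (sym (*-identityʳ _)) (divide b≉0 _) (≈k*0 d≈0)
      choose (no b≉0) (no c≉0) (no d≉0) = contradiction bcd≈0 (*-≉0 (*-≉0 b≉0 c≉0) d≉0)
      choose (yes b≈0) (yes c≈0) (yes d≈0) = contradiction (λ { 0F → proj₁ a∞ ; 1F → b≈0 ; 2F → c≈0 ; 3F → proj₁ (proj₂ a∞) ; 4F → d≈0 ; 5F → proj₂ (proj₂ a∞) }) a≉0

  count-realPairs : ∀ {h} → HasCardinality Inversion.Orbits h → Count (𝓗₂,ᵣ ∩ Contains L) (h ℕ.+ 3 ℕ.* q)
  count-realPairs orbits≅h = count-balanced L L∈o₁₄,₁ RealPair realPair-resp realPair-pullback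
    (card-⊎ orbits≅h (card-× (Identity.inverse (≡.setoid (Fin 3))) cardinality)) f
    (λ { (inj₁ (x , _)) → normalised⇒nonzero (conic x) (conic-normalised x) ; (inj₂ s) → corner-nonzero s })
    (λ { (inj₁ (x , _)) → normalised⇒balanced (conic x) (conic-normalised x) ; (inj₂ s) → atInfinity⇒balanced (corner s) (corner-atInfinity s) })
    (λ { (inj₁ (x , x-moving)) → factor x , factor (σ x) , moving⇒factors≁ x x-moving , (λ _ → refl) ; (inj₂ s) → corner-realPair s })
    (λ {s} {t} → f-cong s t) (λ {s} {t} → f-injective s t) surjective
    where
    Source = ⊎-setoid Inversion.Orbits Corners

    f : Setoid.Carrier Source → QuadraticForm
    f (inj₁ (x , _)) = conic x
    f (inj₂ s)       = corner s

    f-cong : ∀ s t → Setoid._≈_ Source s t → f s ∝ f t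
    f-cong (inj₁ (x , _)) (inj₁ (y , _)) (inj₁ x~y) = ≋⇒∝ (conic-orbit x y x~y)
    f-cong (inj₂ s) (inj₂ t) (inj₂ s≈t) = corner-cong {s} {t} s≈t

    f-injective : ∀ s t → f s ∝ f t → Setoid._≈_ Source s t
    f-injective (inj₁ (x , _)) (inj₁ (y , _)) x∝y = inj₁ (conic-injective x y (normalised-∝⇒≋ (conic x) (conic y) (conic-normalised x) (conic-normalised y) x∝y))
    f-injective (inj₁ (x , _)) (inj₂ t) x∝t = contradiction x∝t (normalised≁atInfinity (conic x) (corner t) (conic-normalised x) (corner-atInfinity t))
    f-injective (inj₂ s) (inj₁ (y , _)) s∝y = contradiction (∝-sym s∝y) (normalised≁atInfinity (conic y) (corner s) (conic-normalised y) (corner-atInfinity s))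
    f-injective (inj₂ s) (inj₂ t) s∝t = inj₂ (corner-injective {s} {t} s∝t)

    moving-roots : ∀ b → Normalised b → RealPair b → ∃ λ (x : Setoid.Carrier Moving) → b ≋ conic (proj₁ x)
    moving-roots b b-normal (l , m , l≁m , b≋) = (R.roots , l≁m ∘ R.fixed⇒∝) , λ i → trans (b≋ i) (R.conic-roots i)
      where
      products = normal-product {b} l m b-normal b≋
      p₀ = proj₁ products
      p₁ = proj₁ (proj₂ products)
      p₂ = proj₂ (proj₂ products)
      module R = Factorisation l m p₀ p₁ p₂ (ratio-≉0 p₀ p₁) (ratio-≉0 p₀ p₂)

    surjective : ∀ a → ¬ (∀ j → a j ≈ 0#) → Balanced a → RealPair a → ∃ λ s → a ∝ f s
    surjective a a≉0 a-balanced a-pair = by-leading-coefficient (a 0F ≟ 0#)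
      where
      by-leading-coefficient : Dec (a 0F ≈ 0#) → ∃ λ s → a ∝ f s
      by-leading-coefficient (yes a₀≈0) =
        let a∞ = balanced⇒atInfinity a a-balanced a₀≈0
            -- A product of linear forms is singular, and at infinity this means bcd = 0.
            s , a∝s = corner-surjective a a∞ a≉0 (trans (sym (discriminant-atInfinity a a∞)) (realPair-singular a a-pair))
        in inj₂ s , a∝s
      by-leading-coefficient (no a₀≉0) =
        let b , a∝b , b-normal = normalise a a-balanced a₀≉0
            x , b≋x = moving-roots b b-normal (realPair-resp a∝b a-pair)
        in inj₁ x , ∝-trans a∝b (≋⇒∝ b≋x)

  -- At infinity non-singularity means bcd ≉ 0; scaling b to 1 leaves c and d as free units.
  count-nonsingular : ∀ {s k} → HasCardinality (Subsetoid Triples (∁ Singular)) s → HasCardinality Nonzero k →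
    Count (𝓗₃ ∩ Contains L) (s ℕ.+ k ℕ.* k)
  count-nonsingular ns≅s N≅k = count-balanced L L∈o₁₄,₁ Nonsingular nonsingular-resp nonsingular-pullback
    (card-⊎ ns≅s (card-× N≅k N≅k)) f
    (λ { s@(inj₁ _) → normalised⇒nonzero (f s) (refl , refl , refl) ; (inj₂ _) → λ eq → 1≉0 (eq 1F) })
    (λ { s@(inj₁ _) → normalised⇒balanced (f s) (refl , refl , refl) ; s@(inj₂ _) → atInfinity⇒balanced (f s) (refl , refl , refl) })
    (λ { (inj₁ (_ , ns)) → ns
       ; (inj₂ s@((_ , c≉0) , (_ , d≉0))) disc≈0 → *-≉0 (*-≉0 1≉0 c≉0) d≉0 (trans (sym (discriminant-atInfinity (f (inj₂ s)) (refl , refl , refl))) disc≈0) })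
    (λ { (inj₁ (b≈ , c≈ , d≈)) → ≋⇒∝ (λ { 0F → refl ; 1F → b≈ ; 2F → c≈ ; 3F → refl ; 4F → d≈ ; 5F → refl })
       ; (inj₂ (c≈ , d≈)) → ≋⇒∝ (λ { 0F → refl ; 1F → refl ; 2F → c≈ ; 3F → refl ; 4F → d≈ ; 5F → refl }) })
    (λ { {inj₁ s} {inj₁ t} s∝t → let s≋t = normalised-∝⇒≋ (f (inj₁ s)) (f (inj₁ t)) (refl , refl , refl) (refl , refl , refl) s∝t in inj₁ (s≋t 1F , s≋t 2F , s≋t 4F)
       ; {inj₁ s} {inj₂ t} s∝t → contradiction s∝t (normalised≁atInfinity (f (inj₁ s)) (f (inj₂ t)) (refl , refl , refl) (refl , refl , refl))
       ; {inj₂ s} {inj₁ t} s∝t → contradiction (∝-sym s∝t) (normalised≁atInfinity (f (inj₁ t)) (f (inj₂ s)) (refl , refl , refl) (refl , refl , refl))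
       ; {inj₂ _} {inj₂ _} (k , _ , eq) → let k≈1 = trans (sym (*-identityʳ k)) (sym (eq 1F)) in
           inj₂ (trans (eq 2F) (trans (*-congʳ k≈1) (*-identityˡ _)) , trans (eq 4F) (trans (*-congʳ k≈1) (*-identityˡ _))) })
    surjective
    where
    f : ∃ (∁ Singular) ⊎ (Setoid.Carrier Nonzero × Setoid.Carrier Nonzero) → QuadraticForm
    f (inj₁ (t , _)) = affine t
    f (inj₂ ((c , _) , (d , _))) = infinite (1# , c , d)

    surjective : ∀ a → ¬ (∀ j → a j ≈ 0#) → Balanced a → Nonsingular a → ∃ λ s → a ∝ f s
    surjective a _ a-balanced a-ns = by-leading-coefficient (a 0F ≟ 0#)
      where
      by-leading-coefficient : Dec (a 0F ≈ 0#) → ∃ λ s → a ∝ f s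
      by-leading-coefficient (no a₀≉0) =
        let b , a∝b , b₀≈1 , b₃≈1 , b₅≈1 = normalise a a-balanced a₀≉0
            b≋ : b ≋ affine (b 1F , b 2F , b 4F)
            b≋ = λ { 0F → b₀≈1 ; 1F → refl ; 2F → refl ; 3F → b₃≈1 ; 4F → refl ; 5F → b₅≈1 }
        in inj₁ ((b 1F , b 2F , b 4F) , nonsingular-resp (∝-trans a∝b (≋⇒∝ b≋)) a-ns) , ∝-trans a∝b (≋⇒∝ b≋)
      by-leading-coefficient (yes a₀≈0) =
        inj₂ ((_ , quotient≉0 c≉0) , (_ , quotient≉0 d≉0)) , infinite-∝ a a∞ (a 1F) 1# _ _ b≉0 (sym (*-identityʳ _)) (divide b≉0 _) (divide b≉0 _)
        where
        a∞ = balanced⇒atInfinity a a-balanced a₀≈0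
        bcd≉0 : a 1F * a 2F * a 4F ≉ 0#
        bcd≉0 eq = a-ns (trans (discriminant-atInfinity a a∞) eq)
        b≉0 : a 1F ≉ 0#
        b≉0 = x*y≉0⇒x≉0 (x*y≉0⇒x≉0 bcd≉0)
        c≉0 : a 2F ≉ 0#
        c≉0 c≈0 = x*y≉0⇒x≉0 bcd≉0 (trans (*-congˡ c≈0) (zeroʳ _))
        d≉0 : a 4F ≉ 0#
        d≉0 d≈0 = bcd≉0 (trans (*-congˡ d≈0) (zeroʳ _))
        quotient≉0 : ∀ {y} → y ≉ 0# → y * proj₁ (inverse (a 1F) b≉0) ≉ 0#
        quotient≉0 y≉0 = *-≉0 y≉0 (x*y≈1⇒x≉0 (trans (*-comm _ _) (proj₂ (inverse (a 1F) b≉0))))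

-- Pairs of conjugate imaginary lines on L

module ImaginaryPairs {c ℓ c′ ℓ′ q} (q-primePower : IsPrimePower q)
  (F : FiniteField c ℓ q) (E : QuadraticExtension F c′ ℓ′) where
  private
    module F where
      open FiniteField F public
      open Forms (FiniteField.commutativeRing F) public
      open Proportionality F public
      open FieldLemmas F public
      open BalancedForms F public
      open Hyperplanes F public
      open Projective F public
  open QuadraticExtension E
  open Extension q-primePower F E
  open ImaginaryClass q-primePower F E
  open FieldLemmas field₂
  open IntegerSolver commutativeRing
  open Forms commutativeRing
  open Pullbacks commutativeRing
  open Proportionality field₂
  open ≈-Reasoning setoid

  -- A square root of one is 1 or -1 and so comes from `F`; therefore it has norm one.
  conj-square-one : ∀ {u} → u * u ≈ 1# → conj u ≈ u
  conj-square-one {u} uu≈1 = [ (λ u-1≈0 → fixed ι-1 (x-y≈0⇒x≈y u-1≈0)) , (λ u+1≈0 → fixed (trans (ι-neg F.1#) (-‿cong ι-1)) (x-y≈0⇒x≈y u+1≈0)) ]′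
    (x*y≈0⇒x≈0∨y≈0 (trans (solve 1 (λ u → (u :- :1) :* (u :- (:- :1)) := u :* u :- :1) refl u) (x≈y⇒x-y≈0 uu≈1)))
    where
    fixed : ∀ {x y} → ι x ≈ y → u ≈ y → conj u ≈ u
    fixed {x} ιx≈y u≈y = let u≈ιx = trans u≈y (sym ιx≈y) in trans (conj-cong u≈ιx) (trans (conj-ι x) (sym u≈ιx))

  normOnes : InverseClosed field₂ ℓ′
  normOnes = record
    { G            = NormOne
    ; inv          = λ u _ → conj u
    ; inv-∈        = λ u uū≈1 → trans (*-congˡ (conj-conj u)) (trans (*-comm _ _) uū≈1)
    ; *-inv        = λ _ uū≈1 → uū≈1
    ; square-one⇒∈ = λ uu≈1 → trans (*-congˡ (conj-square-one uu≈1)) uu≈1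
    }

  module NormTorus = Torus field₂ normOnes
  open NormTorus

  private
    conj-factor : ∀ x → conj ∘ factor x ≋ factor (σ x)
    conj-factor x = λ { 0F → conj-1 ; 1F → refl ; 2F → refl }

    conj-⊡ : ∀ l m → conj ∘ (l ⊡ m) ≋ (conj ∘ l) ⊡ (conj ∘ m)
    conj-⊡ l m = λ where
      0F → conj-* _ _
      1F → trans (conj-+ _ _) (+-cong (conj-* _ _) (conj-* _ _))
      2F → trans (conj-+ _ _) (+-cong (conj-* _ _) (conj-* _ _))
      3F → conj-* _ _
      4F → trans (conj-+ _ _) (+-cong (conj-* _ _) (conj-* _ _))
      5F → conj-* _ _

    conj-conic : ∀ x → conj ∘ conic x ≋ conic x
    conj-conic x i = trans (conj-⊡ (factor x) (factor (σ x)) i) (trans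
      (⊡-cong {conj ∘ factor x} {factor (σ x)} {conj ∘ factor (σ x)} {factor x} (conj-factor x)
        (λ { 0F → conj-1 ; 1F → conj-conj _ ; 2F → conj-conj _ }) i)
      (⊡-comm (factor (σ x)) (factor x) i))

    abstract
      rational : ∀ x → ∃ λ (a : F.QuadraticForm) → ι ∘ a ≋ conic x
      -- Conjugation exchanges the two factors of the conic, so its coefficients are fixed by `conj`
      -- and descend to `F`.
      rational x = (λ i → proj₁ (conj-fixed⇒ι (conj-conic x i))) , (λ i → proj₂ (conj-fixed⇒ι (conj-conic x i)))

    rationalConic : Setoid.Carrier Pairs → F.QuadraticForm
    rationalConic x = proj₁ (rational x)

    ι-rationalConic : ∀ x → ι ∘ rationalConic x ≋ conic x
    ι-rationalConic x = proj₂ (rational x)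

    rationalConic-normalised : ∀ x → F.Normalised (rationalConic x)
    rationalConic-normalised x = let c₀≈1 , c₃≈1 , c₅≈1 = conic-normalised x in
      descend 0F c₀≈1 , descend 3F c₃≈1 , descend 5F c₅≈1
      where
      descend : ∀ i → conic x i ≈ 1# → rationalConic x i F.≈ F.1#
      descend i cᵢ≈1 = ι-injective (trans (ι-rationalConic x i) (trans cᵢ≈1 (sym ι-1)))

    rationalConic-imaginary : ∀ x → ¬ Fixed x → ImaginaryPair (rationalConic x)
    rationalConic-imaginary x x-moving = F.1# , factor x ,
      (λ x∝x̄ → moving⇒factors≁ x x-moving (∝-trans x∝x̄ (≋⇒∝ (conj-factor x)))) ,
      λ i → trans (ι-rationalConic x i) (trans
        (⊡-cong {factor x} {factor x} {factor (σ x)} {conj ∘ factor x} (λ _ → refl) (λ j → sym (conj-factor x j)) i)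
        (trans (sym (*-identityˡ _)) (*-congʳ (sym ι-1))))

    -- The norm is anisotropic: vanishing diagonal coefficients k · lᵢ · conj lᵢ with k nonzero
    -- force all lᵢ to vanish.
    atInfinity⇒zero : ∀ a → F.AtInfinity a → ImaginaryPair a → ∀ i → a i F.≈ F.0#
    atInfinity⇒zero a (a₀≈0 , a₃≈0 , a₅≈0) (k , l , l≁l̄ , a≋) = by-scalar (ι k ≟ 0#)
      where
      by-scalar : Dec (ι k ≈ 0#) → ∀ i → a i F.≈ F.0#
      by-scalar (yes k≈0) i = ι-injective (trans (a≋ i) (trans (*-congʳ k≈0) (trans (zeroˡ _) (sym ι-0))))
      -- The zero form would be proportional to its conjugate, with scalar 1, against the assumption
      -- on `l`.
      by-scalar (no  k≉0) = contradiction (1# , 1≉0 , λ i → trans (l≈0 i) (sym (trans (*-identityˡ _) (trans (conj-cong (trans (l≈0 i) (sym ι-0))) (trans (conj-ι F.0#) ι-0))))) l≁l̄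
        where
        root : ∀ {x y} → ι x ≈ ι k * (y * conj y) → x F.≈ F.0# → y ≈ 0#
        root {x} {y} x≈ x≈0 = by-zero (y ≟ 0#)
          where
          by-zero : Dec (y ≈ 0#) → y ≈ 0#
          by-zero (yes y≈0) = y≈0
          by-zero (no  y≉0) = contradiction (trans (sym x≈) (trans (ι-cong x≈0) ι-0)) (*-≉0 k≉0 (*-≉0 y≉0 (conj-≉0 y≉0)))
        l≈0 : ∀ i → l i ≈ 0#
        l≈0 = λ { 0F → root (a≋ 0F) a₀≈0 ; 1F → root (a≋ 3F) a₃≈0 ; 2F → root (a≋ 5F) a₅≈0 }

    -- The rational scalar k joins the first factor. The ratios klᵢl̄₀ then have norm
    -- (kl₀l̄₀)(klᵢl̄ᵢ) = 1, and a fixed pair would make l proportional to l̄.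
    moving-roots : ∀ b → F.Normalised b → ImaginaryPair b → ∃ λ (x : Setoid.Carrier Moving) → b F.≋ rationalConic (proj₁ x)
    moving-roots b (b₀≈1 , b₃≈1 , b₅≈1) (k , l , l≁l̄ , b≋) =
      (R.roots , λ fixed → l≁l̄ (∝-trans (∝-sym (ι k , k≉0 , λ _ → refl)) (R.fixed⇒∝ fixed))) ,
      λ i → ι-injective (trans (b≋kl⊡l̄ i) (trans (R.conic-roots i) (sym (ι-rationalConic R.roots i))))
      where
      l̄ = conj ∘ l
      b≋kl⊡l̄ : ι ∘ b ≋ (ι k · l) ⊡ l̄
      b≋kl⊡l̄ i = trans (b≋ i) (·-⊡ (ι k) l l̄ i)
      p₀ : ι k * l 0F * l̄ 0F ≈ 1#
      p₀ = trans (sym (b≋kl⊡l̄ 0F)) (trans (ι-cong b₀≈1) ι-1)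
      p₁ : ι k * l 1F * l̄ 1F ≈ 1#
      p₁ = trans (sym (b≋kl⊡l̄ 3F)) (trans (ι-cong b₃≈1) ι-1)
      p₂ : ι k * l 2F * l̄ 2F ≈ 1#
      p₂ = trans (sym (b≋kl⊡l̄ 5F)) (trans (ι-cong b₅≈1) ι-1)
      k≉0 : ι k ≉ 0#
      k≉0 = x*y≉0⇒x≉0 (x*y≈1⇒x≉0 p₀)
      norm : ∀ i → ι k * l i * l̄ i ≈ 1# → NormOne (ι k * l i * l̄ 0F)
      norm i pᵢ = begin
        ι k * l i * l̄ 0F * conj (ι k * l i * l̄ 0F)         ≈⟨ *-congˡ (trans (conj-* _ _) (*-cong (trans (conj-* _ _) (*-congʳ (conj-ι k))) (conj-conj _))) ⟩
        ι k * l i * l̄ 0F * (ι k * l̄ i * l 0F)              ≈⟨ solve 5 (λ k a b c d → k :* a :* b :* (k :* c :* d) := k :* d :* b :* (k :* a :* c)) refl (ι k) (l i) (l̄ 0F) (l̄ i) (l 0F) ⟩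
        ι k * l 0F * l̄ 0F * (ι k * l i * l̄ i)              ≈⟨ trans (*-cong p₀ pᵢ) (*-identityˡ 1#) ⟩
        1#                                                 ∎
      module R = Factorisation (ι k · l) l̄ p₀ p₁ p₂ (norm 1F p₁) (norm 2F p₂)

  module _ (L : F.Line 5) (L∈o₁₄,₁ : F.o₁₄,₁ L) where

    count-imaginaryPairs : ∀ {h} → HasCardinality Inversion.Orbits h → F.Count (F.𝓗₂,ᵢ E ∩ F.Contains L) h
    count-imaginaryPairs orbits≅h = F.count-balanced L L∈o₁₄,₁ ImaginaryPair imaginaryPair-resp imaginaryPair-pullback
      orbits≅h (rationalConic ∘ proj₁)
      (λ (x , _) → F.normalised⇒nonzero (rationalConic x) (rationalConic-normalised x))
      (λ (x , _) → F.normalised⇒balanced (rationalConic x) (rationalConic-normalised x))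
      (λ (x , x-moving) → rationalConic-imaginary x x-moving)
      (λ {s} {t} → cong s t) (λ {s} {t} → injective s t) surjective
      where
      cong : ∀ s t → Setoid._≈_ Inversion.Orbits s t → rationalConic (proj₁ s) F.∝ rationalConic (proj₁ t)
      cong (x , _) (y , _) x~y = F.≋⇒∝ (λ i → ι-injective (trans (ι-rationalConic x i) (trans (conic-orbit x y x~y i) (sym (ι-rationalConic y i)))))

      injective : ∀ s t → rationalConic (proj₁ s) F.∝ rationalConic (proj₁ t) → Setoid._≈_ Inversion.Orbits s t
      injective (x , _) (y , _) x∝y = conic-injective x y λ i → trans (sym (ι-rationalConic x i))
        (trans (ι-cong (F.normalised-∝⇒≋ (rationalConic x) (rationalConic y) (rationalConic-normalised x) (rationalConic-normalised y) x∝y i)) (ι-rationalConic y i))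

      surjective : ∀ a → ¬ (∀ j → a j F.≈ F.0#) → F.Balanced a → ImaginaryPair a → ∃ λ s → a F.∝ rationalConic (proj₁ s)
      surjective a a≉0 a-balanced a-pair = by-leading-coefficient (a 0F F.≟ F.0#)
        where
        by-leading-coefficient : Dec (a 0F F.≈ F.0#) → ∃ λ s → a F.∝ rationalConic (proj₁ s)
        by-leading-coefficient (yes a₀≈0) = contradiction (atInfinity⇒zero a (F.balanced⇒atInfinity a a-balanced a₀≈0) a-pair) a≉0
        by-leading-coefficient (no a₀≉0) =
          let b , a∝b , b-normal = F.normalise a a-balanced a₀≉0
              x , b≋x = moving-roots b b-normal (imaginaryPair-resp a∝b a-pair)
          in x , F.∝-trans a∝b (F.≋⇒∝ b≋x)

-- Arithmetic of the counts

open import Data.Nat.Base using (_+_; _*_; _∸_; _^_; _/_)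
open import Data.Vec.Base using (_∷_; [])
open ≡ using (refl; sym; trans; cong; subst)

halve-double : ∀ m {n} → n ≡ m * 2 → n / 2 ≡ m
halve-double m refl = m*n/n≡m m 2

double-cancel : ∀ {m n} → m + m ≡ n + n → m ≡ n
double-cancel {m} {n} eq = ℕ.*-cancelʳ-≡ m n 2 (trans (two m) (trans eq (sym (two n))))
  where
  two : ∀ m → m * 2 ≡ m + m
  two = solve-∀

-- For k = q - 1 one has q² - 1 = k² + 2k = 2(h + 2 + k), which evaluates the quotient; the
-- truncated `∸ 1` acts on a positive number.
odd-realPairs : ∀ {q} k h → suc k ≡ q → 4 + (h + h) ≡ k * k → h + 3 * q ≡ (q ^ 2 ∸ 1) / 2 + 2 * q ∸ 1
odd-realPairs k h refl 4+2h≡k² = trans (total h k) (cong (λ x → x + 2 * suc k ∸ 1) (sym (halve-double (h + 2 + k)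
  (trans (square k) (trans (cong (2 * k +_) (sym 4+2h≡k²)) (regroup h k))))))
  where
  square : ∀ k → suc k ^ 2 ∸ 1 ≡ 2 * k + k * k
  square k = cong (_∸ 1) (expand k)
    where
    expand : ∀ k → suc k * (suc k * 1) ≡ suc (2 * k + k * k)
    expand = solve-∀
  regroup : ∀ h k → 2 * k + (4 + (h + h)) ≡ (h + 2 + k) * 2
  regroup = solve-∀
  total : ∀ h k → h + 3 * suc k ≡ h + 2 + k + 2 * suc k ∸ 1
  total h k = cong (_∸ 1) (expand h k)
    where
    expand : ∀ h k → suc (h + 3 * suc k) ≡ h + 2 + k + 2 * suc k
    expand = solve-∀

-- For k = q - 1 one has q² = k² + 2k + 1 = 2(h + 1 + k).
even-realPairs : ∀ {q} k h → suc k ≡ q → 1 + (h + h) ≡ k * k → h + 3 * q ≡ q ^ 2 / 2 + 2 * q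
even-realPairs k h refl 1+2h≡k² = trans (total h k) (cong (_+ 2 * suc k) (sym (halve-double (h + suc k)
  (trans (square k) (trans (cong (2 * k + 1 +_) (sym 1+2h≡k²)) (regroup h k))))))
  where
  square : ∀ k → suc k * (suc k * 1) ≡ 2 * k + 1 + k * k
  square = solve-∀
  regroup : ∀ h k → 2 * k + 1 + (1 + (h + h)) ≡ (h + suc k) * 2
  regroup = solve-∀
  total : ∀ h k → h + 3 * suc k ≡ h + suc k + 2 * suc k
  total = solve-∀

-- With q = 2r + 1 both sides become polynomials in r: (q² - 1)/2 = 2r² + 2r and h = 2r² + 4r.
odd-imaginaryPairs : ∀ {q} r → suc (r + r) ≡ q → ∀ h → 4 + (h + h) ≡ suc q * suc q → h ≡ (q ^ 2 ∸ 1) / 2 + q ∸ 1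
odd-imaginaryPairs r refl h 4+2h≡ = trans h≡ (trans (total r) (cong (λ x → x + suc (r + r) ∸ 1) (sym (halve-double (2 * (r * r) + 2 * r) (square r)))))
  where
  expand : ∀ r → suc (suc (r + r)) * suc (suc (r + r)) ≡ 4 + ((2 * (r * r) + 4 * r) + (2 * (r * r) + 4 * r))
  expand = solve-∀
  h≡ : h ≡ 2 * (r * r) + 4 * r
  h≡ = double-cancel (ℕ.+-cancelˡ-≡ 4 _ _ (trans 4+2h≡ (expand r)))
  square : ∀ r → suc (r + r) ^ 2 ∸ 1 ≡ (2 * (r * r) + 2 * r) * 2
  square r = cong (_∸ 1) (expand′ r)
    where
    expand′ : ∀ r → suc (r + r) * (suc (r + r) * 1) ≡ suc ((2 * (r * r) + 2 * r) * 2)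
    expand′ = solve-∀
  total : ∀ r → 2 * (r * r) + 4 * r ≡ 2 * (r * r) + 2 * r + suc (r + r) ∸ 1
  total r = cong (_∸ 1) (expand′ r)
    where
    expand′ : ∀ r → suc (2 * (r * r) + 4 * r) ≡ 2 * (r * r) + 2 * r + suc (r + r)
    expand′ = solve-∀

-- With q = 2r one has q²/2 = 2r² and h = 2r² + 2r.
even-imaginaryPairs : ∀ {q} r → r + r ≡ q → ∀ h → 1 + (h + h) ≡ suc q * suc q → h ≡ q ^ 2 / 2 + q
even-imaginaryPairs r refl h 1+2h≡ = trans h≡ (cong (_+ (r + r)) (sym (halve-double (2 * (r * r)) (square r))))
  where
  expand : ∀ r → suc (r + r) * suc (r + r) ≡ 1 + ((2 * (r * r) + (r + r)) + (2 * (r * r) + (r + r)))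
  expand = solve-∀
  h≡ : h ≡ 2 * (r * r) + (r + r)
  h≡ = double-cancel (ℕ.+-cancelˡ-≡ 1 _ _ (trans 1+2h≡ (expand r)))
  square : ∀ r → (r + r) * ((r + r) * 1) ≡ 2 * (r * r) * 2
  square = solve-∀

-- The first equations give m = k² + k + 1, so q + m exceeds k² by exactly 2q.
nonsingular-total : ∀ {q} k m s → suc k ≡ q → k + m ≡ q * q → q + m + s ≡ q * (q * q) → s + k * k ≡ q ^ 3 ∸ 2 * q
nonsingular-total k m s refl k+m≡q² total = sym (trans (cong (_∸ 2 * suc k) cube) (ℕ.m+n∸n≡m (s + k * k) (2 * suc k)))
  where
  expand : ∀ k → suc k * suc k ≡ k + suc (k + k * k)
  expand = solve-∀
  m≡ : m ≡ suc (k + k * k)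
  m≡ = ℕ.+-cancelˡ-≡ k _ _ (trans k+m≡q² (expand k))
  cube′ : ∀ k → suc k * (suc k * (suc k * 1)) ≡ suc k * (suc k * suc k)
  cube′ = solve-∀
  regroup : ∀ k s → suc k + suc (k + k * k) + s ≡ s + k * k + 2 * suc k
  regroup = solve-∀
  cube : suc k ^ 3 ≡ s + k * k + 2 * suc k
  cube = trans (cube′ k) (trans (sym total) (trans (cong (λ m → suc k + m + s) m≡) (regroup k s)))

2∣r+r : ∀ r → 2 ∣ r + r
2∣r+r r = divides r (two r)
  where
  two : ∀ r → r + r ≡ r * 2
  two = solve-∀

2∤1+r+r : ∀ r → ¬ (2 ∣ suc (r + r))
2∤1+r+r r 2∣1+2r with ∣⇒≤ (∣m+n∣m⇒∣n (subst (2 ∣_) (ℕ.+-comm 1 (r + r)) 2∣1+2r) (2∣r+r r))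
... | s≤s ()

lemma4p15 : ∀ {c ℓ c′ ℓ′} (q : ℕ) → IsPrimePower q →
    (F : FiniteField c ℓ q) (E : QuadraticExtension F c′ ℓ′) →
    let open Projective F in
    (L : Line 5) → o₁₄,₁ L →
    (¬ (2 ∣ q) →
    OD₄ E L (4 ∷
    (q ^ 2 ∸ 1) / 2 + 2 * q ∸ 1 ∷
    (q ^ 2 ∸ 1) / 2 + q ∸ 1 ∷
    q ^ 3 ∸ 2 * q ∷ [])) ×
    (2 ∣ q →
    OD₄ E L (1 ∷
    q ^ 2 / 2 + 2 * q ∷
    q ^ 2 / 2 + q ∷
    q ^ 3 ∸ 2 * q ∷ []))
lemma4p15 q q-primePower F E L L∈o₁₄,₁ = odd , even
  where
  module F where
    open FiniteField F public
    open FieldLemmas F public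
    open SingularConics F public
    open Projective F public
  module E where
    open QuadraticExtension E public
    open Extension q-primePower F E public
    open SingularConics (QuadraticExtension.field₂ E) public
    open ImaginaryPairs q-primePower F E public
  open RationalCounts F L L∈o₁₄,₁

  -- Both parities at once: the same f serves for `F` and `E`, because ι carries 1 + 1 to 1 + 1 and
  -- reflects its vanishing. The arithmetic is supplied separately for each parity.
  distribution : ∀ {f h₁ h₂ h₃ h₄} → HasCardinality F.SquareRootsOfOne f → HasCardinality E.SquareRootsOfOne f →
    f * f ≡ h₁ →
    (∀ k h → suc k ≡ q → f * f + (h + h) ≡ k * k → h + 3 * q ≡ h₂) →
    (∀ h → f * f + (h + h) ≡ suc q * suc q → h ≡ h₃) →
    (∀ k m s → suc k ≡ q → k + m ≡ q * q → q + m + s ≡ q * (q * q) → s + k * k ≡ h₄) →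
    F.OD₄ E L (h₁ ∷ h₂ ∷ h₃ ∷ h₄ ∷ [])
  distribution μF≅f μE≅f h₁≡ h₂≡ h₃≡ h₄≡ =
    let k , 1+k≡q , N≅k = F.card-nonzero
        hᵣ , real≡ , real≅ = UnitTorus.card-inversion-orbits N≅k μF≅f
        hᵢ , imaginary≡ , imaginary≅ = E.NormTorus.card-inversion-orbits E.card-normOne μE≅f
        m , s , k+m≡ , total , ns≅s = F.card-nonsingular N≅k
    in subst (F.Count _) h₁≡ (count-doubleLines μF≅f) ,
       subst (F.Count _) (h₂≡ k hᵣ 1+k≡q real≡) (count-realPairs real≅) ,
       subst (F.Count _) (h₃≡ hᵢ imaginary≡) (E.count-imaginaryPairs L L∈o₁₄,₁ imaginary≅) ,
       subst (F.Count _) (h₄≡ k m s 1+k≡q k+m≡ total) (count-nonsingular ns≅s N≅k)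

  ι-1+1 : E.ι (F.1# F.+ F.1#) E.≈ E.1# E.+ E.1#
  ι-1+1 = E.trans (E.ι-+ F.1# F.1#) (E.+-cong E.ι-1 E.ι-1)

  odd : ¬ (2 ∣ q) → F.OD₄ E L (4 ∷ (q ^ 2 ∸ 1) / 2 + 2 * q ∸ 1 ∷ (q ^ 2 ∸ 1) / 2 + q ∸ 1 ∷ q ^ 3 ∸ 2 * q ∷ [])
  odd 2∤q = distribution (F.card-square-roots-odd 2≉0) (E.card-square-roots-odd (λ 2≈0 → E.ι-≉0 2≉0 (E.trans ι-1+1 2≈0)))
    refl odd-realPairs (odd-imaginaryPairs (proj₁ half) (proj₂ half)) nonsingular-total
    where
    -- The free involution x ↦ x + 1 would make q even.
    2≉0 : F.1# F.+ F.1# F.≉ F.0#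
    2≉0 2≈0 = let r , r+r≡q = F.1+1≈0⇒even 2≈0 in 2∤q (subst (2 ∣_) r+r≡q (2∣r+r r))
    half : ∃ λ r → suc (r + r) ≡ q
    half = F.1+1≉0⇒odd 2≉0

  even : 2 ∣ q → F.OD₄ E L (1 ∷ q ^ 2 / 2 + 2 * q ∷ q ^ 2 / 2 + q ∷ q ^ 3 ∸ 2 * q ∷ [])
  even 2∣q = distribution (F.card-square-roots-even 2≈0)
    (E.card-square-roots-even (E.trans (E.sym ι-1+1) (E.trans (E.ι-cong 2≈0) E.ι-0)))
    refl even-realPairs (even-imaginaryPairs (proj₁ half) (proj₂ half)) nonsingular-total
    where
    2≈0 : F.1# F.+ F.1# F.≈ F.0#
    2≈0 = decidable-stable (F.1# F.+ F.1# F.≟ F.0#) λ 2≉0 →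
      let r , 1+r+r≡q = F.1+1≉0⇒odd 2≉0 in 2∤1+r+r r (subst (2 ∣_) (sym 1+r+r≡q) 2∣q)
    half : ∃ λ r → r + r ≡ q
    half = F.1+1≈0⇒even 2≈0
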